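{- Effectors with unlimited budget ($b=\infty$) is solvable in $O(4^r\cdot n^4)$ time, where $n=|V|$ is the number of nodes and $r=|\{u\to v\in E: w(u\to v)<1\}|$ is the number of probabilistic arcs of the input influence graph $G=(V,E,w)$.
   Context: An influence graph $G=(V,E,w)$ is a finite simple directed graph (no loops) with a weight function $w:E\to(0,1]\cap\mathbb{Q}$. Independent Cascade process started from $X\subseteq V$: at time $0$ exactly the nodes in $X$ are active. When a node $u$ becomes active for the first time, at time step $t$, it gets a single chance to activate each currently inactive out-neighbor $v$, succeeding with probability $w(u\to v)$, all attempts being independent; if it succeeds, $v$ becomes active at step $t+1$; if it fails, $u$ makes no further attempts on $v$. Active nodes stay active. The process terminates when there are no newly activated nodes. Let $p(v|X)$ be the probability that $v$ is active upon termination. Cost: for $A\subseteq V$ and $X\subseteq V$, $C_A(G,X):=\sum_{v\in A}(1-p(v|X))+\sum_{v\in V\setminus A}p(v|X)$. Effectors: given an influence graph $G=(V,E,w)$, a set of target nodes $A\subseteq V$, a budget $b$ and a cost $c\in\mathbb{Q}$, decide whether there is a set $X\subseteq V$ (of effectors) with $|X|\le b$ and $C_A(G,X)\le c$. Unlimited budget ($b=\infty$) means that there is no restriction on $|X|$. Running-time convention: the precision of the probabilities given by $w$ is polynomially bounded in $n$, and additions and multiplications of rational numbers are assumed to take constant time. -}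

module Defs where

open import Data.Bool.Base using (Bool; true; false; if_then_else_; _∨_)
open import Data.Fin.Base using (Fin)
open import Data.Fin.Subset using (Subset; ∣_∣; ∁; _∪_)
open import Data.List.Base as List
  using (List; []; _∷_; allFin; cartesianProduct; concatMap; filterᵇ; foldr; length)
open import Data.Maybe.Base using (Maybe; just; nothing)
open import Data.Nat.Base as ℕ using (ℕ; zero; suc)
open import Data.Nat.Logarithm using (⌈log₂_⌉)
open import Data.Integer.Base as ℤ using ()
open import Data.Product.Base using (Σ-syntax; _×_; _,_)
open import Data.Rational.Base as ℚ using (ℚ; 0ℚ; 1ℚ)
open import Data.Rational.Properties using (_<?_)
open import Data.Sum.Base using (_⊎_)
open import Data.Unit.Base using (⊤)
open import Data.Vec.Base as Vec using (Vec; []; _∷_; lookup; tabulate)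
open import Relation.Binary.PropositionalEquality.Core using (_≡_)
open import Relation.Nullary using (¬_; does)

------------------------------------------------------------------------
-- Influence graphs

record Weight : Set where
  field
    value    : ℚ
    positive : 0ℚ ℚ.< value
    atMost1  : value ℚ.≤ 1ℚ

open Weight public

-- `weight u v` is `just w` if u → v is an arc of weight w, and `nothing`
-- if there is no arc from u to v.
record InfluenceGraph (n : ℕ) : Set where
  field
    weight  : Fin n → Fin n → Maybe Weight
    no-loop : ∀ u → weight u u ≡ nothing

open InfluenceGraph public

pairs : ∀ n → List (Fin n × Fin n)
pairs n = cartesianProduct (allFin n) (allFin n)

isProbabilistic : ∀ {n} → InfluenceGraph n → Fin n × Fin n → Bool
isProbabilistic G (u , v) with weight G u v
... | just w  = does (value w <? 1ℚ)
... | nothing = false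

#probabilistic : ∀ {n} → InfluenceGraph n → ℕ
#probabilistic {n} G = length (filterᵇ (isProbabilistic G) (pairs n))

------------------------------------------------------------------------
-- Finite probability distributions: lists of outcomes with their
-- probabilities.  An outcome may be listed several times.

Dist : Set → Set
Dist A = List (ℚ × A)

infixl 1 _>>=_

return : ∀ {A} → A → Dist A
return a = (1ℚ , a) ∷ []

_>>=_ : ∀ {A B} → Dist A → (A → Dist B) → Dist B
d >>= f = concatMap (λ (p , a) → List.map (λ (q , b) → (p ℚ.* q , b)) (f a)) d

bernoulli : ℚ → Dist Bool
bernoulli p = (p , true) ∷ (1ℚ ℚ.- p , false) ∷ []

-- The entries are drawn independently of one another.
sequence : ∀ {A n} → Vec (Dist A) n → Dist (Vec A n)
sequence []       = return []
sequence (d ∷ ds) = d >>= λ a → sequence ds >>= λ as → return (a ∷ as)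

Pr[_]_ : ∀ {A} → (A → Bool) → Dist A → ℚ
Pr[ P ] d = foldr (λ (p , a) acc → (if P a then p else 0ℚ) ℚ.+ acc) 0ℚ d

------------------------------------------------------------------------
-- The Independent Cascade process

record Stage (n : ℕ) : Set where
  constructor stage
  field
    active : Subset n
    new    : Subset n   -- the nodes that became active in the latest time step

open Stage public

module _ {n : ℕ} (G : InfluenceGraph n) where

  attempt : (u v : Fin n) → Dist Bool
  attempt u v with weight G u v
  ... | just w  = bernoulli (value w)
  ... | nothing = return false

  -- Does at least one node of N succeed in activating v?
  hit : Subset n → Fin n → Dist Bool
  hit N v = foldr
    (λ u d → (if lookup N u then attempt u v else return false) >>= λ b →
             d >>= λ b′ → return (b ∨ b′))
    (return false) (allFin n)

  step : Stage n → Dist (Stage n)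
  step (stage act N) =
    sequence (tabulate λ v → if lookup act v then return false else hit N v) >>= λ N′ →
    return (stage (act ∪ N′) N′)

  steps : ℕ → Stage n → Dist (Stage n)
  steps zero    s = return s
  steps (suc t) s = step s >>= steps t

  -- Every time step before termination activates a further node, so the
  -- process has terminated by time n; a stage without newly activated nodes
  -- is left unchanged by `step`.
  cascade : Subset n → Dist (Stage n)
  cascade X = steps n (stage X X)

  -- p(v|X)
  p : Fin n → Subset n → ℚ
  p v X = Pr[ (λ s → lookup (active s) v) ] cascade X

------------------------------------------------------------------------
-- The problem Effectors

∑[_] : ∀ {n} → Subset n → (Fin n → ℚ) → ℚ
∑[_] {n} S f = foldr (λ v acc → (if lookup S v then f v else 0ℚ) ℚ.+ acc) 0ℚ (allFin n)

cost : ∀ {n} → InfluenceGraph n → Subset n → Subset n → ℚ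
cost G A X = ∑[ A ] (λ v → 1ℚ ℚ.- p G v X) ℚ.+ ∑[ ∁ A ] (λ v → p G v X)

data Budget : Set where
  fin : ℕ → Budget
  ∞   : Budget

_≤ᴮ_ : ℕ → Budget → Set
m ≤ᴮ fin b = m ℕ.≤ b
m ≤ᴮ ∞     = ⊤

Effectors : ∀ {n} → InfluenceGraph n → Subset n → Budget → ℚ → Set
Effectors {n} G A b c = Σ[ X ∈ Subset n ] (∣ X ∣ ≤ᴮ b) × (cost G A X ℚ.≤ c)

------------------------------------------------------------------------
-- Precision of the weights

-- Coefficients, constant term first.
evalPoly : List ℕ → ℕ → ℕ
evalPoly cs n = foldr (λ a acc → a ℕ.+ n ℕ.* acc) 0 cs

bits : ℚ → ℕ
bits q = ⌈log₂ suc ℤ.∣ ℚ.↥ q ∣ ⌉ ℕ.+ ⌈log₂ suc (ℚ.↧ₙ q) ⌉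

PrecisionBoundedBy : List ℕ → ∀ {n} → InfluenceGraph n → Set
PrecisionBoundedBy poly {n} G =
  ∀ u v w → weight G u v ≡ just w → bits (value w) ℕ.≤ evalPoly poly n

------------------------------------------------------------------------
-- A random access machine computing with natural and rational numbers.
-- The memory consists of arrays of naturals and arrays of rationals.  Array
-- names are fixed by the program, indices are computed, and a scalar
-- variable is an array used at index 0 only.  There is no operation that
-- divides or rounds, or that converts a rational into a natural, except for
-- comparing rationals.

infixl 6 _⊕_ _⊖_
infixl 7 _⊗_
infix  4 _≼_
infix  9 _[_]
infix  3 _[_]≔ᴺ_ _[_]≔ᴿ_
infixr 2 _⨟_
infix  2 IF_THEN_ELSE_ WHILE_DO_

data NatExp : Set
data RatExp : Set

data NatExp where
  lit         : ℕ → NatExp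
  _[_]        : (array : ℕ) → NatExp → NatExp
  _⊕_ _⊖_ _⊗_ : NatExp → NatExp → NatExp
  _≼_         : RatExp → RatExp → NatExp

data RatExp where
  lit         : ℚ → RatExp
  _[_]        : (array : ℕ) → NatExp → RatExp
  _⊕_ _⊖_ _⊗_ : RatExp → RatExp → RatExp

data Program : Set where
  skip          : Program
  _[_]≔ᴺ_       : (array : ℕ) → NatExp → NatExp → Program
  _[_]≔ᴿ_       : (array : ℕ) → NatExp → RatExp → Program
  _⨟_           : Program → Program → Program
  IF_THEN_ELSE_ : NatExp → Program → Program → Program
  WHILE_DO_     : NatExp → Program → Program

record Memory : Set where
  constructor memory
  field
    nat : ℕ → ℕ → ℕ   -- array name, index
    rat : ℕ → ℕ → ℚ

open Memory public

evalᴺ : NatExp → Memory → ℕ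
evalᴿ : RatExp → Memory → ℚ

evalᴺ (lit k)   m = k
evalᴺ (a [ e ]) m = nat m a (evalᴺ e m)
evalᴺ (e ⊕ f)   m = evalᴺ e m ℕ.+ evalᴺ f m
evalᴺ (e ⊖ f)   m = evalᴺ e m ℕ.∸ evalᴺ f m
evalᴺ (e ⊗ f)   m = evalᴺ e m ℕ.* evalᴺ f m
evalᴺ (e ≼ f)   m = if evalᴿ e m ℚ.≤ᵇ evalᴿ f m then 1 else 0

evalᴿ (lit q)   m = q
evalᴿ (a [ e ]) m = rat m a (evalᴺ e m)
evalᴿ (e ⊕ f)   m = evalᴿ e m ℚ.+ evalᴿ f m
evalᴿ (e ⊖ f)   m = evalᴿ e m ℚ.- evalᴿ f m
evalᴿ (e ⊗ f)   m = evalᴿ e m ℚ.* evalᴿ f m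

-- Every arithmetic operation, comparison and memory access takes one unit of
-- time.
timeᴺ : NatExp → ℕ
timeᴿ : RatExp → ℕ

timeᴺ (lit k)   = 1
timeᴺ (a [ e ]) = 1 ℕ.+ timeᴺ e
timeᴺ (e ⊕ f)   = 1 ℕ.+ (timeᴺ e ℕ.+ timeᴺ f)
timeᴺ (e ⊖ f)   = 1 ℕ.+ (timeᴺ e ℕ.+ timeᴺ f)
timeᴺ (e ⊗ f)   = 1 ℕ.+ (timeᴺ e ℕ.+ timeᴺ f)
timeᴺ (e ≼ f)   = 1 ℕ.+ (timeᴿ e ℕ.+ timeᴿ f)

timeᴿ (lit q)   = 1
timeᴿ (a [ e ]) = 1 ℕ.+ timeᴺ e
timeᴿ (e ⊕ f)   = 1 ℕ.+ (timeᴿ e ℕ.+ timeᴿ f)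
timeᴿ (e ⊖ f)   = 1 ℕ.+ (timeᴿ e ℕ.+ timeᴿ f)
timeᴿ (e ⊗ f)   = 1 ℕ.+ (timeᴿ e ℕ.+ timeᴿ f)

update : ∀ {A : Set} → (ℕ → ℕ → A) → ℕ → ℕ → A → ℕ → ℕ → A
update M a i x b j =
  if a ℕ.≡ᵇ b then (if i ℕ.≡ᵇ j then x else M b j) else M b j

setᴺ : ℕ → ℕ → ℕ → Memory → Memory
setᴺ a i x m = record m { nat = update (nat m) a i x }

setᴿ : ℕ → ℕ → ℚ → Memory → Memory
setᴿ a i x m = record m { rat = update (rat m) a i x }

-- P , m ⇓ m′ , t : started in memory m, the program P halts after t units of
-- time in memory m′.  A condition holds if its value is nonzero.
infix 1 _,_⇓_,_

data _,_⇓_,_ : Program → Memory → Memory → ℕ → Set where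

  skip : ∀ {m} → skip , m ⇓ m , 1

  assignᴺ : ∀ {a e f m} →
    a [ e ]≔ᴺ f , m ⇓ setᴺ a (evalᴺ e m) (evalᴺ f m) m , 1 ℕ.+ (timeᴺ e ℕ.+ timeᴺ f)

  assignᴿ : ∀ {a e f m} →
    a [ e ]≔ᴿ f , m ⇓ setᴿ a (evalᴺ e m) (evalᴿ f m) m , 1 ℕ.+ (timeᴺ e ℕ.+ timeᴿ f)

  seq : ∀ {P Q m m′ m″ t t′} →
    P , m ⇓ m′ , t → Q , m′ ⇓ m″ , t′ → P ⨟ Q , m ⇓ m″ , t ℕ.+ t′

  if-true : ∀ {e P Q m m′ t k} → evalᴺ e m ≡ suc k →
    P , m ⇓ m′ , t → IF e THEN P ELSE Q , m ⇓ m′ , 1 ℕ.+ (timeᴺ e ℕ.+ t)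

  if-false : ∀ {e P Q m m′ t} → evalᴺ e m ≡ 0 →
    Q , m ⇓ m′ , t → IF e THEN P ELSE Q , m ⇓ m′ , 1 ℕ.+ (timeᴺ e ℕ.+ t)

  while-true : ∀ {e P m m′ m″ t t′ k} → evalᴺ e m ≡ suc k →
    P , m ⇓ m′ , t → WHILE e DO P , m′ ⇓ m″ , t′ →
    WHILE e DO P , m ⇓ m″ , 1 ℕ.+ (timeᴺ e ℕ.+ (t ℕ.+ t′))

  while-false : ∀ {e P m} → evalᴺ e m ≡ 0 →
    WHILE e DO P , m ⇓ m , 1 ℕ.+ timeᴺ e

------------------------------------------------------------------------
-- Input and output

-- The contents of an array: the given entries, followed by zeros.
contents : ∀ {A : Set} → A → List A → ℕ → A
contents z []       i       = z
contents z (x ∷ xs) zero    = x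
contents z (x ∷ xs) (suc i) = contents z xs i

-- Arcs have positive weight, so 0 encodes the absence of an arc.
entry : ∀ {n} → InfluenceGraph n → Fin n × Fin n → ℚ
entry G (u , v) with weight G u v
... | just w  = value w
... | nothing = 0ℚ

-- Natural array 0 holds n, natural array 1 the characteristic vector of A,
-- rational array 0 the weighted adjacency matrix, row by row, and rational
-- array 1 the cost bound c.  All other cells are zero.
input : ∀ {n} → InfluenceGraph n → Subset n → ℚ → Memory
input {n} G A c = memory nats rats
  where
  nats : ℕ → ℕ → ℕ
  nats 0 = contents 0 (n ∷ [])
  nats 1 = contents 0 (List.map (λ b → if b then 1 else 0) (Vec.toList A))
  nats _ = contents 0 []

  rats : ℕ → ℕ → ℚ
  rats 0 = contents 0ℚ (List.map (entry G) (pairs n))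
  rats 1 = contents 0ℚ (c ∷ [])
  rats _ = contents 0ℚ []

-- The answer is read off cell 0 of natural array 0.
output : Memory → ℕ
output m = nat m 0 0

Answers : ℕ → Set → Set
Answers o Q = (o ≡ 1 × Q) ⊎ (o ≡ 0 × ¬ Q)

{-# OPTIONS --safe #-}

-- With an unlimited budget one may assume that the set R of effectors is closed
-- under the certain arcs.  Only the random arcs with tail in R can then carry the
-- cascade out of R.  Guess the set S of these arcs (one of 2 ^ r).  The probability q v
-- that a node v outside R becomes active depends on S alone and is a sum over the
-- 2 ^ r outcomes of the random arcs, because tossing all coins in advance does
-- not change the distribution of the cascade.  The cost of R is therefore a sum of
-- independent contributions of the nodes, and a cheapest closed R that complies with S
-- is a closure of maximum weight, which is a minimum cut.  Compliance is enforced by a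
-- penalty of n for every random arc that violates the guess; no set of effectors costs
-- more than n, so a violated guess never wins.  Each of the 2 ^ r minimum cuts takes
-- O(n ^ 2) rounds of a push-relabel algorithm, in each of which every pair of nodes is
-- inspected once.
module Submission where

open import Defs
open import Data.Bool.Base as Bool using (Bool; true; false; if_then_else_; _∨_; _∧_; _xor_; not; T; f<t)
import Data.Bool.Properties as Boolₚ
open import Data.Fin.Base as Fin using (Fin; toℕ; fromℕ<)
import Data.Fin.Properties as Finₚ
open import Data.Fin.Subset using (Subset; ∣_∣; _∪_)
import Data.Fin.Subset.Properties as Subsetₚ
open import Data.List.Base as List using (List; []; _∷_)
import Data.List.Properties as Listₚ
open import Data.List.Relation.Unary.All as All using (All; []; _∷_)
import Data.List.Relation.Unary.All.Properties as Allₚ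
open import Data.Maybe.Base using (just; nothing)
open import Data.Nat.Base
open import Data.Nat.Properties
open import Data.Nat.Tactic.RingSolver using (solve-∀)
open import Data.Product.Base using (Σ-syntax; _×_; _,_; proj₁; proj₂; ∃)
open import Data.Rational.Base as ℚ using (ℚ; 0ℚ; 1ℚ)
import Data.Rational.Properties as ℚₚ
import Data.Rational.Solver as ℚSolver
open import Data.Sum.Base using (_⊎_; inj₁; inj₂)
open import Data.Unit.Base using (tt)
open import Data.Vec.Base as Vec using (Vec; []; _∷_; lookup; tabulate)
import Data.Vec.Properties as Vecₚ
open import Function.Base using (_∘_; id)
open import Relation.Binary.PropositionalEquality hiding ([_])
open import Relation.Nullary using (¬_; contradiction; Dec; yes; no; does)
import Relation.Nullary.Decidable as Decidable
open import Relation.Nullary.Decidable using (dec-true; dec-false)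

open ℚSolver.+-*-Solver using (solve; _:=_; _:+_; _:*_; _:-_; :-_; con)

-- Structured programs with bounded loops

-- The unlimited budget is needed at one point: passing from a set of effectors to its closure under
-- the certain arcs changes no activation probability, but it may enlarge the set. Guesses and
-- outcomes are both bit patterns on the random arcs, so a single numbering by 2 ^ r masks serves
-- for both; nesting the two loops gives 4 ^ r. The supplies of the closure problem are arbitrary
-- rationals, so the number of steps of the flow algorithm must not depend on their size.
-- Push-relabel has this property, since its rounds are bounded through heights alone. Only a
-- preflow has to be found: deficits act as sinks, excess that cannot reach one stays where it is,
-- and the positive excess that remains is the maximum weight of a closure. An outcome costs O(n ^
-- 3), by repeated sweeps over the matrix, and is treated 4 ^ r times in all; a flow costs O(n ^ 4)
-- and is computed 2 ^ r times. The stated bound covers both.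

-- Array names of the loop bounds; they are never written inside a loop.
data Bound : Set where
  #nodes #cells #rounds #masks : Bound

array : Bound → ℕ
array #nodes  = 2
array #cells  = 3
array #rounds = 4
array #masks  = 5

infixr 2 _▹_
infix  3 _⟦_⟧≔ᴺ_ _⟦_⟧≔ᴿ_

-- A fragment of the machine language in which the number of iterations of a loop is known on entry.
-- Running such a program is a total function, and a bound on its time can be read off its syntax.
data Code : Set where
  done       : Code
  _⟦_⟧≔ᴺ_    : ℕ → NatExp → NatExp → Code
  _⟦_⟧≔ᴿ_    : ℕ → NatExp → RatExp → Code
  _▹_        : Code → Code → Code
  branch     : NatExp → Code → Code → Code
  for        : ℕ → Bound → Code → Code

compile : Code → Program
compile done = skip
compile (a ⟦ e ⟧≔ᴺ f) = a [ e ]≔ᴺ f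
compile (a ⟦ e ⟧≔ᴿ f) = a [ e ]≔ᴿ f
compile (S ▹ S′) = compile S ⨟ compile S′
compile (branch e S S′) = IF e THEN compile S ELSE compile S′
compile (for i b S) =
  i [ lit 0 ]≔ᴺ lit 0 ⨟
  WHILE array b [ lit 0 ] ⊖ i [ lit 0 ] DO
    (compile S ⨟ i [ lit 0 ]≔ᴺ i [ lit 0 ] ⊕ lit 1)

cond : ∀ {A : Set} → ℕ → A → A → A
cond zero    a b = b
cond (suc _) a b = a

-- A loop reads its bound once and overwrites the counter with the number of the iteration, whereas
-- the compiled loop reads the bound at every test and increments the stored counter. The two agree
-- if the body writes neither, which `wellFormed` and `Unwritten` ensure.
exec : Code → Memory → Memory
iterate : ℕ → Code → (N k : ℕ) → Memory → Memory

exec done m = m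
exec (a ⟦ e ⟧≔ᴺ f) m = setᴺ a (evalᴺ e m) (evalᴺ f m) m
exec (a ⟦ e ⟧≔ᴿ f) m = setᴿ a (evalᴺ e m) (evalᴿ f m) m
exec (S ▹ S′) m = exec S′ (exec S m)
exec (branch e S S′) m = cond (evalᴺ e m) (exec S m) (exec S′ m)
exec (for i b S) m = iterate i S (nat m (array b) 0) 0 (setᴺ i 0 0 m)

iterate i S zero    k m = m
iterate i S (suc N) k m = iterate i S N (suc k) (setᴺ i 0 (suc k) (exec S m))

elem : ℕ → List ℕ → Bool
elem a = List.foldr (λ b r → (b ≡ᵇ a) ∨ r) false

writesᴺ writesᴿ : Code → List ℕ
writesᴺ done = []
writesᴺ (a ⟦ e ⟧≔ᴺ f) = a ∷ []
writesᴺ (a ⟦ e ⟧≔ᴿ f) = []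
writesᴺ (S ▹ S′) = writesᴺ S List.++ writesᴺ S′
writesᴺ (branch e S S′) = writesᴺ S List.++ writesᴺ S′
writesᴺ (for i b S) = i ∷ writesᴺ S

writesᴿ done = []
writesᴿ (a ⟦ e ⟧≔ᴺ f) = []
writesᴿ (a ⟦ e ⟧≔ᴿ f) = a ∷ []
writesᴿ (S ▹ S′) = writesᴿ S List.++ writesᴿ S′
writesᴿ (branch e S S′) = writesᴿ S List.++ writesᴿ S′
writesᴿ (for i b S) = writesᴿ S

-- The lists name the arrays that may have been written. For concrete code membership is decided by
-- evaluation, so that most frame conditions below are proved by `refl`.
record Unchanged (ns rs : List ℕ) (m m′ : Memory) : Set where
  field
    natᶠ : ∀ a → elem a ns ≡ false → ∀ j → nat m′ a j ≡ nat m a j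
    ratᶠ : ∀ a → elem a rs ≡ false → ∀ j → rat m′ a j ≡ rat m a j
open Unchanged public

elem-++ : ∀ a xs {ys} → elem a (xs List.++ ys) ≡ false → elem a xs ≡ false × elem a ys ≡ false
elem-++ a []       e = refl , e
elem-++ a (x ∷ xs) e with x ≡ᵇ a
... | true  = contradiction e λ ()
... | false = elem-++ a xs e

unchanged-refl : ∀ {ns rs m} → Unchanged ns rs m m
unchanged-refl = record { natᶠ = λ _ _ _ → refl ; ratᶠ = λ _ _ _ → refl }

unchanged-trans : ∀ {ns rs m m′ m″} → Unchanged ns rs m m′ → Unchanged ns rs m′ m″ → Unchanged ns rs m m″
unchanged-trans u v = record
  { natᶠ = λ a e j → trans (natᶠ v a e j) (natᶠ u a e j)
  ; ratᶠ = λ a e j → trans (ratᶠ v a e j) (ratᶠ u a e j) }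

unchanged-++ : ∀ ns rs {ns′ rs′ m m′ m″} → Unchanged ns rs m m′ → Unchanged ns′ rs′ m′ m″ →
  Unchanged (ns List.++ ns′) (rs List.++ rs′) m m″
unchanged-++ ns rs u v = record
  { natᶠ = λ a e j → trans (natᶠ v a (proj₂ (elem-++ a ns e)) j) (natᶠ u a (proj₁ (elem-++ a ns e)) j)
  ; ratᶠ = λ a e j → trans (ratᶠ v a (proj₂ (elem-++ a rs e)) j) (ratᶠ u a (proj₁ (elem-++ a rs e)) j) }

unchanged-setᴺ : ∀ i ns rs j x m → Unchanged (i ∷ ns) rs m (setᴺ i j x m)
unchanged-setᴺ i ns rs j x m = record { natᶠ = go ; ratᶠ = λ _ _ _ → refl }
  where
  go : ∀ a → elem a (i ∷ ns) ≡ false → ∀ l → nat (setᴺ i j x m) a l ≡ nat m a l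
  go a e l with i ≡ᵇ a
  ... | true  = contradiction e λ ()
  ... | false = refl

unchanged-setᴿ : ∀ i ns j x m → Unchanged ns (i ∷ []) m (setᴿ i j x m)
unchanged-setᴿ i ns j x m = record { natᶠ = λ _ _ _ → refl ; ratᶠ = go }
  where
  go : ∀ a → elem a (i ∷ []) ≡ false → ∀ l → rat (setᴿ i j x m) a l ≡ rat m a l
  go a e l with i ≡ᵇ a
  ... | true  = contradiction e λ ()
  ... | false = refl

unchanged-∷ : ∀ i {ns rs m m′} → Unchanged ns rs m m′ → Unchanged (i ∷ ns) rs m m′
unchanged-∷ i {ns} u = record { natᶠ = λ a e → natᶠ u a (go a e) ; ratᶠ = ratᶠ u }
  where
  go : ∀ a → elem a (i ∷ ns) ≡ false → elem a ns ≡ false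
  go a e with i ≡ᵇ a
  ... | true  = contradiction e λ ()
  ... | false = e

frame : ∀ S m → Unchanged (writesᴺ S) (writesᴿ S) m (exec S m)
frame-iterate : ∀ i S N k m → Unchanged (i ∷ writesᴺ S) (writesᴿ S) m (iterate i S N k m)

frame done m = unchanged-refl
frame (a ⟦ e ⟧≔ᴺ f) m = unchanged-setᴺ a [] [] (evalᴺ e m) (evalᴺ f m) m
frame (a ⟦ e ⟧≔ᴿ f) m = unchanged-setᴿ a [] (evalᴺ e m) (evalᴿ f m) m
frame (S ▹ S′) m = unchanged-++ (writesᴺ S) (writesᴿ S) (frame S m) (frame S′ (exec S m))
frame (branch e S S′) m with evalᴺ e m
... | suc _ = unchanged-++ (writesᴺ S) (writesᴿ S) {writesᴺ S′} {writesᴿ S′} (frame S m) unchanged-refl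
... | zero  = unchanged-++ (writesᴺ S) (writesᴿ S) unchanged-refl (frame S′ m)
frame (for i b S) m =
  unchanged-trans (unchanged-setᴺ i (writesᴺ S) (writesᴿ S) 0 0 m) (frame-iterate i S (nat m (array b) 0) 0 _)

frame-iterate i S zero    k m = unchanged-refl
frame-iterate i S (suc N) k m =
  unchanged-trans (unchanged-∷ i (frame S m))
    (unchanged-trans (unchanged-setᴺ i (writesᴺ S) (writesᴿ S) 0 (suc k) (exec S m)) (frame-iterate i S N (suc k) _))

-- Termination and running time of compiled code

wellFormed : Code → Bool
wellFormed done = true
wellFormed (a ⟦ e ⟧≔ᴺ f) = true
wellFormed (a ⟦ e ⟧≔ᴿ f) = true
wellFormed (S ▹ S′) = wellFormed S ∧ wellFormed S′
wellFormed (branch e S S′) = wellFormed S ∧ wellFormed S′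
wellFormed (for i b S) = not (elem i (writesᴺ S)) ∧ wellFormed S

constantBounds : Code → Bool
constantBounds S = not (elem 2 (writesᴺ S) ∨ (elem 3 (writesᴺ S) ∨ (elem 4 (writesᴺ S) ∨ elem 5 (writesᴺ S))))

∧-trueˡ : ∀ {x y} → x ∧ y ≡ true → x ≡ true
∧-trueˡ {true} e = refl

∧-trueʳ : ∀ {x y} → x ∧ y ≡ true → y ≡ true
∧-trueʳ {true} e = e

not-true : ∀ {x} → not x ≡ true → x ≡ false
not-true {false} e = refl

∨-falseˡ : ∀ {x y} → x ∨ y ≡ false → x ≡ false
∨-falseˡ {false} e = refl

∨-falseʳ : ∀ {x y} → x ∨ y ≡ false → y ≡ false
∨-falseʳ {false} e = e

bound-unwritten : ∀ S → constantBounds S ≡ true → ∀ b → elem (array b) (writesᴺ S) ≡ false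
bound-unwritten S e #nodes  = ∨-falseˡ (not-true e)
bound-unwritten S e #cells  = ∨-falseˡ (∨-falseʳ {elem 2 (writesᴺ S)} (not-true e))
bound-unwritten S e #rounds = ∨-falseˡ (∨-falseʳ {elem 3 (writesᴺ S)} (∨-falseʳ {elem 2 (writesᴺ S)} (not-true e)))
bound-unwritten S e #masks  = ∨-falseʳ {elem 4 (writesᴺ S)} (∨-falseʳ {elem 3 (writesᴺ S)} (∨-falseʳ {elem 2 (writesᴺ S)} (not-true e)))

-- The 9 consists of 3 for initialising the counter and 6 for the test that fails; the 12 of 6 for a
-- test that succeeds and 6 for the increment. Adding the branches instead of taking their maximum
-- costs a constant factor only.
time : Code → (Bound → ℕ) → ℕ
time done ρ = 1
time (a ⟦ e ⟧≔ᴺ f) ρ = 1 + (timeᴺ e + timeᴺ f)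
time (a ⟦ e ⟧≔ᴿ f) ρ = 1 + (timeᴺ e + timeᴿ f)
time (S ▹ S′) ρ = time S ρ + time S′ ρ
time (branch e S S′) ρ = 1 + (timeᴺ e + (time S ρ + time S′ ρ))
time (for i b S) ρ = 9 + ρ b * (12 + time S ρ)

bounds : Memory → Bound → ℕ
bounds m b = nat m (array b) 0

Halts : Code → (Bound → ℕ) → Memory → Set
Halts S ρ m = Σ[ t ∈ ℕ ] (compile S , m ⇓ exec S m , t) × t ≤ time S ρ

HasBounds : (Bound → ℕ) → Memory → Set
HasBounds ρ m = ∀ b → bounds m b ≡ ρ b

hasBounds-unchanged : ∀ {ρ ns rs m m′} → (∀ b → elem (array b) ns ≡ false) →
  Unchanged ns rs m m′ → HasBounds ρ m → HasBounds ρ m′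
hasBounds-unchanged e u h b = trans (natᶠ u (array b) (e b) 0) (h b)

Unwritten : Code → Set
Unwritten S = ∀ b → elem (array b) (writesᴺ S) ≡ false

unwritten-∷ : ∀ i ns → (∀ b → elem (array b) (i ∷ ns) ≡ false) →
  (∀ b → (i ≡ᵇ array b) ≡ false) × (∀ b → elem (array b) ns ≡ false)
unwritten-∷ i ns e = (λ b → ∨-falseˡ (e b)) , (λ b → ∨-falseʳ {i ≡ᵇ array b} (e b))

≡ᵇ-refl : ∀ n → (n ≡ᵇ n) ≡ true
≡ᵇ-refl zero    = refl
≡ᵇ-refl (suc n) = ≡ᵇ-refl n

setᴺ-get : ∀ a x m → nat (setᴺ a 0 x m) a 0 ≡ x
setᴺ-get a x m rewrite ≡ᵇ-refl a = refl

setᴺ-cong : ∀ a j {x y} m → x ≡ y → setᴺ a j x m ≡ setᴺ a j y m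
setᴺ-cong a j m refl = refl

⇓-cong : ∀ {P m m′ m″ t} → m′ ≡ m″ → P , m ⇓ m′ , t → P , m ⇓ m″ , t
⇓-cong refl r = r

-- One environment `ρ` serves for all loops, nested ones included, because the code never writes a
-- bound. The pieces of the final program that do write bounds are free of loops and are timed
-- separately.
halts : ∀ S ρ m → wellFormed S ≡ true → Unwritten S → HasBounds ρ m → Halts S ρ m
halts-iterate : ∀ i b S ρ N k m → elem i (writesᴺ S) ≡ false → wellFormed S ≡ true →
  Unwritten (for i b S) → HasBounds ρ m → nat m i 0 ≡ k → N + k ≡ ρ b →
  Σ[ t ∈ ℕ ] (WHILE array b [ lit 0 ] ⊖ i [ lit 0 ] DO
    (compile S ⨟ i [ lit 0 ]≔ᴺ i [ lit 0 ] ⊕ lit 1) , m ⇓ iterate i S N k m , t)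
    × t ≤ 6 + N * (12 + time S ρ)

halts done ρ m w u h = 1 , skip , ≤-refl
halts (a ⟦ e ⟧≔ᴺ f) ρ m w u h = _ , assignᴺ , ≤-refl
halts (a ⟦ e ⟧≔ᴿ f) ρ m w u h = _ , assignᴿ , ≤-refl
halts (S ▹ S′) ρ m w u h
  with halts S ρ m (∧-trueˡ w) (λ b → proj₁ (elem-++ (array b) (writesᴺ S) (u b))) h
     | halts S′ ρ (exec S m) (∧-trueʳ {wellFormed S} w) (λ b → proj₂ (elem-++ (array b) (writesᴺ S) (u b)))
         (hasBounds-unchanged (λ b → proj₁ (elem-++ (array b) (writesᴺ S) (u b))) (frame S m) h)
... | _ , r , l | _ , r′ , l′ = _ , seq r r′ , +-mono-≤ l l′
halts (branch e S S′) ρ m w u h with evalᴺ e m in eq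
... | suc _ with halts S ρ m (∧-trueˡ w) (λ b → proj₁ (elem-++ (array b) (writesᴺ S) (u b))) h
...   | _ , r , l = _ , if-true eq r , s≤s (+-monoʳ-≤ (timeᴺ e) (≤-trans l (m≤m+n _ _)))
halts (branch e S S′) ρ m w u h | zero
      with halts S′ ρ m (∧-trueʳ {wellFormed S} w) (λ b → proj₂ (elem-++ (array b) (writesᴺ S) (u b))) h
...   | _ , r , l = _ , if-false eq r , s≤s (+-monoʳ-≤ (timeᴺ e) (≤-trans l (m≤n+m _ _)))
halts (for i b S) ρ m w u h
  with halts-iterate i b S ρ (bounds m b) 0 (setᴺ i 0 0 m) (not-true (∧-trueˡ w))
         (∧-trueʳ {not (elem i (writesᴺ S))} w) u
         (hasBounds-unchanged u (unchanged-setᴺ i (writesᴺ S) [] 0 0 m) h)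
         (setᴺ-get i 0 m) (trans (+-identityʳ _) (h b))
... | _ , r , l = _ , seq assignᴺ r ,
      s≤s (s≤s (s≤s (≤-trans l (≤-reflexive (cong (λ N → 6 + N * (12 + time S ρ)) (h b))))))

halts-iterate i b S ρ zero k m e w u h eq eqN =
  _ , while-false (trans (cong₂ _∸_ (trans (h b) (sym eqN)) eq) (n∸n≡0 k)) , ≤-refl
halts-iterate i b S ρ (suc N) k m e w u h eq eqN =
  _ , while-true continue (seq (proj₁ (proj₂ body)) assignᴺ) (⇓-cong (cong (iterate i S N (suc k)) memEq) (proj₁ (proj₂ rest)))
    , ≤-trans (s≤s (+-monoʳ-≤ (timeᴺ (array b [ lit 0 ] ⊖ i [ lit 0 ]))
                 (+-mono-≤ (+-monoˡ-≤ 6 (proj₂ (proj₂ body))) (proj₂ (proj₂ rest)))))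
        (≤-reflexive (arith (time S ρ) (N * (12 + time S ρ))))
  where
  arith : ∀ x y → 1 + (5 + ((x + 6) + (6 + y))) ≡ 6 + ((12 + x) + y)
  arith = solve-∀

  unwrittenS : Unwritten S
  unwrittenS = proj₂ (unwritten-∷ i (writesᴺ S) u)

  m₁ m₂ : Memory
  m₁ = exec S m
  m₂ = setᴺ i 0 (nat m₁ i 0 + 1) m₁

  eq₁ : nat m₁ i 0 + 1 ≡ suc k
  eq₁ = trans (cong (_+ 1) (trans (natᶠ (frame S m) i e 0) eq)) (+-comm k 1)

  memEq : m₂ ≡ setᴺ i 0 (suc k) m₁
  memEq = setᴺ-cong i 0 m₁ eq₁

  continue : nat m (array b) 0 ∸ nat m i 0 ≡ suc N
  continue = trans (cong₂ _∸_ (trans (h b) (sym eqN)) eq) (m+n∸n≡m (suc N) k)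

  body = halts S ρ m w unwrittenS h

  rest = halts-iterate i b S ρ N (suc k) m₂ e w u
    (hasBounds-unchanged u (unchanged-setᴺ i (writesᴺ S) [] 0 (nat m₁ i 0 + 1) m₁) (hasBounds-unchanged unwrittenS (frame S m) h))
    (trans (setᴺ-get i _ m₁) eq₁)
    (trans (+-suc N k) eqN)

-- The bound b is at most boundCoeff b * (ν ^ boundDegᴺ b * M ^ boundDegᴹ b), where
-- ν is one more than the number of nodes and M the number of masks.
boundCoeff boundDegᴺ boundDegᴹ : Bound → ℕ
boundCoeff #rounds = 2
boundCoeff _       = 1
boundDegᴺ #nodes  = 1
boundDegᴺ #cells  = 2
boundDegᴺ #rounds = 2
boundDegᴺ #masks  = 0
boundDegᴹ #masks = 1
boundDegᴹ _      = 0

coeff degᴺ degᴹ : Code → ℕ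
coeff done = 1
coeff (a ⟦ e ⟧≔ᴺ f) = 1 + (timeᴺ e + timeᴺ f)
coeff (a ⟦ e ⟧≔ᴿ f) = 1 + (timeᴺ e + timeᴿ f)
coeff (S ▹ S′) = coeff S + coeff S′
coeff (branch e S S′) = 1 + (timeᴺ e + (coeff S + coeff S′))
coeff (for i b S) = 9 + boundCoeff b * (12 + coeff S)

degᴺ (S ▹ S′) = degᴺ S ⊔ degᴺ S′
degᴺ (branch e S S′) = degᴺ S ⊔ degᴺ S′
degᴺ (for i b S) = boundDegᴺ b + degᴺ S
degᴺ _ = 0

degᴹ (S ▹ S′) = degᴹ S ⊔ degᴹ S′
degᴹ (branch e S S′) = degᴹ S ⊔ degᴹ S′
degᴹ (for i b S) = boundDegᴹ b + degᴹ S
degᴹ _ = 0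

module _ (ν M : ℕ) .{{_ : NonZero ν}} .{{_ : NonZero M}} where

  1≤monomial : ∀ i j → 1 ≤ ν ^ i * M ^ j
  1≤monomial i j = *-mono-≤ (m^n>0 ν i) (m^n>0 M j)

  monomial-mono : ∀ {i i′ j j′} → i ≤ i′ → j ≤ j′ → ν ^ i * M ^ j ≤ ν ^ i′ * M ^ j′
  monomial-mono p q = *-mono-≤ (^-monoʳ-≤ ν p) (^-monoʳ-≤ M q)

  const≤ : ∀ c i j → c ≤ c * (ν ^ i * M ^ j)
  const≤ c i j = ≤-trans (≤-reflexive (sym (*-identityʳ c))) (*-monoʳ-≤ c (1≤monomial i j))

  module _ (ρ : Bound → ℕ)
           (ρ≤ : ∀ b → ρ b ≤ boundCoeff b * (ν ^ boundDegᴺ b * M ^ boundDegᴹ b)) where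

    -- Since `ν` and `M` are at least 1, terms of lower order can be absorbed into a single
    -- monomial. The two exponents are maximised separately, so that ν ^ 3 * M ^ 2 and ν ^ 4 * M
    -- together are bounded by a multiple of ν ^ 4 * M ^ 2.
    time≤ : ∀ S → time S ρ ≤ coeff S * (ν ^ degᴺ S * M ^ degᴹ S)

    time-⊔≤ : ∀ S S′ → time S ρ + time S′ ρ ≤
      (coeff S + coeff S′) * (ν ^ (degᴺ S ⊔ degᴺ S′) * M ^ (degᴹ S ⊔ degᴹ S′))
    time-⊔≤ S S′ = begin
      time S ρ + time S′ ρ
        ≤⟨ +-mono-≤ (time≤ S) (time≤ S′) ⟩
      coeff S * (ν ^ degᴺ S * M ^ degᴹ S) + coeff S′ * (ν ^ degᴺ S′ * M ^ degᴹ S′)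
        ≤⟨ +-mono-≤ (*-monoʳ-≤ (coeff S) (monomial-mono (m≤m⊔n (degᴺ S) _) (m≤m⊔n (degᴹ S) _)))
             (*-monoʳ-≤ (coeff S′) (monomial-mono (m≤n⊔m (degᴺ S) _) (m≤n⊔m (degᴹ S) _))) ⟩
      coeff S * X + coeff S′ * X
        ≡⟨ *-distribʳ-+ X (coeff S) (coeff S′) ⟨
      (coeff S + coeff S′) * X ∎
      where
      open ≤-Reasoning
      X = ν ^ (degᴺ S ⊔ degᴺ S′) * M ^ (degᴹ S ⊔ degᴹ S′)

    time≤ done = const≤ 1 0 0
    time≤ (a ⟦ e ⟧≔ᴺ f) = const≤ _ 0 0
    time≤ (a ⟦ e ⟧≔ᴿ f) = const≤ _ 0 0
    time≤ (S ▹ S′) = time-⊔≤ S S′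
    time≤ (branch e S S′) = begin
      1 + (timeᴺ e + (time S ρ + time S′ ρ))
        ≡⟨ +-assoc 1 (timeᴺ e) _ ⟨
      (1 + timeᴺ e) + (time S ρ + time S′ ρ)
        ≤⟨ +-mono-≤ (const≤ (1 + timeᴺ e) (degᴺ S ⊔ degᴺ S′) (degᴹ S ⊔ degᴹ S′)) (time-⊔≤ S S′) ⟩
      (1 + timeᴺ e) * X + (coeff S + coeff S′) * X
        ≡⟨ *-distribʳ-+ X (1 + timeᴺ e) (coeff S + coeff S′) ⟨
      ((1 + timeᴺ e) + (coeff S + coeff S′)) * X
        ≡⟨ cong (_* X) (+-assoc 1 (timeᴺ e) _) ⟩
      (1 + (timeᴺ e + (coeff S + coeff S′))) * X ∎
      where
      open ≤-Reasoning
      X = ν ^ (degᴺ S ⊔ degᴺ S′) * M ^ (degᴹ S ⊔ degᴹ S′)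
    time≤ (for i b S) = begin
      9 + ρ b * (12 + time S ρ)
        ≤⟨ +-mono-≤ (const≤ 9 (β + degᴺ S) (γ + degᴹ S))
             (*-mono-≤ (ρ≤ b) (+-mono-≤ (const≤ 12 (degᴺ S) (degᴹ S)) (time≤ S))) ⟩
      9 * (ν ^ (β + degᴺ S) * M ^ (γ + degᴹ S)) + k * (ν ^ β * M ^ γ) * (12 * Y + coeff S * Y)
        ≡⟨ cong₂ (λ x y → 9 * (x * y) + k * (ν ^ β * M ^ γ) * (12 * Y + coeff S * Y))
             (^-distribˡ-+-* ν β (degᴺ S)) (^-distribˡ-+-* M γ (degᴹ S)) ⟩
      9 * ((ν ^ β * ν ^ degᴺ S) * (M ^ γ * M ^ degᴹ S)) + k * (ν ^ β * M ^ γ) * (12 * Y + coeff S * Y)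
        ≡⟨ arith (ν ^ β) (ν ^ degᴺ S) (M ^ γ) (M ^ degᴹ S) k (coeff S) ⟩
      (9 + k * (12 + coeff S)) * ((ν ^ β * ν ^ degᴺ S) * (M ^ γ * M ^ degᴹ S))
        ≡⟨ cong₂ (λ x y → (9 + k * (12 + coeff S)) * (x * y))
             (^-distribˡ-+-* ν β (degᴺ S)) (^-distribˡ-+-* M γ (degᴹ S)) ⟨
      (9 + k * (12 + coeff S)) * (ν ^ (β + degᴺ S) * M ^ (γ + degᴹ S)) ∎
      where
      open ≤-Reasoning
      k = boundCoeff b
      β = boundDegᴺ b
      γ = boundDegᴹ b
      Y = ν ^ degᴺ S * M ^ degᴹ S
      arith : ∀ a b c d k s → 9 * ((a * b) * (c * d)) + k * (a * c) * (12 * (b * d) + s * (b * d))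
                              ≡ (9 + k * (12 + s)) * ((a * b) * (c * d))
      arith = solve-∀

    time≤-deg : ∀ S i j → degᴺ S ≤ i → degᴹ S ≤ j → time S ρ ≤ coeff S * (ν ^ i * M ^ j)
    time≤-deg S i j p q = ≤-trans (time≤ S) (*-monoʳ-≤ (coeff S) (monomial-mono p q))

-- Proof rules for branches and loops

branch-rule : ∀ (P : Memory → Set) e S S′ m →
  (∀ k → evalᴺ e m ≡ suc k → P (exec S m)) → (evalᴺ e m ≡ 0 → P (exec S′ m)) →
  P (exec (branch e S S′) m)
branch-rule P e S S′ m t f with evalᴺ e m
... | suc k = t k refl
... | zero  = f refl

-- Besides the invariant, each step is given the frame condition relative to the memory before the
-- loop. An invariant therefore only has to speak of the arrays that the loop writes.
for-rule : ∀ (Inv : ℕ → Memory → Set) {N} i b S m → elem i (writesᴺ S) ≡ false →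
  bounds m b ≡ N →
  Inv 0 (setᴺ i 0 0 m) →
  (∀ k m′ → k < N → nat m′ i 0 ≡ k → Unchanged (i ∷ writesᴺ S) (writesᴿ S) m m′ → Inv k m′ →
     Inv (suc k) (setᴺ i 0 (suc k) (exec S m′))) →
  Inv N (exec (for i b S) m)
for-rule Inv {N} i b S m i∉ refl base step =
  go (bounds m b) 0 _ (+-identityʳ _) (setᴺ-get i 0 m) (unchanged-setᴺ i (writesᴺ S) (writesᴿ S) 0 0 m) base
  where
  go : ∀ r k m′ → r + k ≡ N → nat m′ i 0 ≡ k → Unchanged (i ∷ writesᴺ S) (writesᴿ S) m m′ →
       Inv k m′ → Inv N (iterate i S r k m′)
  go zero    k m′ refl e u inv = inv
  go (suc r) k m′ eq e u inv =
    go r (suc k) _ (trans (+-suc r k) eq) (setᴺ-get i (suc k) (exec S m′))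
      (unchanged-trans u (unchanged-trans (unchanged-∷ i (frame S m′))
        (unchanged-setᴺ i (writesᴺ S) (writesᴿ S) 0 (suc k) (exec S m′))))
      (step k m′ (≤-trans (s≤s (m≤n+m k r)) (≤-reflexive eq)) e u inv)

-- The Independent Cascade process with all coins tossed in advance

-- Distributions are lists, and two lists may represent the same distribution without being equal.
-- They are therefore compared through the expectations of all functions.
𝔼 : ∀ {A : Set} → Dist A → (A → ℚ) → ℚ
𝔼 []            F = 0ℚ
𝔼 ((p , a) ∷ d) F = p ℚ.* F a ℚ.+ 𝔼 d F

module _ {A : Set} where

  𝔼-cong : ∀ (d : Dist A) {F G} → (∀ a → F a ≡ G a) → 𝔼 d F ≡ 𝔼 d G
  𝔼-cong []            eq = refl
  𝔼-cong ((p , a) ∷ d) eq = cong₂ (λ x y → p ℚ.* x ℚ.+ y) (eq a) (𝔼-cong d eq)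

  𝔼-++ : ∀ (d d′ : Dist A) F → 𝔼 (d List.++ d′) F ≡ 𝔼 d F ℚ.+ 𝔼 d′ F
  𝔼-++ []            d′ F = sym (ℚₚ.+-identityˡ _)
  𝔼-++ ((p , a) ∷ d) d′ F = trans (cong (p ℚ.* F a ℚ.+_) (𝔼-++ d d′ F)) (sym (ℚₚ.+-assoc (p ℚ.* F a) _ _))

  𝔼-scale : ∀ (d : Dist A) c F → 𝔼 d (λ a → c ℚ.* F a) ≡ c ℚ.* 𝔼 d F
  𝔼-scale []            c F = sym (ℚₚ.*-zeroʳ c)
  𝔼-scale ((p , a) ∷ d) c F = trans (cong (p ℚ.* (c ℚ.* F a) ℚ.+_) (𝔼-scale d c F))
    (solve 4 (λ p c x y → p :* (c :* x) :+ c :* y := c :* (p :* x :+ y)) refl p c (F a) (𝔼 d F))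

  𝔼-+ : ∀ (d : Dist A) F G → 𝔼 d (λ a → F a ℚ.+ G a) ≡ 𝔼 d F ℚ.+ 𝔼 d G
  𝔼-+ []            F G = refl
  𝔼-+ ((p , a) ∷ d) F G = trans (cong (p ℚ.* (F a ℚ.+ G a) ℚ.+_) (𝔼-+ d F G))
    (solve 5 (λ p x y u v → p :* (x :+ y) :+ (u :+ v) := (p :* x :+ u) :+ (p :* y :+ v)) refl
      p (F a) (G a) (𝔼 d F) (𝔼 d G))

  𝔼-zero : ∀ (d : Dist A) → 𝔼 d (λ _ → 0ℚ) ≡ 0ℚ
  𝔼-zero []            = refl
  𝔼-zero ((p , a) ∷ d) = trans (cong (p ℚ.* 0ℚ ℚ.+_) (𝔼-zero d)) (trans (ℚₚ.+-identityʳ _) (ℚₚ.*-zeroʳ p))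

  Pr≡𝔼 : ∀ (P : A → Bool) d → (Pr[ P ] d) ≡ 𝔼 d (λ a → if P a then 1ℚ else 0ℚ)
  Pr≡𝔼 P []            = refl
  Pr≡𝔼 P ((p , a) ∷ d) = cong₂ ℚ._+_ (lemma (P a)) (Pr≡𝔼 P d)
    where
    lemma : ∀ b → (if b then p else 0ℚ) ≡ p ℚ.* (if b then 1ℚ else 0ℚ)
    lemma true  = sym (ℚₚ.*-identityʳ p)
    lemma false = sym (ℚₚ.*-zeroʳ p)

  Total : Dist A → Set
  Total d = 𝔼 d (λ _ → 1ℚ) ≡ 1ℚ

  𝔼-const : ∀ (d : Dist A) → Total d → ∀ c → 𝔼 d (λ _ → c) ≡ c
  𝔼-const d t c = begin
    𝔼 d (λ _ → c)          ≡⟨ 𝔼-cong d (λ _ → sym (ℚₚ.*-identityʳ c)) ⟩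
    𝔼 d (λ _ → c ℚ.* 1ℚ)   ≡⟨ 𝔼-scale d c (λ _ → 1ℚ) ⟩
    c ℚ.* 𝔼 d (λ _ → 1ℚ)   ≡⟨ cong (c ℚ.*_) t ⟩
    c ℚ.* 1ℚ               ≡⟨ ℚₚ.*-identityʳ c ⟩
    c ∎
    where open ≡-Reasoning

module _ {A B : Set} where

  𝔼-map : ∀ q (d : Dist B) (F : B → ℚ) →
    𝔼 (List.map (λ (p , b) → (q ℚ.* p , b)) d) F ≡ q ℚ.* 𝔼 d F
  𝔼-map q []            F = sym (ℚₚ.*-zeroʳ q)
  𝔼-map q ((p , b) ∷ d) F = trans (cong (q ℚ.* p ℚ.* F b ℚ.+_) (𝔼-map q d F))
    (solve 4 (λ q p x y → q :* p :* x :+ q :* y := q :* (p :* x :+ y)) refl q p (F b) (𝔼 d F))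

  𝔼->>= : ∀ (d : Dist A) (f : A → Dist B) F → 𝔼 (d >>= f) F ≡ 𝔼 d (λ a → 𝔼 (f a) F)
  𝔼->>= []            f F = refl
  𝔼->>= ((p , a) ∷ d) f F = trans (𝔼-++ (List.map (λ (q , b) → (p ℚ.* q , b)) (f a)) _ F)
    (cong₂ ℚ._+_ (𝔼-map p (f a) F) (𝔼->>= d f F))

  𝔼-swap : ∀ (d : Dist A) (d′ : Dist B) (F : A → B → ℚ) →
    𝔼 d (λ a → 𝔼 d′ (F a)) ≡ 𝔼 d′ (λ b → 𝔼 d (λ a → F a b))
  𝔼-swap []            d′ F = sym (𝔼-zero d′)
  𝔼-swap ((p , a) ∷ d) d′ F = begin
    p ℚ.* 𝔼 d′ (F a) ℚ.+ 𝔼 d (λ a → 𝔼 d′ (F a))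
      ≡⟨ cong₂ ℚ._+_ (sym (𝔼-scale d′ p (F a))) (𝔼-swap d d′ F) ⟩
    𝔼 d′ (λ b → p ℚ.* F a b) ℚ.+ 𝔼 d′ (λ b → 𝔼 d (λ a → F a b))
      ≡⟨ 𝔼-+ d′ _ _ ⟨
    𝔼 d′ (λ b → 𝔼 ((p , a) ∷ d) (λ a → F a b)) ∎
    where open ≡-Reasoning

𝔼-return : ∀ {A : Set} (a : A) F → 𝔼 (return a) F ≡ F a
𝔼-return a F = trans (ℚₚ.+-identityʳ _) (ℚₚ.*-identityˡ (F a))

𝔼->>=return : ∀ {A B : Set} (d : Dist A) (f : A → B) F → 𝔼 (d >>= λ a → return (f a)) F ≡ 𝔼 d (F ∘ f)
𝔼->>=return d f F = trans (𝔼->>= d (λ a → return (f a)) F) (𝔼-cong d (λ a → 𝔼-return (f a) F))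

𝔼-sequence : ∀ {A : Set} {n} (d : Dist A) (ds : Vec (Dist A) n) F →
  𝔼 (sequence (d ∷ ds)) F ≡ 𝔼 d (λ a → 𝔼 (sequence ds) (λ as → F (a ∷ as)))
𝔼-sequence d ds F = trans (𝔼->>= d _ F) (𝔼-cong d (λ a → 𝔼->>=return (sequence ds) (a ∷_) F))

tab : ∀ {A : Set} {n} → (Fin n → Dist A) → Dist (Vec A n)
tab a = sequence (tabulate a)

𝔼-nil : ∀ {A : Set} (a : Fin 0 → Dist A) F → 𝔼 (tab a) F ≡ F []
𝔼-nil a F = 𝔼-return [] F

-- c is the distribution of ρ x y for independent x and y drawn from a and b.
Couples : ∀ {A B C : Set} → (A → B → C) → Dist A → Dist B → Dist C → Set
Couples ρ a b c = ∀ F → 𝔼 a (λ x → 𝔼 b (λ y → F (ρ x y))) ≡ 𝔼 c F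

-- The coordinates are independent, so the order of summation can be exchanged by `𝔼-swap` until the
-- two first coordinates stand next to each other and can be coupled.
tab-couples : ∀ {A B C : Set} n (ρ : Fin n → A → B → C) (a : Fin n → Dist A) (b : Fin n → Dist B) (c : Fin n → Dist C) →
  (∀ i → Couples (ρ i) (a i) (b i) (c i)) →
  Couples (λ xs ys → tabulate (λ i → ρ i (lookup xs i) (lookup ys i))) (tab a) (tab b) (tab c)
tab-couples zero    ρ a b c h F = trans (𝔼-nil a (λ xs → 𝔼 (tab b) (λ ys → F (tabulate (λ i → ρ i (lookup xs i) (lookup ys i)))))) (trans (𝔼-nil b (λ _ → F [])) (sym (𝔼-nil c F)))
tab-couples (suc n) ρ a b c h F = begin
  𝔼 (tab a) (λ xs → 𝔼 (tab b) (λ ys → F (tabulate (λ i → ρ i (lookup xs i) (lookup ys i)))))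
    ≡⟨ 𝔼-cong (tab a) (λ xs → 𝔼-sequence (b 0F) (tabulate (b ∘ Fin.suc)) _) ⟩
  𝔼 (tab a) (λ xs → 𝔼 (b 0F) (λ y → 𝔼 bs (λ ys → F (tabulate (λ i → ρ i (lookup xs i) (lookup (y ∷ ys) i))))))
    ≡⟨ 𝔼-sequence (a 0F) (tabulate (a ∘ Fin.suc)) _ ⟩
  𝔼 (a 0F) (λ x → 𝔼 as (λ xs → 𝔼 (b 0F) (λ y → 𝔼 bs (λ ys →
    F (ρ 0F x y ∷ tabulate (λ i → ρ (Fin.suc i) (lookup xs i) (lookup ys i)))))))
    ≡⟨ 𝔼-cong (a 0F) (λ x → 𝔼-swap as (b 0F) _) ⟩
  𝔼 (a 0F) (λ x → 𝔼 (b 0F) (λ y → 𝔼 as (λ xs → 𝔼 bs (λ ys →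
    F (ρ 0F x y ∷ tabulate (λ i → ρ (Fin.suc i) (lookup xs i) (lookup ys i)))))))
    ≡⟨ 𝔼-cong (a 0F) (λ x → 𝔼-cong (b 0F) (λ y →
         tab-couples n (ρ ∘ Fin.suc) (a ∘ Fin.suc) (b ∘ Fin.suc) (c ∘ Fin.suc) (h ∘ Fin.suc) (λ zs → F (ρ 0F x y ∷ zs)))) ⟩
  𝔼 (a 0F) (λ x → 𝔼 (b 0F) (λ y → 𝔼 cs (λ zs → F (ρ 0F x y ∷ zs))))
    ≡⟨ h 0F (λ z → 𝔼 cs (λ zs → F (z ∷ zs))) ⟩
  𝔼 (c 0F) (λ z → 𝔼 cs (λ zs → F (z ∷ zs)))
    ≡⟨ 𝔼-sequence (c 0F) (tabulate (c ∘ Fin.suc)) F ⟨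
  𝔼 (tab c) F ∎
  where
  open ≡-Reasoning
  0F : Fin (suc n)
  0F = Fin.zero
  as = tab (a ∘ Fin.suc)
  bs = tab (b ∘ Fin.suc)
  cs = tab (c ∘ Fin.suc)

tab-total : ∀ {A : Set} n (a : Fin n → Dist A) → (∀ i → Total (a i)) → Total (tab a)
tab-total zero    a t = refl
tab-total (suc n) a t = trans (𝔼-sequence (a Fin.zero) (tabulate (a ∘ Fin.suc)) _)
  (trans (𝔼-cong (a Fin.zero) (λ _ → tab-total n (a ∘ Fin.suc) (t ∘ Fin.suc))) (t Fin.zero))

module _ {n : ℕ} (G : InfluenceGraph n) where

  attempt-total : ∀ u v → Total (attempt G u v)
  attempt-total u v with weight G u v
  ... | just w  = solve 1 (λ w → w :* con 1ℚ :+ ((con 1ℚ :- w) :* con 1ℚ :+ con 0ℚ) := con 1ℚ) refl (value w)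
  ... | nothing = refl

  row : Fin n → Dist (Subset n)
  row u = tab (attempt G u)

  row-total : ∀ u → Total (row u)
  row-total u = tab-total n (attempt G u) (attempt-total u)

  -- Row u of an outcome holds the heads of the live arcs with tail u.
  outcomes : Dist (Vec (Subset n) n)
  outcomes = tab row

  outcomes-total : Total outcomes
  outcomes-total = tab-total n row row-total

anyHit : ∀ {n k} → Subset n → (Fin k → Fin n) → Vec (Subset n) k → Fin n → Bool
anyHit N g []       v = false
anyHit N g (r ∷ rs) v = (lookup N (g Fin.zero) ∧ lookup r v) ∨ anyHit N (g ∘ Fin.suc) rs v

nextNew : ∀ {n} → Vec (Subset n) n → Stage n → Subset n
nextNew L (stage act N) = tabulate λ v → if lookup act v then false else anyHit N id L v

stepᴸ : ∀ {n} → Vec (Subset n) n → Stage n → Stage n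
stepᴸ L s = stage (active s ∪ nextNew L s) (nextNew L s)

stepsᴸ : ∀ {n} → Vec (Subset n) n → ℕ → Stage n → Stage n
stepsᴸ L zero    s = s
stepsᴸ L (suc t) s = stepsᴸ L t (stepᴸ L s)

module _ {n : ℕ} (G : InfluenceGraph n) where

  hitFrom : List (Fin n) → Subset n → Fin n → Dist Bool
  hitFrom us N v = List.foldr
    (λ u d → (if lookup N u then attempt G u v else return false) >>= λ b →
             d >>= λ b′ → return (b ∨ b′))
    (return false) us

  module _ (act N : Subset n) where

    newBit : List (Fin n) → Fin n → Dist Bool
    newBit us v = if lookup act v then return false else hitFrom us N v

    private
      combine : Fin n → Fin n → Bool → Bool → Bool
      combine u v x y = if lookup act v then false else (lookup N u ∧ x) ∨ y

      -- If v is active or u is not new, the process tosses no coin for this pair. Tossing it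
      -- nevertheless and ignoring the result is harmless, since the weights of a coin add up to 1.
      newBit-couples : ∀ u us v → Couples (combine u v) (attempt G u v) (newBit us v) (newBit (u ∷ us) v)
      newBit-couples u us v F with lookup act v
      ... | true = trans (𝔼-cong (attempt G u v) (λ x → trans (𝔼-return false (λ _ → F false)) (sym (𝔼-return false F))))
                     (𝔼-const (attempt G u v) (attempt-total G u v) _)
      ... | false with lookup N u
      ...   | true = sym (trans (𝔼->>= (attempt G u v) _ F)
                (𝔼-cong (attempt G u v) (λ x → 𝔼->>=return (hitFrom us N v) (x ∨_) F)))
      ...   | false = sym (trans (𝔼->>= (return false) (λ b → hitFrom us N v >>= λ b′ → return (b ∨ b′)) F)
                (trans (𝔼-return false (λ b → 𝔼 (hitFrom us N v >>= λ b′ → return (b ∨ b′)) F))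
                (trans (𝔼->>=return (hitFrom us N v) (false ∨_) F)
                   (sym (𝔼-const (attempt G u v) (attempt-total G u v) _)))))

    -- The process groups the coins of a time step by their heads, an outcome groups them by their
    -- tails. The induction adds one tail at a time, for all heads at once, and so converts one
    -- grouping into the other.
    newBits≡outcomes : ∀ k (g : Fin k → Fin n) F →
      𝔼 (tab (newBit (List.tabulate g))) F ≡
      𝔼 (tab (row G ∘ g)) (λ rs → F (tabulate λ v → if lookup act v then false else anyHit N g rs v))
    newBits≡outcomes zero g F =
      trans (nobody (newBit []) (λ v → lookup act v) (λ v → refl) F)
        (sym (𝔼-nil (row G ∘ g) (λ rs → F (tabulate λ v → if lookup act v then false else anyHit N g rs v))))
      where
      -- Without tails no bit can be set, but `newBit [] v` still branches on whether v is active,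
      -- so it does not reduce to `return false`.
      nobody : ∀ {m} (a : Fin m → Dist Bool) (b : Fin m → Bool) →
        (∀ v → a v ≡ (if b v then return false else return false)) → ∀ F →
        𝔼 (tab a) F ≡ F (tabulate λ v → if b v then false else false)
      nobody {zero}  a b eq F = 𝔼-return [] F
      nobody {suc m} a b eq F = trans (𝔼-sequence (a Fin.zero) (tabulate (a ∘ Fin.suc)) F)
        (trans (𝔼-cong (a Fin.zero) (λ x → nobody (a ∘ Fin.suc) (b ∘ Fin.suc) (eq ∘ Fin.suc) (λ as → F (x ∷ as))))
          (trans (cong (λ d → 𝔼 d (λ x → F (x ∷ tabulate (λ v → if b (Fin.suc v) then false else false)))) (eq Fin.zero)) (lemma (b Fin.zero))))
        where
        lemma : ∀ c → 𝔼 (if c then return false else return false) (λ x → F (x ∷ tabulate (λ v → if b (Fin.suc v) then false else false)))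
                ≡ F ((if c then false else false) ∷ tabulate (λ v → if b (Fin.suc v) then false else false))
        lemma true  = 𝔼-return false (λ x → F (x ∷ tabulate (λ v → if b (Fin.suc v) then false else false)))
        lemma false = 𝔼-return false (λ x → F (x ∷ tabulate (λ v → if b (Fin.suc v) then false else false)))
    newBits≡outcomes (suc k) g F = begin
      𝔼 (tab (newBit (u ∷ us))) F
        ≡⟨ tab-couples n (combine u) (attempt G u) (newBit us) (newBit (u ∷ us)) (newBit-couples u us) F ⟨
      𝔼 (row G u) (λ r → 𝔼 (tab (newBit us)) (λ ys → F (tabulate λ v → combine u v (lookup r v) (lookup ys v))))
        ≡⟨ 𝔼-cong (row G u) (λ r → newBits≡outcomes k (g ∘ Fin.suc) _) ⟩
      𝔼 (row G u) (λ r → 𝔼 (tab (row G ∘ g ∘ Fin.suc)) (λ rs → F (tabulate λ v → combine u v (lookup r v)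
        (lookup (tabulate λ v → if lookup act v then false else anyHit N (g ∘ Fin.suc) rs v) v))))
        ≡⟨ 𝔼-cong (row G u) (λ r → 𝔼-cong (tab (row G ∘ g ∘ Fin.suc)) (λ rs → cong F (Vecₚ.tabulate-cong (pointwise r rs)))) ⟩
      𝔼 (row G u) (λ r → 𝔼 (tab (row G ∘ g ∘ Fin.suc)) (λ rs →
        F (tabulate λ v → if lookup act v then false else anyHit N g (r ∷ rs) v)))
        ≡⟨ 𝔼-sequence (row G u) (tabulate (row G ∘ g ∘ Fin.suc)) _ ⟨
      𝔼 (tab (row G ∘ g)) (λ rs → F (tabulate λ v → if lookup act v then false else anyHit N g rs v)) ∎
      where
      open ≡-Reasoning
      u = g Fin.zero
      us = List.tabulate (g ∘ Fin.suc)
      pointwise : ∀ r rs v → combine u v (lookup r v)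
        (lookup (tabulate λ v → if lookup act v then false else anyHit N (g ∘ Fin.suc) rs v) v)
        ≡ (if lookup act v then false else anyHit N g (r ∷ rs) v)
      pointwise r rs v rewrite Vecₚ.lookup∘tabulate (λ v → if lookup act v then false else anyHit N (g ∘ Fin.suc) rs v) v
        with lookup act v
      ... | true  = refl
      ... | false = refl

  𝔼-step : ∀ s F → 𝔼 (step G s) F ≡ 𝔼 (outcomes G) (λ L → F (stepᴸ L s))
  𝔼-step s@(stage act N) F = trans (𝔼->>=return (tab (newBit act N (List.allFin n))) (λ N′ → stage (act ∪ N′) N′) F)
    (newBits≡outcomes act N n id (λ N′ → F (stage (act ∪ N′) N′)))

lookup-∪ : ∀ {n} (X Y : Subset n) v → lookup (X ∪ Y) v ≡ lookup X v ∨ lookup Y v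
lookup-∪ X Y v = Vecₚ.lookup-zipWith _∨_ v X Y

-- The first step of a cascade reads rows of active nodes only, all later steps read the other rows
-- only. Hence an outcome used for the first step and an independent one used afterwards can be
-- merged into one, and by `splice-couples` the merged outcome has the right distribution.
splice : ∀ {n} → Subset n → Vec (Subset n) n → Vec (Subset n) n → Vec (Subset n) n
splice act L L′ = tabulate λ u → if lookup act u then lookup L u else lookup L′ u

anyHit-cong : ∀ {n k} (N : Subset n) (g : Fin k → Fin n) (rs rs′ : Vec (Subset n) k) v →
  (∀ i → lookup N (g i) ≡ true → lookup rs i ≡ lookup rs′ i) → anyHit N g rs v ≡ anyHit N g rs′ v
anyHit-cong N g []       []         v h = refl
anyHit-cong N g (r ∷ rs) (r′ ∷ rs′) v h = cong₂ _∨_ first (anyHit-cong N (g ∘ Fin.suc) rs rs′ v (h ∘ Fin.suc))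
  where
  first : lookup N (g Fin.zero) ∧ lookup r v ≡ lookup N (g Fin.zero) ∧ lookup r′ v
  first with lookup N (g Fin.zero) in eq
  ... | true  = cong (λ r → lookup r v) (h Fin.zero eq)
  ... | false = refl

stepᴸ-cong : ∀ {n} (L L′ : Vec (Subset n) n) s →
  (∀ u → lookup (new s) u ≡ true → lookup L u ≡ lookup L′ u) → stepᴸ L s ≡ stepᴸ L′ s
stepᴸ-cong L L′ s@(stage act N) h = cong (λ N′ → stage (act ∪ N′) N′)
  (Vecₚ.tabulate-cong (λ v → cong (if lookup act v then false else_) (anyHit-cong N id L L′ v h)))

lookup-nextNew : ∀ {n} (L : Vec (Subset n) n) s v →
  lookup (nextNew L s) v ≡ (if lookup (active s) v then false else anyHit (new s) id L v)
lookup-nextNew L s v = Vecₚ.lookup∘tabulate (λ v → if lookup (active s) v then false else anyHit (new s) id L v) v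

nextNew-fresh : ∀ {n} (L : Vec (Subset n) n) s v → lookup (nextNew L s) v ≡ true → lookup (active s) v ≡ false
nextNew-fresh L s v e = go (trans (sym (lookup-nextNew L s v)) e)
  where
  go : ∀ {a b} → (if a then false else b) ≡ true → a ≡ false
  go {false} _ = refl

-- Here `act` is the active set at an earlier time. A node fires only while it is new, and whatever
-- is new after that time lies outside `act`; the rows of `act` are not read again.
stepsᴸ-cong : ∀ {n} (act : Subset n) (L L′ : Vec (Subset n) n) t s →
  (∀ u → lookup act u ≡ false → lookup L u ≡ lookup L′ u) →
  (∀ u → lookup act u ≡ true → lookup (active s) u ≡ true) →
  (∀ u → lookup (new s) u ≡ true → lookup act u ≡ false) →
  stepsᴸ L t s ≡ stepsᴸ L′ t s
stepsᴸ-cong act L L′ zero    s h i j = refl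
stepsᴸ-cong act L L′ (suc t) s h i j = trans (cong (stepsᴸ L t) (stepᴸ-cong L L′ s (λ u e → h u (j u e))))
  (stepsᴸ-cong act L L′ t (stepᴸ L′ s) h
    (λ u e → trans (lookup-∪ (active s) (nextNew L′ s) u) (cong (_∨ lookup (nextNew L′ s) u) (i u e)))
    (λ u e → ¬true (λ e′ → contradiction (trans (sym (i u e′)) (nextNew-fresh L′ s u e)) λ ())))
  where
  ¬true : ∀ {b} → ¬ b ≡ true → b ≡ false
  ¬true {false} _ = refl
  ¬true {true}  h = contradiction refl h

module _ {n : ℕ} (G : InfluenceGraph n) where

  splice-couples : ∀ act → Couples (splice act) (outcomes G) (outcomes G) (outcomes G)
  splice-couples act = tab-couples n (λ u r r′ → if lookup act u then r else r′) (row G) (row G) (row G) each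
    where
    each : ∀ u → Couples (λ r r′ → if lookup act u then r else r′) (row G u) (row G u) (row G u)
    each u F with lookup act u
    ... | true  = 𝔼-cong (row G u) (λ r → 𝔼-const (row G u) (row-total G u) (F r))
    ... | false = 𝔼-const (row G u) (row-total G u) _

  -- Principle of deferred decisions: the coin of an arc is tossed only when
  -- its tail becomes active, so all coins may as well be tossed in advance.
  𝔼-steps : ∀ t s → (∀ u → lookup (new s) u ≡ true → lookup (active s) u ≡ true) → ∀ F →
    𝔼 (steps G t s) F ≡ 𝔼 (outcomes G) (λ L → F (stepsᴸ L t s))
  𝔼-steps zero    s h F = trans (𝔼-return s F) (sym (𝔼-const (outcomes G) (outcomes-total G) (F s)))
  𝔼-steps (suc t) s h F = begin
    𝔼 (steps G (suc t) s) F
      ≡⟨ 𝔼->>= (step G s) (steps G t) F ⟩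
    𝔼 (step G s) (λ s′ → 𝔼 (steps G t s′) F)
      ≡⟨ 𝔼-step G s _ ⟩
    𝔼 Ω (λ L → 𝔼 (steps G t (stepᴸ L s)) F)
      ≡⟨ 𝔼-cong Ω (λ L → 𝔼-steps t (stepᴸ L s) (λ u e →
           trans (lookup-∪ (active s) (nextNew L s) u) (trans (cong (lookup (active s) u ∨_) e) (Boolₚ.∨-zeroʳ _))) F) ⟩
    𝔼 Ω (λ L → 𝔼 Ω (λ L′ → F (stepsᴸ L′ t (stepᴸ L s))))
      ≡⟨ 𝔼-cong Ω (λ L → 𝔼-cong Ω (λ L′ → cong F (local L L′))) ⟩
    𝔼 Ω (λ L → 𝔼 Ω (λ L′ → F (stepsᴸ (splice act L L′) (suc t) s)))
      ≡⟨ splice-couples act (λ L → F (stepsᴸ L (suc t) s)) ⟩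
    𝔼 Ω (λ L → F (stepsᴸ L (suc t) s)) ∎
    where
    open ≡-Reasoning
    act = active s
    Ω = outcomes G
    lookup-splice : ∀ L L′ u → lookup (splice act L L′) u ≡ (if lookup act u then lookup L u else lookup L′ u)
    lookup-splice L L′ u = Vecₚ.lookup∘tabulate (λ u → if lookup act u then lookup L u else lookup L′ u) u
    local : ∀ L L′ → stepsᴸ L′ t (stepᴸ L s) ≡ stepsᴸ (splice act L L′) t (stepᴸ (splice act L L′) s)
    local L L′ = trans
      (cong (stepsᴸ L′ t) (stepᴸ-cong L (splice act L L′) s (λ u e →
         sym (trans (lookup-splice L L′ u) (cong (if_then lookup L u else lookup L′ u) (h u e))))))
      (stepsᴸ-cong act L′ (splice act L L′) t (stepᴸ (splice act L L′) s)
        (λ u e → sym (trans (lookup-splice L L′ u) (cong (if_then lookup L u else lookup L′ u) e)))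
        (λ u e → trans (lookup-∪ act (nextNew (splice act L L′) s) u) (cong (_∨ lookup (nextNew (splice act L L′) s) u) e))
        (λ u e → nextNew-fresh (splice act L L′) s u e))

  liveᴸ : Vec (Subset n) n → Subset n → Subset n
  liveᴸ L X = active (stepsᴸ L n (stage X X))

  p≡𝔼 : ∀ v X → p G v X ≡ 𝔼 (outcomes G) (λ L → if lookup (liveᴸ L X) v then 1ℚ else 0ℚ)
  p≡𝔼 v X = trans (Pr≡𝔼 (λ s → lookup (active s) v) (cascade G X)) (𝔼-steps n (stage X X) (λ u e → e) _)

-- Closures

infix 4 _⊑_
_⊑_ : ∀ {n} → Subset n → Subset n → Set
X ⊑ Y = ∀ v → lookup X v ≡ true → lookup Y v ≡ true

⊑-antisym : ∀ {n} (X Y : Subset n) → X ⊑ Y → Y ⊑ X → ∀ v → lookup X v ≡ lookup Y v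
⊑-antisym X Y p q v with lookup X v in e | lookup Y v in e′
... | true  | true  = refl
... | false | false = refl
... | true  | false = trans (sym (p v e)) e′
... | false | true  = trans (sym e) (q v e′)

module _ {n : ℕ} (ℓ : Fin n → Fin n → Bool) where

  Closed : Subset n → Set
  Closed Z = ∀ u v → lookup Z u ≡ true → ℓ u v ≡ true → lookup Z v ≡ true

  record IsClosure (X Z : Subset n) : Set where
    field
      contains : X ⊑ Z
      closed   : Closed Z
      least    : ∀ Z′ → X ⊑ Z′ → Closed Z′ → Z ⊑ Z′
  open IsClosure public

  isClosure-unique : ∀ {X Z Z′} → IsClosure X Z → IsClosure X Z′ → ∀ v → lookup Z v ≡ lookup Z′ v
  isClosure-unique {Z = Z} {Z′} c c′ = ⊑-antisym Z Z′ (least c Z′ (contains c′) (closed c′)) (least c′ Z (contains c) (closed c))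

  -- A closure computed in rounds gains a node per round until it is closed.
  Growth : ℕ → Subset n → Set
  Growth t Z = Closed Z ⊎ t ≤ ∣ Z ∣

  -- Either some node is gained, and the cardinality grows, or `A′` equals `A`, and then `next` says
  -- that it is closed. Once the set is closed, `sound` keeps it from changing. The lemma serves for
  -- the cascade and for the sweeps of the program.
  growth-step : ∀ {t} A A′ → Growth t A → A ⊑ A′ →
    (∀ u v → lookup A u ≡ true → ℓ u v ≡ true → lookup A′ v ≡ true) →
    (Closed A → A′ ⊑ A) → Growth (suc t) A′
  growth-step {t} A A′ g A⊑A′ next sound with Finₚ.any? (λ v → lookup A v Boolₚ.<? lookup A′ v)
  ... | no none = inj₁ (λ u v e → next u v (A′⊑A u e))
    where
    A′⊑A : A′ ⊑ A
    A′⊑A v e with lookup A v in e′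
    ... | true  = refl
    ... | false = contradiction (v , subst₂ Bool._<_ (sym e′) (sym e) f<t) none
  growth-step {t} A A′ (inj₁ c) A⊑A′ next sound | yes _ = inj₁ (λ u v e l → next u v (sound c u e) l)
  growth-step {t} A A′ (inj₂ t≤) A⊑A′ next sound | yes (v , lt) =
    inj₂ (≤-trans (s≤s t≤) (Subsetₚ.p⊂q⇒∣p∣<∣q∣ {p = A} {q = A′}
      ((λ {x} x∈ → Vecₚ.lookup⇒[]= x A′ (A⊑A′ x (Vecₚ.[]=⇒lookup x∈)))
      , v , Vecₚ.lookup⇒[]= v A′ (proj₂ (split lt)) , λ v∈ → contradiction (trans (sym (Vecₚ.[]=⇒lookup v∈)) (proj₁ (split lt))) λ ())))
    where
    split : ∀ {a b} → a Bool.< b → a ≡ false × b ≡ true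
    split f<t = refl , refl

  growth-full : ∀ A → Growth n A → Closed A
  growth-full A (inj₁ c) = c
  growth-full A (inj₂ n≤) u v _ _ =
    trans (cong (λ Z → lookup Z v) (Subsetₚ.∣p∣≡n⇒p≡⊤ {p = A} (≤-antisym (Subsetₚ.∣p∣≤n A) n≤))) (Vecₚ.lookup-replicate v true)

arcsᴸ : ∀ {n} → Vec (Subset n) n → Fin n → Fin n → Bool
arcsᴸ L u v = lookup (lookup L u) v

anyHit⇒ : ∀ {n k} (N : Subset n) (g : Fin k → Fin n) (rs : Vec (Subset n) k) v → anyHit N g rs v ≡ true →
  ∃ λ i → lookup N (g i) ≡ true × lookup (lookup rs i) v ≡ true
anyHit⇒ N g (r ∷ rs) v e with lookup N (g Fin.zero) in e₁ | lookup r v in e₂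
... | true  | true  = Fin.zero , e₁ , e₂
... | true  | false with anyHit⇒ N (g ∘ Fin.suc) rs v e
...   | i , q = Fin.suc i , q
anyHit⇒ N g (r ∷ rs) v e | false | _ with anyHit⇒ N (g ∘ Fin.suc) rs v e
...   | i , q = Fin.suc i , q

anyHit⇐ : ∀ {n k} (N : Subset n) (g : Fin k → Fin n) (rs : Vec (Subset n) k) v i →
  lookup N (g i) ≡ true → lookup (lookup rs i) v ≡ true → anyHit N g rs v ≡ true
anyHit⇐ N g (r ∷ rs) v Fin.zero    e₁ e₂ rewrite e₁ | e₂ = refl
anyHit⇐ N g (r ∷ rs) v (Fin.suc i) e₁ e₂ =
  trans (cong (_ ∨_) (anyHit⇐ N (g ∘ Fin.suc) rs v i e₁ e₂)) (Boolₚ.∨-zeroʳ _)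

module _ {n : ℕ} (L : Vec (Subset n) n) where

  private ℓ = arcsᴸ L

  -- Only new nodes fire in the cascade, whereas a closure has to respect the arcs out of all active
  -- nodes. The field `frontier` bridges this: a node that is no longer new has already activated
  -- its successors along live arcs.
  record Spreading (X : Subset n) (t : ℕ) (s : Stage n) : Set where
    field
      new⊑     : new s ⊑ active s
      frontier : ∀ u v → lookup (active s) u ≡ true → lookup (new s) u ≡ false → ℓ u v ≡ true → lookup (active s) v ≡ true
      seeds    : X ⊑ active s
      sound    : ∀ Z → X ⊑ Z → Closed ℓ Z → active s ⊑ Z
      growth   : Growth ℓ t (active s)
  open Spreading

  spreading-step : ∀ X t s → Spreading X t s → Spreading X (suc t) (stepᴸ L s)
  spreading-step X t s sp = record
    { new⊑     = λ v e → trans (lookup-∪ act N′ v) (trans (cong (lookup act v ∨_) e) (Boolₚ.∨-zeroʳ _))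
    ; frontier = λ u v e e′ l → onward u v (old u e e′) l
    ; seeds    = λ v e → act⊑ v (seeds sp v e)
    ; sound    = λ Z X⊑ c → sound′ Z c (sound sp Z X⊑ c)
    ; growth   = growth-step ℓ act (act ∪ N′) (growth sp) act⊑ onward (λ c → sound′ act c (λ _ e → e))
    }
    where
    act = active s
    N′ = nextNew L s
    act⊑ : act ⊑ act ∪ N′
    act⊑ v e = trans (lookup-∪ act N′ v) (cong (_∨ lookup N′ v) e)
    old : ∀ u → lookup (act ∪ N′) u ≡ true → lookup N′ u ≡ false → lookup act u ≡ true
    old u e e′ = trans (sym (Boolₚ.∨-identityʳ _)) (trans (cong (lookup act u ∨_) (sym e′)) (trans (sym (lookup-∪ act N′ u)) e))
    onward : ∀ u v → lookup act u ≡ true → ℓ u v ≡ true → lookup (act ∪ N′) v ≡ true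
    onward u v e l with lookup (new s) u in eᴺ
    ... | false = act⊑ v (frontier sp u v e eᴺ l)
    ... | true  = trans (lookup-∪ act N′ v) (trans (cong (lookup act v ∨_) (lookup-nextNew L s v))
                    (lemma (lookup act v) (anyHit⇐ (new s) id L v u eᴺ l)))
      where
      lemma : ∀ a {b} → b ≡ true → a ∨ (if a then false else b) ≡ true
      lemma true  _ = refl
      lemma false e = e
    sound′ : ∀ Z → Closed ℓ Z → act ⊑ Z → act ∪ N′ ⊑ Z
    sound′ Z c act⊑Z v e with lookup act v in eᴬ | trans (sym (lookup-∪ act N′ v)) e
    ... | true  | _  = act⊑Z v eᴬ
    ... | false | e₁ with anyHit⇒ (new s) id L v (trans (sym (trans (lookup-nextNew L s v) (cong (if_then false else anyHit (new s) id L v) eᴬ))) e₁)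
    ...   | u , eᴺ , l = c u v (act⊑Z u (new⊑ sp u eᴺ)) l

  spreading-steps : ∀ X r t s → Spreading X t s → Spreading X (r + t) (stepsᴸ L r s)
  spreading-steps X zero    t s sp = sp
  spreading-steps X (suc r) t s sp = subst (λ k → Spreading X k (stepsᴸ L r (stepᴸ L s))) (+-suc r t)
    (spreading-steps X r (suc t) _ (spreading-step X t s sp))

  activeᴸ : Subset n → Subset n
  activeᴸ X = active (stepsᴸ L n (stage X X))

  active-isClosure : ∀ X → IsClosure ℓ X (activeᴸ X)
  active-isClosure X = record
    { contains = seeds final ; closed = growth-full ℓ (activeᴸ X) (growth final) ; least = sound final }
    where
    final = subst (λ t → Spreading X t (stepsᴸ L n (stage X X))) (+-identityʳ n)
      -- All active nodes are new at the start, which makes `frontier` vacuous.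
      (spreading-steps X n 0 (stage X X) record
        { new⊑ = λ _ e → e ; frontier = λ u v e e′ → contradiction (trans (sym e) e′) λ ()
        ; seeds = λ _ e → e ; sound = λ _ X⊑ _ → X⊑ ; growth = inj₂ z≤n })

module _ {n : ℕ} {ℓ : Fin n → Fin n → Bool} where

  -- Whatever leaves `R` passes through `H`, and every node of `H` is hit directly from `R`. Outside
  -- `R` the closure of `R` thus agrees with that of `H`, even if the latter leads back into `R`.
  -- This is why, for a fixed guess, the nodes reached outside do not depend on `R` any further.
  closure-restart : ∀ R H Z W → (∀ u v → lookup R u ≡ true → ℓ u v ≡ true → lookup R v ≡ true ⊎ lookup H v ≡ true) →
    (∀ v → lookup H v ≡ true → ∃ λ u → lookup R u ≡ true × ℓ u v ≡ true) →
    IsClosure ℓ R Z → IsClosure ℓ H W → ∀ v → lookup Z v ≡ lookup R v ∨ lookup W v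
  closure-restart R H Z W exits heads z w v = trans (⊑-antisym Z (R ∪ W) Z⊑ ⊑Z v) (lookup-∪ R W v)
    where
    R⊑ : R ⊑ R ∪ W
    R⊑ v e = trans (lookup-∪ R W v) (cong (_∨ lookup W v) e)
    W⊑ : W ⊑ R ∪ W
    W⊑ v e = trans (lookup-∪ R W v) (trans (cong (lookup R v ∨_) e) (Boolₚ.∨-zeroʳ _))
    ∪-closed : Closed ℓ (R ∪ W)
    ∪-closed u v e l with lookup R u in eᴿ | trans (sym (lookup-∪ R W u)) e
    ... | false | eᵂ = W⊑ v (closed w u v eᵂ l)
    ... | true  | _ with exits u v eᴿ l
    ...   | inj₁ r = R⊑ v r
    ...   | inj₂ h = W⊑ v (contains w v h)
    Z⊑ : Z ⊑ R ∪ W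
    Z⊑ = least z (R ∪ W) R⊑ ∪-closed
    H⊑Z : H ⊑ Z
    H⊑Z v e with heads v e
    ... | u , r , l = closed z u v (contains z u r) l
    ⊑Z : R ∪ W ⊑ Z
    ⊑Z v e with lookup R v in eᴿ | trans (sym (lookup-∪ R W v)) e
    ... | true  | _  = contains z v eᴿ
    ... | false | eᵂ = least w Z H⊑Z (closed z) v eᵂ

  -- With the certain arcs for `δ`, which are live in every outcome, this shows that a set and its
  -- closure under certain arcs activate the same nodes.
  closure-absorb : ∀ {δ} X R Z Z′ → (∀ u v → δ u v ≡ true → ℓ u v ≡ true) →
    IsClosure δ X R → IsClosure ℓ X Z → IsClosure ℓ R Z′ → ∀ v → lookup Z v ≡ lookup Z′ v
  closure-absorb X R Z Z′ δ⊆ℓ r z z′ = ⊑-antisym Z Z′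
    (least z Z′ (λ v e → contains z′ v (contains r v e)) (closed z′))
    (least z′ Z (least r Z (contains z) (λ u v e d → closed z u v e (δ⊆ℓ u v d))) (closed z))

-- Enumerating the outcomes

sumTo : ℕ → (ℕ → ℚ) → ℚ
sumTo zero    f = 0ℚ
sumTo (suc n) f = sumTo n f ℚ.+ f n

sumTo-cong : ∀ n {f g : ℕ → ℚ} → (∀ k → k < n → f k ≡ g k) → sumTo n f ≡ sumTo n g
sumTo-cong zero    h = refl
sumTo-cong (suc n) h = cong₂ ℚ._+_ (sumTo-cong n (λ k k< → h k (m<n⇒m<1+n k<))) (h n ≤-refl)

sumTo-+ : ∀ n (f g : ℕ → ℚ) → sumTo n (λ k → f k ℚ.+ g k) ≡ sumTo n f ℚ.+ sumTo n g
sumTo-+ zero    f g = refl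
sumTo-+ (suc n) f g = trans (cong (ℚ._+ (f n ℚ.+ g n)) (sumTo-+ n f g))
  (solve 4 (λ a b c d → (a :+ b) :+ (c :+ d) := (a :+ c) :+ (b :+ d)) refl (sumTo n f) (sumTo n g) (f n) (g n))

sumTo-* : ∀ n c (f : ℕ → ℚ) → sumTo n (λ k → c ℚ.* f k) ≡ c ℚ.* sumTo n f
sumTo-* zero    c f = sym (ℚₚ.*-zeroʳ c)
sumTo-* (suc n) c f = trans (cong (ℚ._+ (c ℚ.* f n)) (sumTo-* n c f)) (sym (ℚₚ.*-distribˡ-+ c (sumTo n f) (f n)))

sumTo-mono : ∀ n {f g : ℕ → ℚ} → (∀ k → k < n → f k ℚ.≤ g k) → sumTo n f ℚ.≤ sumTo n g
sumTo-mono zero    h = ℚₚ.≤-refl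
sumTo-mono (suc n) h = ℚₚ.+-mono-≤ (sumTo-mono n (λ k k< → h k (m<n⇒m<1+n k<))) (h n ≤-refl)

sumTo-zero : ∀ n → sumTo n (λ _ → 0ℚ) ≡ 0ℚ
sumTo-zero zero    = refl
sumTo-zero (suc n) = trans (ℚₚ.+-identityʳ _) (sumTo-zero n)

sumTo-split : ∀ a b (f : ℕ → ℚ) → sumTo (a + b) f ≡ sumTo a f ℚ.+ sumTo b (λ k → f (a + k))
sumTo-split a zero    f = trans (cong (λ n → sumTo n f) (+-identityʳ a)) (sym (ℚₚ.+-identityʳ _))
sumTo-split a (suc b) f = trans (cong (λ n → sumTo n f) (+-suc a b))
  (trans (cong (ℚ._+ f (a + b)) (sumTo-split a b f)) (ℚₚ.+-assoc (sumTo a f) _ _))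

contents-< : ∀ {A : Set} (z : A) xs {ys} j → j < List.length xs → contents z (xs List.++ ys) j ≡ contents z xs j
contents-< z (x ∷ xs) zero    j< = refl
contents-< z (x ∷ xs) (suc j) j< = contents-< z xs j (s≤s⁻¹ j<)

contents-≥ : ∀ {A : Set} (z : A) xs {ys} j → contents z (xs List.++ ys) (List.length xs + j) ≡ contents z ys j
contents-≥ z []       j = refl
contents-≥ z (x ∷ xs) j = contents-≥ z xs j

contents-toList : ∀ {A : Set} {n} (z : A) (xs : Vec A n) i → contents z (Vec.toList xs) (toℕ i) ≡ lookup xs i
contents-toList z (x ∷ xs) Fin.zero    = refl
contents-toList z (x ∷ xs) (Fin.suc i) = contents-toList z xs i

contents-tabulate : ∀ {A : Set} {n} (z : A) (f : Fin n → A) i → contents z (List.tabulate f) (toℕ i) ≡ f i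
contents-tabulate z f Fin.zero    = refl
contents-tabulate z f (Fin.suc i) = contents-tabulate z (f ∘ Fin.suc) i

index : ∀ {n} → Fin n → Fin n → ℕ
index {n} u v = toℕ u * n + toℕ v

flat : ∀ {n k} → Vec (Subset n) k → List Bool
flat []       = []
flat (r ∷ rs) = Vec.toList r List.++ flat rs

contents-flat : ∀ {n k} (L : Vec (Subset n) k) u v →
  contents false (flat L) (toℕ u * n + toℕ v) ≡ lookup (lookup L u) v
contents-flat {n} (r ∷ rs) Fin.zero v = trans (contents-< false (Vec.toList r) (toℕ v)
    (≤-trans (Finₚ.toℕ<n v) (≤-reflexive (sym (Vecₚ.length-toList r))))) (contents-toList false r v)
contents-flat {n} (r ∷ rs) (Fin.suc u) v = trans (cong (contents false (flat (r ∷ rs)))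
    (trans (+-assoc n _ _) (cong (_+ (toℕ u * n + toℕ v)) (sym (Vecₚ.length-toList r)))))
  (trans (contents-≥ false (Vec.toList r) _) (contents-flat rs u v))

rows : ∀ n → List Bool → Vec (Subset n) n
rows n xs = tabulate λ u → tabulate λ v → contents false xs (index u v)

lookup-rows : ∀ {n} xs (u v : Fin n) → lookup (lookup (rows n xs) u) v ≡ contents false xs (index u v)
lookup-rows xs u v = trans (cong (λ r → lookup r v) (Vecₚ.lookup∘tabulate (λ u → tabulate λ v → contents false xs (index u v)) u))
  (Vecₚ.lookup∘tabulate (λ v → contents false xs (index u v)) v)

rows-flat : ∀ {n} (L : Vec (Subset n) n) → rows n (flat L) ≡ L
rows-flat L = trans (Vecₚ.tabulate-cong (λ u → trans (Vecₚ.tabulate-cong (contents-flat L u)) (Vecₚ.tabulate∘lookup (lookup L u))))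
  (Vecₚ.tabulate∘lookup L)

isRandom isCertain : ℚ → Bool
isRandom w  = not (w ℚ.≤ᵇ 0ℚ) ∧ not (1ℚ ℚ.≤ᵇ w)
isCertain w = 1ℚ ℚ.≤ᵇ w

#random : List ℚ → ℕ
#random []       = 0
#random (w ∷ ws) = if isRandom w then suc (#random ws) else #random ws

-- The outcome of the coins ws with number x; x is read as a binary number whose
-- leading digit decides the first coin that is random.
decode : List ℚ → ℕ → List Bool
decode []       x = []
decode (w ∷ ws) x =
  if isRandom w then (if 2 ^ #random ws ≤ᵇ x then true ∷ decode ws (x ∸ 2 ^ #random ws) else false ∷ decode ws x)
  else isCertain w ∷ decode ws x

prob : List ℚ → ℕ → ℚ
prob []       x = 1ℚ
prob (w ∷ ws) x =
  if isRandom w then (if 2 ^ #random ws ≤ᵇ x then w ℚ.* prob ws (x ∸ 2 ^ #random ws) else (1ℚ ℚ.- w) ℚ.* prob ws x)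
  else prob ws x

-- It branches on every coin, also on those of weight 0 or 1, and can therefore be matched with the
-- cascade cell by cell; `sumTo-outcomes` then discards the branches of weight 0.
expected : List ℚ → (List Bool → ℚ) → ℚ
expected []       F = F []
expected (w ∷ ws) F = w ℚ.* expected ws (F ∘ (true ∷_)) ℚ.+ (1ℚ ℚ.- w) ℚ.* expected ws (F ∘ (false ∷_))

expected-++ : ∀ ws ws′ F → expected (ws List.++ ws′) F ≡ expected ws (λ xs → expected ws′ (λ ys → F (xs List.++ ys)))
expected-++ []       ws′ F = refl
expected-++ (w ∷ ws) ws′ F = cong₂ (λ x y → w ℚ.* x ℚ.+ (1ℚ ℚ.- w) ℚ.* y) (expected-++ ws ws′ _) (expected-++ ws ws′ _)

expected-one : ∀ ws → expected ws (λ _ → 1ℚ) ≡ 1ℚ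
expected-one []       = refl
expected-one (w ∷ ws) rewrite expected-one ws = solve 1 (λ w → w :* con 1ℚ :+ (con 1ℚ :- w) :* con 1ℚ := con 1ℚ) refl w

Probability : ℚ → Set
Probability w = 0ℚ ℚ.≤ w × w ℚ.≤ 1ℚ

T⇒≡ : ∀ {b} → T b → b ≡ true
T⇒≡ {true} _ = refl

≡⇒T : ∀ {b} → b ≡ true → T b
≡⇒T refl = tt

¬T⇒≡ : ∀ {b} → ¬ T b → b ≡ false
¬T⇒≡ {false} _ = refl
¬T⇒≡ {true}  h = contradiction tt h

≡⇒¬T : ∀ {b} → b ≡ false → ¬ T b
≡⇒¬T refl ()

data Coin (w : ℚ) : Set where
  random   : isRandom w ≡ true → 0ℚ ℚ.< w → w ℚ.< 1ℚ → Coin w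
  constant : isRandom w ≡ false → w ≡ (if isCertain w then 1ℚ else 0ℚ) → Coin w

≤ᵇ≡true : ∀ p q → (p ℚ.≤ᵇ q) ≡ true → p ℚ.≤ q
≤ᵇ≡true p q e = ℚₚ.≤ᵇ⇒≤ (≡⇒T e)

≤ᵇ≡false : ∀ p q → (p ℚ.≤ᵇ q) ≡ false → q ℚ.< p
≤ᵇ≡false p q e = ℚₚ.≰⇒> λ p≤q → ≡⇒¬T e (ℚₚ.≤⇒≤ᵇ p≤q)

0<1ℚ : 0ℚ ℚ.< 1ℚ
0<1ℚ = ℚₚ.positive⁻¹ 1ℚ

coin : ∀ w → Probability w → Coin w
coin w (0≤w , w≤1) with w ℚ.≤ᵇ 0ℚ in e₀ | 1ℚ ℚ.≤ᵇ w in e₁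
... | false | false = random (cong₂ (λ a b → not a ∧ not b) e₀ e₁) (≤ᵇ≡false w 0ℚ e₀) (≤ᵇ≡false 1ℚ w e₁)
... | false | true  = constant (cong₂ (λ a b → not a ∧ not b) e₀ e₁)
  (trans (ℚₚ.≤-antisym w≤1 (≤ᵇ≡true 1ℚ w e₁)) (cong (if_then 1ℚ else 0ℚ) (sym e₁)))
... | true  | false = constant (cong₂ (λ a b → not a ∧ not b) e₀ e₁)
  (trans (ℚₚ.≤-antisym (≤ᵇ≡true w 0ℚ e₀) 0≤w) (cong (if_then 1ℚ else 0ℚ) (sym e₁)))
... | true  | true  = contradiction (ℚₚ.<-≤-trans 0<1ℚ (ℚₚ.≤-trans (≤ᵇ≡true 1ℚ w e₁) (≤ᵇ≡true w 0ℚ e₀))) (ℚₚ.<-irrefl refl)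

m≤ᵇm+n : ∀ m n → (m ≤ᵇ m + n) ≡ true
m≤ᵇm+n m n = T⇒≡ (≤⇒≤ᵇ (m≤m+n m n))

<⇒≤ᵇ≡false : ∀ {m n} → n < m → (m ≤ᵇ n) ≡ false
<⇒≤ᵇ≡false n<m = ¬T⇒≡ (λ t → <⇒≱ n<m (≤ᵇ⇒≤ _ _ t))

double : ∀ k → 2 ^ suc k ≡ 2 ^ k + 2 ^ k
double k = cong (2 ^ k +_) (+-identityʳ (2 ^ k))

-- A random coin splits the range of numbers into halves: it fails in the lower one and succeeds in
-- the upper one. Any other coin has a branch of weight 0 and leaves the range as it is, so 2 ^ r
-- numbers suffice for all n * n cells.
sumTo-outcomes : ∀ ws → All Probability ws → ∀ F →
  sumTo (2 ^ #random ws) (λ x → prob ws x ℚ.* F (decode ws x)) ≡ expected ws F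
sumTo-outcomes []       []       F = trans (ℚₚ.+-identityˡ _) (ℚₚ.*-identityˡ (F []))
sumTo-outcomes (w ∷ ws) (v ∷ vs) F with coin w v
... | constant e w≡ rewrite e = begin
  sumTo R (λ x → prob ws x ℚ.* F (isCertain w ∷ decode ws x))
    ≡⟨ sumTo-outcomes ws vs (F ∘ (isCertain w ∷_)) ⟩
  expected ws (F ∘ (isCertain w ∷_))
    ≡⟨ lemma (isCertain w) ⟩
  c (isCertain w) ℚ.* expected ws (F ∘ (true ∷_)) ℚ.+ (1ℚ ℚ.- c (isCertain w)) ℚ.* expected ws (F ∘ (false ∷_))
    ≡⟨ cong (λ w → w ℚ.* expected ws (F ∘ (true ∷_)) ℚ.+ (1ℚ ℚ.- w) ℚ.* expected ws (F ∘ (false ∷_))) w≡ ⟨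
  w ℚ.* expected ws (F ∘ (true ∷_)) ℚ.+ (1ℚ ℚ.- w) ℚ.* expected ws (F ∘ (false ∷_)) ∎
  where
  open ≡-Reasoning
  R = 2 ^ #random ws
  c : Bool → ℚ
  c b = if b then 1ℚ else 0ℚ
  lemma : ∀ b → expected ws (F ∘ (b ∷_)) ≡ c b ℚ.* expected ws (F ∘ (true ∷_)) ℚ.+ (1ℚ ℚ.- c b) ℚ.* expected ws (F ∘ (false ∷_))
  lemma true  = solve 2 (λ x y → x := con 1ℚ :* x :+ (con 1ℚ :- con 1ℚ) :* y) refl (expected ws (F ∘ (true ∷_))) (expected ws (F ∘ (false ∷_)))
  lemma false = solve 2 (λ x y → y := con 0ℚ :* x :+ (con 1ℚ :- con 0ℚ) :* y) refl (expected ws (F ∘ (true ∷_))) (expected ws (F ∘ (false ∷_)))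
... | random e _ _ rewrite e = begin
  sumTo (2 ^ suc (#random ws)) f
    ≡⟨ cong (λ n → sumTo n f) (double (#random ws)) ⟩
  sumTo (R + R) f
    ≡⟨ sumTo-split R R f ⟩
  sumTo R f ℚ.+ sumTo R (λ x → f (R + x))
    ≡⟨ cong₂ ℚ._+_ (sumTo-cong R low) (sumTo-cong R (λ x _ → high x)) ⟩
  sumTo R (λ x → (1ℚ ℚ.- w) ℚ.* g false x) ℚ.+ sumTo R (λ x → w ℚ.* g true x)
    ≡⟨ cong₂ ℚ._+_ (sumTo-* R (1ℚ ℚ.- w) (g false)) (sumTo-* R w (g true)) ⟩
  (1ℚ ℚ.- w) ℚ.* sumTo R (g false) ℚ.+ w ℚ.* sumTo R (g true)
    ≡⟨ ℚₚ.+-comm ((1ℚ ℚ.- w) ℚ.* sumTo R (g false)) _ ⟩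
  w ℚ.* sumTo R (g true) ℚ.+ (1ℚ ℚ.- w) ℚ.* sumTo R (g false)
    ≡⟨ cong₂ (λ x y → w ℚ.* x ℚ.+ (1ℚ ℚ.- w) ℚ.* y) (sumTo-outcomes ws vs (F ∘ (true ∷_))) (sumTo-outcomes ws vs (F ∘ (false ∷_))) ⟩
  w ℚ.* expected ws (F ∘ (true ∷_)) ℚ.+ (1ℚ ℚ.- w) ℚ.* expected ws (F ∘ (false ∷_)) ∎
  where
  open ≡-Reasoning
  R = 2 ^ #random ws
  f : ℕ → ℚ
  f x = (if R ≤ᵇ x then w ℚ.* prob ws (x ∸ R) else (1ℚ ℚ.- w) ℚ.* prob ws x)
        ℚ.* F (if R ≤ᵇ x then true ∷ decode ws (x ∸ R) else false ∷ decode ws x)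
  g : Bool → ℕ → ℚ
  g b x = prob ws x ℚ.* F (b ∷ decode ws x)
  low : ∀ x → x < R → f x ≡ (1ℚ ℚ.- w) ℚ.* g false x
  low x x<R rewrite <⇒≤ᵇ≡false x<R = ℚₚ.*-assoc (1ℚ ℚ.- w) (prob ws x) _
  high : ∀ x → f (R + x) ≡ w ℚ.* g true x
  high x rewrite m≤ᵇm+n R x | m+n∸m≡n R x = ℚₚ.*-assoc w (prob ws x) _

0≤* : ∀ {x y} → 0ℚ ℚ.≤ x → 0ℚ ℚ.≤ y → 0ℚ ℚ.≤ x ℚ.* y
0≤* {x} {y} 0≤x 0≤y = ℚₚ.≤-trans (ℚₚ.≤-reflexive (sym (ℚₚ.*-zeroʳ x)))
  (ℚₚ.*-monoˡ-≤-nonNeg x {{ℚ.nonNegative 0≤x}} 0≤y)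

≤⇒0≤- : ∀ {x y} → x ℚ.≤ y → 0ℚ ℚ.≤ y ℚ.- x
≤⇒0≤- {x} {y} x≤y = ℚₚ.≤-trans (ℚₚ.≤-reflexive (sym (ℚₚ.+-inverseʳ x))) (ℚₚ.+-monoˡ-≤ (ℚ.- x) x≤y)

prob≥0 : ∀ ws → All Probability ws → ∀ x → 0ℚ ℚ.≤ prob ws x
prob≥0 []       []       x = ℚₚ.nonNegative⁻¹ 1ℚ
prob≥0 (w ∷ ws) ((0≤w , w≤1) ∷ vs) x with isRandom w
... | false = prob≥0 ws vs x
... | true with 2 ^ #random ws ≤ᵇ x
...   | true  = 0≤* 0≤w (prob≥0 ws vs _)
...   | false = 0≤* (≤⇒0≤- w≤1) (prob≥0 ws vs _)

decode-constant : ∀ ws x j → isRandom (contents 0ℚ ws j) ≡ false → contents false (decode ws x) j ≡ isCertain (contents 0ℚ ws j)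
decode-constant []       x j       e = refl
decode-constant (w ∷ ws) x zero    e rewrite e = refl
decode-constant (w ∷ ws) x (suc j) e with isRandom w
... | false = decode-constant ws x j e
... | true with 2 ^ #random ws ≤ᵇ x
...   | true  = decode-constant ws _ j e
...   | false = decode-constant ws _ j e

-- Completeness of the enumeration of guesses: whichever random arcs have their tails in the desired
-- set, some mask says so. At the remaining cells the decoded bit is dictated by the weight.
decode-surjective : ∀ ws (β : ℕ → Bool) → ∃ λ x → x < 2 ^ #random ws ×
  (∀ j → isRandom (contents 0ℚ ws j) ≡ true → contents false (decode ws x) j ≡ β j)
decode-surjective []       β = 0 , ≤-refl , λ j ()
decode-surjective (w ∷ ws) β with decode-surjective ws (β ∘ suc) | isRandom w in e
... | x , x< , h | false = x , x< , λ where
        zero    e′ → contradiction (trans (sym e) e′) λ ()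
        (suc j) e′ → h j e′
... | x , x< , h | true with β 0 in e₀
...   | false = x , ≤-trans x< (m≤m+n _ _) , agree
  where
  agree : ∀ j → isRandom (contents 0ℚ (w ∷ ws) j) ≡ true →
    contents false (if 2 ^ #random ws ≤ᵇ x then true ∷ decode ws (x ∸ 2 ^ #random ws) else false ∷ decode ws x) j ≡ β j
  agree j e′ rewrite <⇒≤ᵇ≡false x< with j
  ... | zero  = sym e₀
  ... | suc j = h j e′
...   | true = 2 ^ #random ws + x , ≤-trans (+-monoʳ-< (2 ^ #random ws) x<) (≤-reflexive (sym (double (#random ws)))) , agree
  where
  agree : ∀ j → isRandom (contents 0ℚ (w ∷ ws) j) ≡ true →
    contents false (if 2 ^ #random ws ≤ᵇ 2 ^ #random ws + x then true ∷ decode ws (2 ^ #random ws + x ∸ 2 ^ #random ws)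
                    else false ∷ decode ws (2 ^ #random ws + x)) j ≡ β j
  agree j e′ rewrite m≤ᵇm+n (2 ^ #random ws) x | m+n∸m≡n (2 ^ #random ws) x with j
  ... | zero  = sym e₀
  ... | suc j = h j e′

length-cartesianProduct : ∀ {A B : Set} (xs : List A) (ys : List B) →
  List.length (List.cartesianProduct xs ys) ≡ List.length xs * List.length ys
length-cartesianProduct []       ys = refl
length-cartesianProduct (x ∷ xs) ys = trans (Listₚ.length-++ (List.map (x ,_) ys))
  (cong₂ _+_ (Listₚ.length-map (x ,_) ys) (length-cartesianProduct xs ys))

module _ {n : ℕ} (G : InfluenceGraph n) where

  weights : List ℚ
  weights = List.map (entry G) (pairs n)

  entry-probability : ∀ a → Probability (entry G a)
  entry-probability (u , v) with weight G u v
  ... | just w  = ℚₚ.<⇒≤ (positive w) , atMost1 w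
  ... | nothing = ℚₚ.≤-refl , ℚₚ.nonNegative⁻¹ 1ℚ

  weights-probability : All Probability weights
  weights-probability = Allₚ.map⁺ (All.universal entry-probability (pairs n))

  𝔼-attempt : ∀ u v F → 𝔼 (attempt G u v) F ≡ entry G (u , v) ℚ.* F true ℚ.+ (1ℚ ℚ.- entry G (u , v)) ℚ.* F false
  𝔼-attempt u v F with weight G u v
  ... | just w  = cong (value w ℚ.* F true ℚ.+_) (ℚₚ.+-identityʳ _)
  ... | nothing = solve 2 (λ x y → con 1ℚ :* y :+ con 0ℚ := con 0ℚ :* x :+ (con 1ℚ :- con 0ℚ) :* y) refl (F true) (F false)

  𝔼-row : ∀ u k (g : Fin k → Fin n) F → 𝔼 (tab (attempt G u ∘ g)) (F ∘ Vec.toList) ≡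
    expected (List.map (entry G) (List.map (u ,_) (List.tabulate g))) F
  𝔼-row u zero    g F = 𝔼-nil (attempt G u ∘ g) (F ∘ Vec.toList)
  𝔼-row u (suc k) g F = trans (𝔼-sequence (attempt G u (g Fin.zero)) (tabulate (attempt G u ∘ g ∘ Fin.suc)) (F ∘ Vec.toList))
    (trans (𝔼-attempt u (g Fin.zero) _)
      (cong₂ (λ x y → entry G (u , g Fin.zero) ℚ.* x ℚ.+ (1ℚ ℚ.- entry G (u , g Fin.zero)) ℚ.* y)
        (𝔼-row u k (g ∘ Fin.suc) (F ∘ (true ∷_))) (𝔼-row u k (g ∘ Fin.suc) (F ∘ (false ∷_)))))

  𝔼-rows : ∀ k (g : Fin k → Fin n) F → 𝔼 (tab (row G ∘ g)) (F ∘ flat) ≡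
    expected (List.map (entry G) (List.cartesianProduct (List.tabulate g) (List.allFin n))) F
  𝔼-rows zero    g F = 𝔼-nil (row G ∘ g) (F ∘ flat)
  𝔼-rows (suc k) g F = begin
    𝔼 (tab (row G ∘ g)) (F ∘ flat)
      ≡⟨ 𝔼-sequence (row G (g Fin.zero)) (tabulate (row G ∘ g ∘ Fin.suc)) (F ∘ flat) ⟩
    𝔼 (row G (g Fin.zero)) (λ r → 𝔼 (tab (row G ∘ g ∘ Fin.suc)) (λ rs → F (Vec.toList r List.++ flat rs)))
      ≡⟨ 𝔼-cong (row G (g Fin.zero)) (λ r → 𝔼-rows k (g ∘ Fin.suc) (λ ys → F (Vec.toList r List.++ ys))) ⟩
    𝔼 (row G (g Fin.zero)) (λ r → expected ws₂ (λ ys → F (Vec.toList r List.++ ys)))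
      ≡⟨ 𝔼-row (g Fin.zero) n id (λ xs → expected ws₂ (λ ys → F (xs List.++ ys))) ⟩
    expected ws₁ (λ xs → expected ws₂ (λ ys → F (xs List.++ ys)))
      ≡⟨ expected-++ ws₁ ws₂ F ⟨
    expected (ws₁ List.++ ws₂) F
      ≡⟨ cong (λ ws → expected ws F) (Listₚ.map-++ (entry G) (List.map (g Fin.zero ,_) (List.allFin n)) _) ⟨
    expected (List.map (entry G) (List.cartesianProduct (List.tabulate g) (List.allFin n))) F ∎
    where
    open ≡-Reasoning
    ws₁ = List.map (entry G) (List.map (g Fin.zero ,_) (List.allFin n))
    ws₂ = List.map (entry G) (List.cartesianProduct (List.tabulate (g ∘ Fin.suc)) (List.allFin n))

  masks : ℕ
  masks = 2 ^ #random weights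

  𝔼-outcomes : ∀ F → 𝔼 (outcomes G) F ≡ sumTo masks (λ l → prob weights l ℚ.* F (rows n (decode weights l)))
  𝔼-outcomes F = begin
    𝔼 (outcomes G) F                          ≡⟨ 𝔼-cong (outcomes G) (λ L → cong F (sym (rows-flat L))) ⟩
    𝔼 (outcomes G) (λ L → F (rows n (flat L))) ≡⟨ 𝔼-rows n id (F ∘ rows n) ⟩
    expected weights (F ∘ rows n)             ≡⟨ sumTo-outcomes weights weights-probability (F ∘ rows n) ⟨
    sumTo masks (λ l → prob weights l ℚ.* F (rows n (decode weights l))) ∎
    where open ≡-Reasoning

  sum-prob : sumTo masks (prob weights) ≡ 1ℚ
  sum-prob = trans (sumTo-cong masks (λ l _ → sym (ℚₚ.*-identityʳ _)))
    (trans (sumTo-outcomes weights weights-probability (λ _ → 1ℚ)) (expected-one weights))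

  isRandom-entry : ∀ a → isRandom (entry G a) ≡ isProbabilistic G a
  isRandom-entry (u , v) with weight G u v
  ... | nothing = refl
  ... | just w with coin (value w) (ℚₚ.<⇒≤ (positive w) , atMost1 w)
  ...   | random e _ w<1 = trans e (sym (dec-true (value w ℚₚ.<? 1ℚ) w<1))
  ...   | constant e w≡  = trans e (sym (dec-false (value w ℚₚ.<? 1ℚ) (w≮1 (isCertain (value w)) w≡)))
    where
    w≮1 : ∀ b → value w ≡ (if b then 1ℚ else 0ℚ) → ¬ value w ℚ.< 1ℚ
    w≮1 true  w≡ w<1 = ℚₚ.<-irrefl w≡ w<1
    w≮1 false w≡ _   = ℚₚ.<-irrefl (sym w≡) (positive w)

  #random≡#probabilistic : #random weights ≡ #probabilistic G
  #random≡#probabilistic = go (pairs n)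
    where
    go : ∀ as → #random (List.map (entry G) as) ≡ List.length (List.filterᵇ (isProbabilistic G) as)
    go []       = refl
    go (a ∷ as) rewrite isRandom-entry a with isProbabilistic G a
    ... | true  = cong suc (go as)
    ... | false = go as

  length-weights : List.length weights ≡ n * n
  length-weights = trans (Listₚ.length-map (entry G) (pairs n))
    (trans (length-cartesianProduct (List.allFin n) (List.allFin n)) (cong₂ _*_ (Listₚ.length-tabulate {n = n} id) (Listₚ.length-tabulate {n = n} id)))

-- Push-relabel

sumTo-update : ∀ n (g g′ : ℕ → ℚ) i δ → i < n → g′ i ≡ g i ℚ.+ δ → (∀ k → k < n → k ≢ i → g′ k ≡ g k) →
  sumTo n g′ ≡ sumTo n g ℚ.+ δ
sumTo-update (suc n) g g′ i δ i< at off with i ≟ n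
... | yes refl = trans (cong₂ ℚ._+_ (sumTo-cong n (λ k k< → off k (m<n⇒m<1+n k<) (<⇒≢ k<))) at) (sym (ℚₚ.+-assoc (sumTo n g) (g n) δ))
... | no i≢n = trans (cong₂ ℚ._+_ (sumTo-update n g g′ i δ (≤∧≢⇒< (s≤s⁻¹ i<) i≢n) at (λ k k< → off k (m<n⇒m<1+n k<)))
                 (off n ≤-refl (≢-sym i≢n)))
  (solve 3 (λ a b c → (a :+ b) :+ c := (a :+ c) :+ b) refl (sumTo n g) δ (g n))

sumᴺ : ℕ → (ℕ → ℕ) → ℕ
sumᴺ zero    f = 0
sumᴺ (suc n) f = sumᴺ n f + f n

sumᴺ-cong : ∀ n {f g : ℕ → ℕ} → (∀ k → k < n → f k ≡ g k) → sumᴺ n f ≡ sumᴺ n g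
sumᴺ-cong zero    h = refl
sumᴺ-cong (suc n) h = cong₂ _+_ (sumᴺ-cong n (λ k k< → h k (m<n⇒m<1+n k<))) (h n ≤-refl)

sumᴺ-update : ∀ n (g g′ : ℕ → ℕ) i → i < n → g′ i ≡ suc (g i) → (∀ k → k < n → k ≢ i → g′ k ≡ g k) →
  sumᴺ n g′ ≡ suc (sumᴺ n g)
sumᴺ-update (suc n) g g′ i i< at off with i ≟ n
... | yes refl = trans (cong₂ _+_ (sumᴺ-cong n (λ k k< → off k (m<n⇒m<1+n k<) (<⇒≢ k<))) at) (+-suc (sumᴺ n g) (g n))
... | no i≢n = cong₂ _+_ (sumᴺ-update n g g′ i (≤∧≢⇒< (s≤s⁻¹ i<) i≢n) at (λ k k< → off k (m<n⇒m<1+n k<)))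
                 (off n ≤-refl (≢-sym i≢n))

sumᴺ-≤ : ∀ n (g : ℕ → ℕ) c → (∀ k → k < n → g k ≤ c) → sumᴺ n g ≤ n * c
sumᴺ-≤ zero    g c h = z≤n
sumᴺ-≤ (suc n) g c h = ≤-trans (+-mono-≤ (sumᴺ-≤ n g c (λ k k< → h k (m<n⇒m<1+n k<))) (h n ≤-refl)) (≤-reflexive (+-comm (n * c) c))

index-injective : ∀ {n} u u′ {v v′} → v < n → v′ < n → u * n + v ≡ u′ * n + v′ → u ≡ u′ × v ≡ v′
index-injective zero    zero     v< v′< e = refl , e
index-injective {n} zero (suc u′) {v} {v′} v< v′< e =
  contradiction v< (≤⇒≯ (≤-trans (m≤m+n n (u′ * n + v′)) (≤-reflexive (trans (sym (+-assoc n _ _)) (sym e)))))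
index-injective {n} (suc u) zero {v} {v′} v< v′< e =
  contradiction v′< (≤⇒≯ (≤-trans (m≤m+n n (u * n + v)) (≤-reflexive (trans (sym (+-assoc n _ _)) e))))
index-injective {n} (suc u) (suc u′) v< v′< e
  with index-injective u u′ v< v′< (+-cancelˡ-≡ n _ _ (trans (sym (+-assoc n _ _)) (trans e (+-assoc n _ _))))
... | p , q = cong suc p , q

positivePart : ℚ → ℚ
positivePart x = if x ℚ.≤ᵇ 0ℚ then 0ℚ else x

ι : Bool → ℚ
ι b = if b then 1ℚ else 0ℚ

neg* : ∀ {x y} → 0ℚ ℚ.≤ x → y ℚ.≤ 0ℚ → x ℚ.* y ℚ.≤ 0ℚ
neg* {x} {y} 0≤x y≤0 = ℚₚ.≤-trans (ℚₚ.*-monoˡ-≤-nonNeg x {{ℚ.nonNegative 0≤x}} y≤0) (ℚₚ.≤-reflexive (ℚₚ.*-zeroʳ x))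

0≤+ : ∀ {x y} → 0ℚ ℚ.≤ x → 0ℚ ℚ.≤ y → 0ℚ ℚ.≤ x ℚ.+ y
0≤+ 0≤x 0≤y = ℚₚ.≤-trans (ℚₚ.≤-reflexive (sym (ℚₚ.+-identityʳ 0ℚ))) (ℚₚ.+-mono-≤ 0≤x 0≤y)

x≤x+y : ∀ x {y} → 0ℚ ℚ.≤ y → x ℚ.≤ x ℚ.+ y
x≤x+y x 0≤y = ℚₚ.≤-trans (ℚₚ.≤-reflexive (sym (ℚₚ.+-identityʳ x))) (ℚₚ.+-monoʳ-≤ x 0≤y)

x-y≤x : ∀ x {y} → 0ℚ ℚ.≤ y → x ℚ.- y ℚ.≤ x
x-y≤x x {y} 0≤y = ℚₚ.≤-trans (x≤x+y (x ℚ.- y) 0≤y) (ℚₚ.≤-reflexive (solve 2 (λ x y → x :- y :+ y := x) refl x y))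

≡0 : ∀ {x} → 0ℚ ℚ.≤ x → ¬ 0ℚ ℚ.< x → x ≡ 0ℚ
≡0 0≤x x≯0 = ℚₚ.≤-antisym (ℚₚ.≮⇒≥ x≯0) 0≤x

-- Maximum-weight closure as a minimum cut: the arcs have unlimited capacity, the nodes
-- have supplies b, and e is the excess of the preflow f.
module PushRelabel (n : ℕ) (arc : ℕ → ℕ → Bool) (b : ℕ → ℚ) where

  flowSum : (f : ℕ → ℚ) (y : ℕ → ℚ) → ℚ
  flowSum f y = sumTo n (λ u → sumTo n (λ v → f (u * n + v) ℚ.* (y u ℚ.- y v)))

  -- The field `balance` is flow conservation tested against a potential y. The indicator of one
  -- node gives: supply equals excess plus outflow minus inflow. The indicator of a set gives the
  -- balance across its boundary, which is the form that duality needs. An arc is always residual,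
  -- its reverse only while the arc carries flow; by `valid` and `validᵇ` no residual arc descends
  -- by more than one level. Deficits stay at height 0, as sinks do.
  record Preflow (e : ℕ → ℚ) (d : ℕ → ℕ) (f : ℕ → ℚ) : Set where
    field
      balance : ∀ y → sumTo n (λ v → y v ℚ.* b v) ≡ sumTo n (λ v → y v ℚ.* e v) ℚ.+ flowSum f y
      f≥0     : ∀ u v → u < n → v < n → 0ℚ ℚ.≤ f (u * n + v)
      f≡0     : ∀ u v → u < n → v < n → arc u v ≡ false → f (u * n + v) ≡ 0ℚ
      valid   : ∀ u v → u < n → v < n → arc u v ≡ true → d u ≤ suc (d v)
      validᵇ  : ∀ u v → u < n → v < n → 0ℚ ℚ.< f (u * n + v) → d v ≤ suc (d u)
      deficit : ∀ v → v < n → e v ℚ.< 0ℚ → d v ≡ 0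
      height  : ∀ v → v < n → d v ≤ suc n
  open Preflow

  -- The sign of `θ` is free: taking back δ from the flow of v to u is the case of θ = - δ with i =
  -- v and j = u.
  balance-update : ∀ {e f e′ f′ : ℕ → ℚ} i j θ → i < n → j < n → i ≢ j →
    e′ i ≡ e i ℚ.- θ → e′ j ≡ e j ℚ.+ θ → (∀ k → k < n → k ≢ i → k ≢ j → e′ k ≡ e k) →
    f′ (i * n + j) ≡ f (i * n + j) ℚ.+ θ → (∀ k → k ≢ i * n + j → f′ k ≡ f k) →
    ∀ y → sumTo n (λ v → y v ℚ.* e v) ℚ.+ flowSum f y ≡ sumTo n (λ v → y v ℚ.* e′ v) ℚ.+ flowSum f′ y
  balance-update {e} {f} {e′} {f′} i j θ i< j< i≢j eᵢ eⱼ eₖ fᵢⱼ fₖ y = sym (begin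
    sumTo n (λ v → y v ℚ.* e′ v) ℚ.+ flowSum f′ y
      ≡⟨ cong₂ ℚ._+_ stepⱼ stepᶠ ⟩
    (sumTo n (λ v → y v ℚ.* e v) ℚ.+ y i ℚ.* (ℚ.- θ) ℚ.+ y j ℚ.* θ) ℚ.+ (flowSum f y ℚ.+ θ ℚ.* (y i ℚ.- y j))
      ≡⟨ solve 5 (λ s t a b θ → ((s :+ a :* (:- θ)) :+ b :* θ) :+ (t :+ θ :* (a :- b)) := s :+ t) refl
           (sumTo n (λ v → y v ℚ.* e v)) (flowSum f y) (y i) (y j) θ ⟩
    sumTo n (λ v → y v ℚ.* e v) ℚ.+ flowSum f y ∎)
    where
    open ≡-Reasoning
    mid : ℕ → ℚ
    mid k = if k ≡ᵇ i then e i ℚ.- θ else e k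
    midᵢ : mid i ≡ e i ℚ.- θ
    midᵢ rewrite ≡ᵇ-refl i = refl
    midₖ : ∀ k → k ≢ i → mid k ≡ e k
    midₖ k k≢i rewrite ¬T⇒≡ {k ≡ᵇ i} (λ t → k≢i (≡ᵇ⇒≡ k i t)) = refl
    stepᵢ : sumTo n (λ v → y v ℚ.* mid v) ≡ sumTo n (λ v → y v ℚ.* e v) ℚ.+ y i ℚ.* (ℚ.- θ)
    stepᵢ = sumTo-update n _ _ i (y i ℚ.* (ℚ.- θ)) i<
      (trans (cong (y i ℚ.*_) midᵢ) (ℚₚ.*-distribˡ-+ (y i) (e i) (ℚ.- θ)))
      (λ k _ k≢i → cong (y k ℚ.*_) (midₖ k k≢i))
    stepⱼ : sumTo n (λ v → y v ℚ.* e′ v) ≡ sumTo n (λ v → y v ℚ.* e v) ℚ.+ y i ℚ.* (ℚ.- θ) ℚ.+ y j ℚ.* θ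
    stepⱼ = trans (sumTo-update n (λ v → y v ℚ.* mid v) _ j (y j ℚ.* θ) j<
      (trans (cong (y j ℚ.*_) (trans eⱼ (cong (ℚ._+ θ) (sym (midₖ j (≢-sym i≢j)))))) (ℚₚ.*-distribˡ-+ (y j) (mid j) θ))
      (λ k k< k≢j → cong (y k ℚ.*_) (other k k< k≢j)))
      (cong (ℚ._+ y j ℚ.* θ) stepᵢ)
      where
      other : ∀ k → k < n → k ≢ j → e′ k ≡ mid k
      other k k< k≢j with k ≟ i
      ... | yes refl = trans eᵢ (sym midᵢ)
      ... | no k≢i   = trans (eₖ k k< k≢i k≢j) (sym (midₖ k k≢i))
    stepᶠ : flowSum f′ y ≡ flowSum f y ℚ.+ θ ℚ.* (y i ℚ.- y j)
    stepᶠ = sumTo-update n _ _ i (θ ℚ.* (y i ℚ.- y j)) i<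
      (sumTo-update n _ _ j (θ ℚ.* (y i ℚ.- y j)) j<
        (trans (cong (ℚ._* (y i ℚ.- y j)) fᵢⱼ) (ℚₚ.*-distribʳ-+ (y i ℚ.- y j) (f (i * n + j)) θ))
        (λ v v< v≢j → cong (ℚ._* (y i ℚ.- y v)) (fₖ (i * n + v) (λ p → v≢j (proj₂ (index-injective i i v< j< p))))))
      (λ u u< u≢i → sumTo-cong n (λ v v< → cong (ℚ._* (y u ℚ.- y v)) (fₖ (u * n + v) (λ p → u≢i (proj₁ (index-injective u i v< j< p))))))

  -- The amount 0 is allowed, because the program tests only excess and heights; on a pair without
  -- residual capacity it pushes nothing.
  record Push (e e′ : ℕ → ℚ) (d : ℕ → ℕ) (u v : ℕ) (δ : ℚ) : Set where
    field
      u<     : u < n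
      v<     : v < n
      down   : d u ≡ suc (d v)
      δ≥0    : 0ℚ ℚ.≤ δ
      δ≤     : δ ℚ.≤ e u
      eᵘ     : e′ u ≡ e u ℚ.- δ
      eᵛ     : e′ v ≡ e v ℚ.+ δ
      others : ∀ k → k < n → k ≢ u → k ≢ v → e′ k ≡ e k

    u≢v : u ≢ v
    u≢v refl = 1+n≢n (sym down)

    e′≥0 : 0ℚ ℚ.≤ e′ u
    e′≥0 = ℚₚ.≤-trans (≤⇒0≤- δ≤) (ℚₚ.≤-reflexive (sym eᵘ))

    deficit′ : (∀ k → k < n → e k ℚ.< 0ℚ → d k ≡ 0) → ∀ k → k < n → e′ k ℚ.< 0ℚ → d k ≡ 0
    deficit′ h k k< e′<0 with k ≟ u | k ≟ v
    ... | yes refl | _        = contradiction (ℚₚ.<-≤-trans e′<0 e′≥0) (ℚₚ.<-irrefl refl)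
    ... | no _     | yes refl = h v v< (ℚₚ.≤-<-trans (ℚₚ.≤-trans (x≤x+y (e v) δ≥0) (ℚₚ.≤-reflexive (sym eᵛ))) e′<0)
    ... | no k≢u   | no k≢v   = h k k< (subst (ℚ._< 0ℚ) (others k k< k≢u k≢v) e′<0)

  module _ {e e′ : ℕ → ℚ} {d : ℕ → ℕ} {f f′ : ℕ → ℚ} {u v : ℕ} {δ : ℚ} (P : Push e e′ d u v δ) (F : Preflow e d f) where
    open Push P

    push-forward : arc u v ≡ true → f′ (u * n + v) ≡ f (u * n + v) ℚ.+ δ →
      (∀ k → k ≢ u * n + v → f′ k ≡ f k) → Preflow e′ d f′
    push-forward a fᵘᵛ fₖ = record
      { balance = λ y → trans (balance F y) (balance-update {e} {f} {e′} {f′} u v δ u< v< u≢v eᵘ eᵛ others fᵘᵛ fₖ y)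
      ; f≥0 = nonneg
      ; f≡0 = none
      ; valid = valid F
      ; validᵇ = back
      ; deficit = deficit′ (deficit F)
      ; height = height F }
      where
      nonneg : ∀ i j → i < n → j < n → 0ℚ ℚ.≤ f′ (i * n + j)
      nonneg i j i< j< with i * n + j ≟ u * n + v
      ... | no p  = subst (0ℚ ℚ.≤_) (sym (fₖ _ p)) (f≥0 F i j i< j<)
      ... | yes p = subst (0ℚ ℚ.≤_) (sym (trans (cong f′ p) fᵘᵛ)) (0≤+ (f≥0 F u v u< v<) δ≥0)
      none : ∀ i j → i < n → j < n → arc i j ≡ false → f′ (i * n + j) ≡ 0ℚ
      none i j i< j< a′ with i * n + j ≟ u * n + v
      ... | no p  = trans (fₖ _ p) (f≡0 F i j i< j< a′)
      ... | yes p with index-injective i u j< v< p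
      ...   | refl , refl = contradiction (trans (sym a) a′) λ ()
      back : ∀ i j → i < n → j < n → 0ℚ ℚ.< f′ (i * n + j) → d j ≤ suc (d i)
      back i j i< j< pos with i * n + j ≟ u * n + v
      ... | no p  = validᵇ F i j i< j< (subst (0ℚ ℚ.<_) (fₖ _ p) pos)
      ... | yes p with index-injective i u j< v< p
      ...   | refl , refl = ≤-trans (≤-trans (n≤1+n _) (≤-reflexive (sym down))) (n≤1+n _)

    push-back : δ ℚ.≤ f (v * n + u) → f′ (v * n + u) ≡ f (v * n + u) ℚ.- δ →
      (∀ k → k ≢ v * n + u → f′ k ≡ f k) → Preflow e′ d f′
    push-back δ≤f fᵛᵘ fₖ = record
      { balance = λ y → trans (balance F y) (balance-update {e} {f} {e′} {f′} v u (ℚ.- δ) v< u< (≢-sym u≢v)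
          (trans eᵛ (cong (e v ℚ.+_) (solve 1 (λ x → x := :- (:- x)) refl δ))) eᵘ (λ k k< k≢v k≢u → others k k< k≢u k≢v) fᵛᵘ fₖ y)
      ; f≥0 = nonneg
      ; f≡0 = none
      ; valid = valid F
      ; validᵇ = back
      ; deficit = deficit′ (deficit F)
      ; height = height F }
      where
      f′≤f : f′ (v * n + u) ℚ.≤ f (v * n + u)
      f′≤f = ℚₚ.≤-trans (ℚₚ.≤-reflexive fᵛᵘ) (x-y≤x _ δ≥0)
      nonneg : ∀ i j → i < n → j < n → 0ℚ ℚ.≤ f′ (i * n + j)
      nonneg i j i< j< with i * n + j ≟ v * n + u
      ... | no p  = subst (0ℚ ℚ.≤_) (sym (fₖ _ p)) (f≥0 F i j i< j<)
      ... | yes p = subst (0ℚ ℚ.≤_) (sym (trans (cong f′ p) fᵛᵘ)) (≤⇒0≤- δ≤f)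
      none : ∀ i j → i < n → j < n → arc i j ≡ false → f′ (i * n + j) ≡ 0ℚ
      none i j i< j< a′ with i * n + j ≟ v * n + u
      ... | no p  = trans (fₖ _ p) (f≡0 F i j i< j< a′)
      ... | yes p with index-injective i v j< u< p
      ...   | refl , refl = ℚₚ.≤-antisym (ℚₚ.≤-trans f′≤f (ℚₚ.≤-reflexive (f≡0 F v u v< u< a′))) (nonneg v u v< u<)
      back : ∀ i j → i < n → j < n → 0ℚ ℚ.< f′ (i * n + j) → d j ≤ suc (d i)
      back i j i< j< pos with i * n + j ≟ v * n + u
      ... | no p  = validᵇ F i j i< j< (subst (0ℚ ℚ.<_) (fₖ _ p) pos)
      ... | yes p with index-injective i v j< u< p
      ...   | refl , refl = ≤-reflexive down

  -- No arc from u to a node before j is admissible, unless u has been discharged.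
  Scanned : (e : ℕ → ℚ) (d : ℕ → ℕ) (f : ℕ → ℚ) → ℕ → ℕ → Set
  Scanned e d f u j = 0ℚ ℚ.< e u → ∀ v → v < j → arc u v ≡ true ⊎ 0ℚ ℚ.< f (v * n + u) → d u ≢ suc (d v)

  -- For a residual arc from u to v, validity gives d u ≤ d v + 1 and the scan excludes equality. So
  -- d u ≤ d v, and there is room to raise u by one. Residual arcs into u become less steep.
  relabel : ∀ {e d d′ f u} → Preflow e d f → u < n → 0ℚ ℚ.< e u → d u ≤ n → Scanned e d f u n →
    d′ u ≡ suc (d u) → (∀ k → k < n → k ≢ u → d′ k ≡ d k) → Preflow e d′ f
  relabel {e} {d} {d′} {f} {u} F u< e>0 d≤n scanned dᵘ dₖ = record
    { balance = balance F ; f≥0 = f≥0 F ; f≡0 = f≡0 F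
    ; valid = λ i j i< j< a → residual i j i< j< (valid F i j i< j< a) (inj₁ a)
    ; validᵇ = λ j i j< i< pos → residual i j i< j< (validᵇ F j i j< i< pos) (inj₂ pos)
    ; deficit = λ k k< e<0 → trans (dₖ k k< (λ { refl → contradiction (ℚₚ.<-trans e>0 e<0) (ℚₚ.<-irrefl refl) })) (deficit F k k< e<0)
    ; height = top }
    where
    grow : ∀ k → k < n → d k ≤ d′ k
    grow k k< with k ≟ u
    ... | yes refl = ≤-trans (n≤1+n _) (≤-reflexive (sym dᵘ))
    ... | no k≢u   = ≤-reflexive (sym (dₖ k k< k≢u))
    residual : ∀ i j → i < n → j < n → d i ≤ suc (d j) → arc i j ≡ true ⊎ 0ℚ ℚ.< f (j * n + i) → d′ i ≤ suc (d′ j)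
    residual i j i< j< v r with i ≟ u
    ... | no i≢u   = ≤-trans (≤-reflexive (dₖ i i< i≢u)) (≤-trans v (s≤s (grow j j<)))
    ... | yes refl = ≤-trans (≤-reflexive dᵘ) (≤-trans (≤∧≢⇒< v (scanned e>0 j j< r)) (s≤s (grow j j<)))
    top : ∀ k → k < n → d′ k ≤ suc n
    top k k< with k ≟ u
    ... | yes refl = ≤-trans (≤-reflexive dᵘ) (s≤s d≤n)
    ... | no k≢u   = ≤-trans (≤-reflexive (dₖ k k< k≢u)) (height F k k<)

  Active : (e : ℕ → ℚ) (d : ℕ → ℕ) → ℕ → Set
  Active e d v = 0ℚ ℚ.< e v × d v ≤ n

  -- The potential that bounds the number of rounds: in round r, after the nodes
  -- before i have been treated.
  record Progress (r i : ℕ) (e : ℕ → ℚ) (d : ℕ → ℕ) : Set where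
    field
      everyone : ∀ v → v < n → Active e d v → d v + r ≤ 2 * sumᴺ n d
      treated  : ∀ v → v < n → v < i → Active e d v → suc (d v + r) ≤ 2 * sumᴺ n d
  open Progress

  -- The receiving node may become active although its turn in this round is over. It lies one level
  -- below u, however, and so satisfies even the sharper bound required of treated nodes.
  progress-push : ∀ {r i e e′ d u v δ} → Push e e′ d u v δ → 0ℚ ℚ.< e u → d u ≤ n → i ≤ u →
    Progress r i e d → Progress r i e′ d
  progress-push {r} {i} {e} {e′} {d} {u} {v} {δ} P e>0 d≤n i≤u pr = record
    { everyone = λ k k< act → every k k< act
    ; treated  = λ k k< k<i act → treat k k< k<i act }
    where
    open Push P
    fromU : suc (d v + r) ≤ 2 * sumᴺ n d
    fromU = ≤-trans (≤-reflexive (cong (_+ r) (sym down))) (everyone pr u u< (e>0 , d≤n))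
    every : ∀ k → k < n → Active e′ d k → d k + r ≤ 2 * sumᴺ n d
    every k k< (p , q) with k ≟ u | k ≟ v
    ... | yes refl | _        = everyone pr u u< (e>0 , d≤n)
    ... | no _     | yes refl = ≤-trans (n≤1+n _) fromU
    ... | no k≢u   | no k≢v   = everyone pr k k< (subst (0ℚ ℚ.<_) (others k k< k≢u k≢v) p , q)
    treat : ∀ k → k < n → k < i → Active e′ d k → suc (d k + r) ≤ 2 * sumᴺ n d
    treat k k< k<i (p , q) with k ≟ u | k ≟ v
    ... | yes refl | _        = contradiction (≤-trans k<i i≤u) (<-irrefl refl)
    ... | no _     | yes refl = fromU
    ... | no k≢u   | no k≢v   = treated pr k k< k<i (subst (0ℚ ℚ.<_) (others k k< k≢u k≢v) p , q)

  -- Raising u adds 2 to the right-hand side and at most 1 to a left-hand side. Every active node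
  -- thereby gains the spare unit that the next round uses up.
  progress-relabel : ∀ {r e d d′ u} → u < n → 0ℚ ℚ.< e u → d u ≤ n →
    d′ u ≡ suc (d u) → (∀ k → k < n → k ≢ u → d′ k ≡ d k) →
    Progress r u e d → Progress r (suc u) e d′
  progress-relabel {r} {e} {d} {d′} {u} u< e>0 d≤n dᵘ dₖ pr = record
    { everyone = λ k k< act → ≤-trans (n≤1+n _) (bound k k< act)
    ; treated  = λ k k< _ act → bound k k< act }
    where
    raise : 2 * sumᴺ n d′ ≡ suc (suc (2 * sumᴺ n d))
    raise = trans (cong (2 *_) (sumᴺ-update n d d′ u u< dᵘ dₖ)) (*-suc 2 (sumᴺ n d))
    bound : ∀ k → k < n → Active e d′ k → suc (d′ k + r) ≤ 2 * sumᴺ n d′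
    bound k k< (p , q) with k ≟ u
    ... | yes refl = ≤-trans (s≤s (≤-trans (≤-reflexive (cong (_+ r) dᵘ)) (s≤s (everyone pr u u< (e>0 , d≤n))))) (≤-reflexive (sym raise))
    ... | no k≢u   = ≤-trans (s≤s (≤-trans (≤-reflexive (cong (_+ r) (dₖ k k< k≢u)))
                       (≤-trans (everyone pr k k< (p , ≤-trans (≤-reflexive (sym (dₖ k k< k≢u))) q)) (n≤1+n _)))) (≤-reflexive (sym raise))

  progress-inactive : ∀ {r e d u} → ¬ Active e d u → Progress r u e d → Progress r (suc u) e d
  progress-inactive {r} {e} {d} {u} idle pr = record { everyone = everyone pr ; treated = treat }
    where
    treat : ∀ k → k < n → k < suc u → Active e d k → suc (d k + r) ≤ 2 * sumᴺ n d
    treat k k< k<1+u act with k ≟ u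
    ... | yes refl = contradiction act idle
    ... | no k≢u   = treated pr k k< (≤∧≢⇒< (s≤s⁻¹ k<1+u) k≢u) act

  progress-round : ∀ {r e d} → Progress r n e d → Progress (suc r) 0 e d
  progress-round {r} {e} {d} pr = record
    { everyone = λ k k< act → ≤-trans (≤-reflexive (+-suc (d k) r)) (treated pr k k< k< act)
    ; treated = λ { _ _ () _ } }

  -- This fixes the number of rounds. No height exceeds n + 1, so the heights add up to at most n *
  -- (n + 1), which is less than (n + 1) * (n + 1); an active node would require the number of
  -- rounds to be at most twice that sum.
  progress-end : ∀ {e d f} → Preflow e d f → Progress (2 * (suc n * suc n)) 0 e d → ∀ v → v < n → ¬ Active e d v
  progress-end {e} {d} F pr v v< act = <⇒≱ (*-monoʳ-< 2 D<) (≤-trans (m≤n+m _ (d v)) (everyone pr v v< act))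
    where
    D< : sumᴺ n d < suc n * suc n
    D< = s≤s (≤-trans (sumᴺ-≤ n d (suc n) (height F)) (m≤n+m (n * suc n) n))

  ClosedUnder : (ℕ → Bool) → Set
  ClosedUnder y = ∀ u v → u < n → v < n → arc u v ≡ true → y u ≡ true → y v ≡ true

  closure-weight : (ℕ → Bool) → ℚ
  closure-weight y = sumTo n (λ v → ι (y v) ℚ.* b v)

  excess : (ℕ → ℚ) → ℚ
  excess e = sumTo n (λ v → positivePart (e v))

  -- Weak duality: no arc leaves a closed set, so flow can only enter it, and its weight is at most
  -- the excess collected inside.
  closure≤excess : ∀ {e d f} → Preflow e d f → ∀ y → ClosedUnder y → closure-weight y ℚ.≤ excess e
  closure≤excess {e} {d} {f} F y y-closed = begin
    closure-weight y
      ≡⟨ balance F (ι ∘ y) ⟩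
    sumTo n (λ v → ι (y v) ℚ.* e v) ℚ.+ flowSum f (ι ∘ y)
      ≤⟨ ℚₚ.+-mono-≤ (sumTo-mono n (λ v _ → part (y v) (e v))) (sumTo-mono n (λ u u< → sumTo-mono n (λ v v< → term u v u< v<))) ⟩
    excess e ℚ.+ sumTo n (λ _ → sumTo n (λ _ → 0ℚ))
      ≡⟨ cong (excess e ℚ.+_) (trans (sumTo-cong n (λ _ _ → sumTo-zero n)) (sumTo-zero n)) ⟩
    excess e ℚ.+ 0ℚ
      ≡⟨ ℚₚ.+-identityʳ _ ⟩
    excess e ∎
    where
    open ℚₚ.≤-Reasoning
    part : ∀ c x → ι c ℚ.* x ℚ.≤ positivePart x
    part c x with x ℚ.≤ᵇ 0ℚ in eq
    part true  x | true  = ℚₚ.≤-trans (ℚₚ.≤-reflexive (ℚₚ.*-identityˡ x)) (≤ᵇ≡true x 0ℚ eq)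
    part false x | true  = ℚₚ.≤-reflexive (ℚₚ.*-zeroˡ x)
    part true  x | false = ℚₚ.≤-reflexive (ℚₚ.*-identityˡ x)
    part false x | false = ℚₚ.≤-trans (ℚₚ.≤-reflexive (ℚₚ.*-zeroˡ x)) (ℚₚ.<⇒≤ (≤ᵇ≡false x 0ℚ eq))
    diff : ∀ c c′ → (c ≡ true → c′ ≡ true) → ι c ℚ.- ι c′ ℚ.≤ 0ℚ
    diff true  true  h = ℚₚ.≤-reflexive (ℚₚ.+-inverseʳ 1ℚ)
    diff true  false h = contradiction (h refl) λ ()
    diff false true  h = x-y≤x 0ℚ (ℚₚ.<⇒≤ 0<1ℚ)
    diff false false h = ℚₚ.≤-reflexive (ℚₚ.+-inverseʳ 0ℚ)
    term : ∀ u v → u < n → v < n → f (u * n + v) ℚ.* (ι (y u) ℚ.- ι (y v)) ℚ.≤ 0ℚ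
    term u v u< v< with arc u v in a
    ... | true  = neg* (f≥0 F u v u< v<) (diff (y u) (y v) (y-closed u v u< v< a))
    ... | false = ℚₚ.≤-reflexive (trans (cong (ℚ._* (ι (y u) ℚ.- ι (y v))) (f≡0 F u v u< v< a)) (ℚₚ.*-zeroˡ (ι (y u) ℚ.- ι (y v))))

  -- There are more heights up to n than nodes.
  gap : (d : ℕ → ℕ) → ∃ λ h → h ≤ n × (∀ v → v < n → d v ≢ h)
  gap d with Finₚ.any? {n = suc n} (λ h → Finₚ.all? {n = n} (λ v → Decidable.¬? (d (toℕ v) ≟ toℕ h)))
  ... | yes (h , free) = toℕ h , s≤s⁻¹ (Finₚ.toℕ<n h) , λ v v< e → free (fromℕ< v<) (trans (cong d (Finₚ.toℕ-fromℕ< v<)) e)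
  ... | no full = contradiction (Finₚ.pigeonhole (n<1+n n) (λ h → proj₁ (node h)))
          λ (h , h′ , h<h′ , same) → <-irrefl (trans (sym (proj₂ (node h))) (trans (cong (d ∘ toℕ) same) (proj₂ (node h′)))) h<h′
    where
    node : ∀ (h : Fin (suc n)) → ∃ λ v → d (toℕ v) ≡ toℕ h
    node h with Finₚ.any? {n = n} (λ v → d (toℕ v) ≟ toℕ h)
    ... | yes found = found
    ... | no none   = contradiction (h , λ v e → none (v , e)) full

  -- Strong duality, with the nodes above an unoccupied height h as the closed set. No residual arc
  -- descends across the gap: hence the set is closed, and no flow enters it, as the reverse of that
  -- flow would be residual. Deficits lie at height 0, so none is above h; nodes below h have height
  -- at most n and are not active, so they hold no positive excess. Every inequality of
  -- `closure≤excess` is then tight.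
  cut : ∀ {e d f} → Preflow e d f → (∀ v → v < n → ¬ Active e d v) →
    ∃ λ y → ClosedUnder y × closure-weight y ≡ excess e
  cut {e} {d} {f} F idle with gap d
  ... | h , h≤n , free = y , y-closed , (begin
    closure-weight y
      ≡⟨ balance F (ι ∘ y) ⟩
    sumTo n (λ v → ι (y v) ℚ.* e v) ℚ.+ flowSum f (ι ∘ y)
      ≡⟨ cong₂ ℚ._+_ (sumTo-cong n part) (trans (sumTo-cong n (λ u u< → trans (sumTo-cong n (λ v v< → term u v u< v<)) (sumTo-zero n))) (sumTo-zero n)) ⟩
    excess e ℚ.+ 0ℚ
      ≡⟨ ℚₚ.+-identityʳ _ ⟩
    excess e ∎)
    where
    open ≡-Reasoning
    y : ℕ → Bool
    y v = h <ᵇ d v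
    y⇒ : ∀ {v} → y v ≡ true → h < d v
    y⇒ e = <ᵇ⇒< _ _ (≡⇒T e)
    ¬y⇒ : ∀ {v} → y v ≡ false → d v ≤ h
    ¬y⇒ e = ≮⇒≥ (λ h< → ≡⇒¬T e (<⇒<ᵇ h<))
    y⇐ : ∀ {v} → h < d v → y v ≡ true
    y⇐ h< = T⇒≡ (<⇒<ᵇ h<)
    above : ∀ {u v} → v < n → h < d u → d u ≤ suc (d v) → h < d v
    above {u} {v} v< h< d≤ = ≤∧≢⇒< (s≤s⁻¹ (≤-trans h< d≤)) (≢-sym (free v v<))
    y-closed : ClosedUnder y
    y-closed u v u< v< a e = y⇐ (above {u} v< (y⇒ e) (valid F u v u< v< a))
    part : ∀ v → v < n → ι (y v) ℚ.* e v ≡ positivePart (e v)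
    part v v< with y v in yv | e v ℚ.≤ᵇ 0ℚ in eq
    ... | true  | true  = trans (ℚₚ.*-identityˡ _) (ℚₚ.≤-antisym (≤ᵇ≡true (e v) 0ℚ eq)
            (ℚₚ.≮⇒≥ (λ e<0 → contradiction (≤-trans (y⇒ yv) (≤-reflexive (deficit F v v< e<0))) λ ())))
    ... | true  | false = ℚₚ.*-identityˡ _
    ... | false | true  = ℚₚ.*-zeroˡ (e v)
    ... | false | false = contradiction (≤ᵇ≡false (e v) 0ℚ eq , ≤-trans (¬y⇒ yv) h≤n) (idle v v<)
    term : ∀ u v → u < n → v < n → f (u * n + v) ℚ.* (ι (y u) ℚ.- ι (y v)) ≡ 0ℚ
    term u v u< v< with arc u v in a
    ... | false = trans (cong (ℚ._* (ι (y u) ℚ.- ι (y v))) (f≡0 F u v u< v< a)) (ℚₚ.*-zeroˡ (ι (y u) ℚ.- ι (y v)))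
    ... | true with y u in yu | y v in yv
    ...   | true  | true  = trans (cong (f (u * n + v) ℚ.*_) (ℚₚ.+-inverseʳ 1ℚ)) (ℚₚ.*-zeroʳ (f (u * n + v)))
    ...   | false | false = trans (cong (f (u * n + v) ℚ.*_) (ℚₚ.+-inverseʳ 0ℚ)) (ℚₚ.*-zeroʳ (f (u * n + v)))
    ...   | true  | false = contradiction (trans (sym (y-closed u v u< v< a yu)) yv) λ ()
    ...   | false | true  = trans (cong (ℚ._* (0ℚ ℚ.- 1ℚ)) (≡0 (f≥0 F u v u< v<) (λ pos →
              <⇒≱ (above {v} u< (y⇒ yv) (validᵇ F u v u< v< pos)) (¬y⇒ yu)))) (ℚₚ.*-zeroˡ (0ℚ ℚ.- 1ℚ))

  initial-preflow : ∀ {e d f} → (∀ v → v < n → e v ≡ b v) → (∀ v → v < n → d v ≡ 0) →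
    (∀ u v → u < n → v < n → f (u * n + v) ≡ 0ℚ) → Preflow e d f
  initial-preflow {e} {d} {f} e≡ d≡ f≡ = record
    { balance = λ y → sym (trans (cong₂ ℚ._+_ (sumTo-cong n (λ v v< → cong (y v ℚ.*_) (e≡ v v<)))
        (trans (sumTo-cong n (λ u u< → trans (sumTo-cong n (λ v v< → trans (cong (ℚ._* (y u ℚ.- y v)) (f≡ u v u< v<)) (ℚₚ.*-zeroˡ (y u ℚ.- y v)))) (sumTo-zero n))) (sumTo-zero n)))
        (ℚₚ.+-identityʳ _))
    ; f≥0 = λ u v u< v< → ℚₚ.≤-reflexive (sym (f≡ u v u< v<))
    ; f≡0 = λ u v u< v< _ → f≡ u v u< v<
    ; valid = λ u v u< v< _ → ≤-trans (≤-reflexive (d≡ u u<)) z≤n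
    ; validᵇ = λ u v u< v< _ → ≤-trans (≤-reflexive (d≡ v v<)) z≤n
    ; deficit = λ v v< _ → d≡ v v<
    ; height = λ v v< → ≤-trans (≤-reflexive (d≡ v v<)) z≤n }

  initial-progress : ∀ {e d} → (∀ v → v < n → d v ≡ 0) → Progress 0 0 e d
  initial-progress d≡ = record
    { everyone = λ v v< _ → ≤-trans (≤-reflexive (trans (+-identityʳ _) (d≡ v v<))) z≤n
    ; treated  = λ { _ _ () _ } }

-- The cost of a guess

sumTo-shift : ∀ n (f : ℕ → ℚ) → sumTo (suc n) f ≡ f 0 ℚ.+ sumTo n (f ∘ suc)
sumTo-shift n f = trans (sumTo-split 1 n f) (cong (ℚ._+ sumTo n (f ∘ suc)) (ℚₚ.+-identityˡ (f 0)))

foldr-tabulate : ∀ {n} k (h : Fin k → Fin n) (F : Fin n → ℚ) (g : ℕ → ℚ) → (∀ i → F (h i) ≡ g (toℕ i)) →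
  List.foldr (λ v acc → F v ℚ.+ acc) 0ℚ (List.tabulate h) ≡ sumTo k g
foldr-tabulate zero    h F g eq = refl
foldr-tabulate (suc k) h F g eq = trans (cong₂ ℚ._+_ (eq Fin.zero) (foldr-tabulate k (h ∘ Fin.suc) F (g ∘ suc) (eq ∘ Fin.suc)))
  (sym (sumTo-shift k g))

∀Fin⇒∀< : ∀ {n} (P : ℕ → Set) → (∀ (i : Fin n) → P (toℕ i)) → ∀ k → k < n → P k
∀Fin⇒∀< P h k k< = subst P (Finₚ.toℕ-fromℕ< k<) (h (fromℕ< k<))

sumTo-nonneg : ∀ n {f : ℕ → ℚ} → (∀ k → k < n → 0ℚ ℚ.≤ f k) → 0ℚ ℚ.≤ sumTo n f
sumTo-nonneg n h = ℚₚ.≤-trans (ℚₚ.≤-reflexive (sym (sumTo-zero n))) (sumTo-mono n h)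

term≤sumTo : ∀ n {f : ℕ → ℚ} i → i < n → (∀ k → k < n → 0ℚ ℚ.≤ f k) → f i ℚ.≤ sumTo n f
term≤sumTo (suc n) {f} i i< h with i ≟ n
... | yes refl = ℚₚ.≤-trans (x≤x+y (f n) (sumTo-nonneg n (λ k k< → h k (m<n⇒m<1+n k<)))) (ℚₚ.≤-reflexive (ℚₚ.+-comm (f n) _))
... | no i≢n = ℚₚ.≤-trans (term≤sumTo n i (≤∧≢⇒< (s≤s⁻¹ i<) i≢n) (λ k k< → h k (m<n⇒m<1+n k<))) (x≤x+y _ (h n ≤-refl))

ι≥0 : ∀ b → 0ℚ ℚ.≤ ι b
ι≥0 true  = ℚₚ.<⇒≤ 0<1ℚ
ι≥0 false = ℚₚ.≤-refl

ι≤1 : ∀ b → ι b ℚ.≤ 1ℚ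
ι≤1 true  = ℚₚ.≤-refl
ι≤1 false = ℚₚ.<⇒≤ 0<1ℚ

1-probability : ∀ {x} → Probability x → Probability (1ℚ ℚ.- x)
1-probability (0≤x , x≤1) = ≤⇒0≤- x≤1 , x-y≤x 1ℚ 0≤x

certain⇒¬random : ∀ w → isCertain w ≡ true → isRandom w ≡ false
certain⇒¬random w e = trans (cong (λ b → not (w ℚ.≤ᵇ 0ℚ) ∧ not b) e) (Boolₚ.∧-zeroʳ _)

module Cost {n : ℕ} (G : InfluenceGraph n) (A : Subset n) where

  ws : List ℚ
  ws = weights G

  wt : ℕ → ℚ
  wt = contents 0ℚ ws

  arc randomArc : ℕ → ℕ → Bool
  arc       u v = isCertain (wt (u * n + v))
  randomArc u v = isRandom (wt (u * n + v))

  target : ℕ → Bool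
  target = contents false (Vec.toList A)

  #masksℕ : ℕ
  #masksℕ = masks G

  live : ℕ → Fin n → Fin n → Bool
  live l = arcsᴸ (rows n (decode ws l))

  live≡ : ∀ l u v → live l u v ≡ contents false (decode ws l) (index u v)
  live≡ l u v = lookup-rows (decode ws l) u v

  arc⇒live : ∀ l u v → arc (toℕ u) (toℕ v) ≡ true → live l u v ≡ true
  arc⇒live l u v a = trans (live≡ l u v) (trans (decode-constant ws l (index u v) (certain⇒¬random (wt (index u v)) a)) a)

  live⇒arc : ∀ l u v → live l u v ≡ true → randomArc (toℕ u) (toℕ v) ≡ false → arc (toℕ u) (toℕ v) ≡ true
  live⇒arc l u v e r = trans (sym (trans (live≡ l u v) (decode-constant ws l (index u v) r))) e

  mean : (ℕ → Bool) → ℚ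
  mean χ = sumTo #masksℕ (λ l → prob ws l ℚ.* ι (χ l))

  mean-cong : ∀ {χ χ′} → (∀ l → l < #masksℕ → χ l ≡ χ′ l) → mean χ ≡ mean χ′
  mean-cong h = sumTo-cong #masksℕ (λ l l< → cong (λ b → prob ws l ℚ.* ι b) (h l l<))

  mean-true : mean (λ _ → true) ≡ 1ℚ
  mean-true = trans (sumTo-cong #masksℕ (λ l _ → ℚₚ.*-identityʳ (prob ws l))) (sum-prob G)

  mean-probability : ∀ χ → Probability (mean χ)
  mean-probability χ = sumTo-nonneg #masksℕ (λ l _ → 0≤* (prob≥0 ws (weights-probability G) l) (ι≥0 (χ l)))
    , ℚₚ.≤-trans (sumTo-mono #masksℕ (λ l _ → ℚₚ.*-monoˡ-≤-nonNeg (prob ws l)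
        {{ℚ.nonNegative (prob≥0 ws (weights-probability G) l)}} (ι≤1 (χ l)))) (ℚₚ.≤-reflexive mean-true)

  activated : ℕ → Subset n → Subset n
  activated l X = activeᴸ (rows n (decode ws l)) X

  activated-isClosure : ∀ l X → IsClosure (live l) X (activated l X)
  activated-isClosure l X = active-isClosure (rows n (decode ws l)) X

  p≡mean : ∀ v X → p G v X ≡ mean (λ l → lookup (activated l X) v)
  p≡mean v X = trans (p≡𝔼 G v X) (𝔼-outcomes G (λ L → ι (lookup (liveᴸ G L X) v)))

  p-probability : ∀ v X → Probability (p G v X)
  p-probability v X = subst Probability (sym (p≡mean v X)) (mean-probability _)

  cost-term : ℕ → ℚ → ℚ
  cost-term k x = if target k then 1ℚ ℚ.- x else x

  cost-term-probability : ∀ k x → Probability x → Probability (cost-term k x)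
  cost-term-probability k x px with target k
  ... | true  = 1-probability px
  ... | false = px

  cost≡sumTo : ∀ X (x : ℕ → ℚ) → (∀ v → p G v X ≡ x (toℕ v)) → cost G A X ≡ sumTo n (λ k → cost-term k (x k))
  cost≡sumTo X x eq = trans (cong₂ ℚ._+_
      (foldr-tabulate n id _ (λ k → if target k then 1ℚ ℚ.- x k else 0ℚ) (λ v →
        cong₂ (λ b y → if b then 1ℚ ℚ.- y else 0ℚ) (sym (contents-toList false A v)) (eq v)))
      (foldr-tabulate n id _ (λ k → if not (target k) then x k else 0ℚ) (λ v →
        cong₂ (λ b y → if b then y else 0ℚ) (trans (Vecₚ.lookup-map v not A) (cong not (sym (contents-toList false A v)))) (eq v))))
    (trans (sym (sumTo-+ n _ _)) (sumTo-cong n (λ k _ → merge (target k) (x k))))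
    where
    merge : ∀ b x → (if b then 1ℚ ℚ.- x else 0ℚ) ℚ.+ (if not b then x else 0ℚ) ≡ (if b then 1ℚ ℚ.- x else x)
    merge true  x = ℚₚ.+-identityʳ _
    merge false x = ℚₚ.+-identityˡ x

  -- This is n as a rational. The machine has no operation that turns a natural into a rational, so
  -- the program obtains it in the same way, by adding up ones.
  size : ℚ
  size = sumTo n (λ _ → 1ℚ)

  size≥0 : 0ℚ ℚ.≤ size
  size≥0 = sumTo-nonneg n (λ _ _ → ℚₚ.<⇒≤ 0<1ℚ)

  cost≤size : ∀ X → cost G A X ℚ.≤ size
  cost≤size X = ℚₚ.≤-trans (ℚₚ.≤-reflexive (cost≡sumTo X x pointwise))
    (sumTo-mono n (∀Fin⇒∀< (λ k → cost-term k (x k) ℚ.≤ 1ℚ) (λ v →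
      proj₂ (cost-term-probability (toℕ v) _ (subst Probability (pointwise v) (p-probability v X))))))
    where
    x : ℕ → ℚ
    x = contents 0ℚ (List.tabulate (λ v → p G v X))
    pointwise : ∀ v → p G v X ≡ x (toℕ v)
    pointwise v = sym (contents-tabulate 0ℚ (λ v → p G v X) v)

  -- A guess β fixes for every random arc whether its tail is active initially.
  module Guess (β : ℕ → Bool) where

    IsHead : ℕ → Fin n → Fin n → Set
    IsHead l v u = randomArc (toℕ u) (toℕ v) ∧ (β (index u v) ∧ live l u v) ≡ true

    head? : ∀ l v → Dec (∃ (IsHead l v))
    head? l v = Finₚ.any? (λ u → (randomArc (toℕ u) (toℕ v) ∧ (β (index u v) ∧ live l u v)) Boolₚ.≟ true)

    heads : ℕ → Subset n
    heads l = tabulate λ v → does (head? l v)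

    heads⇒ : ∀ l v → lookup (heads l) v ≡ true → ∃ (IsHead l v)
    heads⇒ l v e with head? l v | trans (sym (Vecₚ.lookup∘tabulate (λ v → does (head? l v)) v)) e
    ... | yes found | _ = found

    heads⇐ : ∀ l v u → IsHead l v u → lookup (heads l) v ≡ true
    heads⇐ l v u h = trans (Vecₚ.lookup∘tabulate (λ v → does (head? l v)) v) (dec-true (head? l v) (u , h))

    reached : ℕ → Subset n
    reached l = activated l (heads l)

    reachProb : Fin n → ℚ
    reachProb v = mean (λ l → lookup (reached l) v)

    Consistent : (ℕ → Bool) → Set
    Consistent y = ∀ (u v : Fin n) → randomArc (toℕ u) (toℕ v) ≡ true → β (index u v) ≡ y (toℕ u)

    -- The probabilities are a parameter that has to be right at the nodes only, so that the array
    -- computed by the program can be inserted as it stands.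
    module Bill (q : ℕ → ℚ) (q≡ : ∀ v → q (toℕ v) ≡ reachProb v) where

      penalty : ℚ → (ℕ → ℕ → Bool) → ℕ → ℚ
      penalty x κ v = sumTo n (λ k → if randomArc v k then (if κ v k then size else x) else 0ℚ)

      β′ : ℕ → ℕ → Bool
      β′ u v = β (u * n + v)

      -- `total v` is what v pays, penalties included, as long as it stays outside the set;
      -- `supply v` is what it saves by joining. Joining exchanges the random arcs out of v that
      -- violate the guess with those that comply: an arc guessed to have an active tail saves
      -- `size`, any other one costs `size`. Minimising the bill thus means maximising the weight of
      -- a closure.
      supply total : ℕ → ℚ
      supply v = (cost-term v (q v) ℚ.- ι (not (target v))) ℚ.+ penalty (ℚ.- size) β′ v
      total  v = cost-term v (q v) ℚ.+ penalty 0ℚ β′ v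

      -- The cost of the closed set y if it complies with the guess.  Otherwise the penalty
      -- alone is at least the cost of any set of effectors, see cost≤size.
      bill : (ℕ → Bool) → ℚ
      bill y = sumTo n (λ v → (if y v then ι (not (target v)) else cost-term v (q v)) ℚ.+ penalty 0ℚ (λ u k → β′ u k xor y u) v)

      bill≡ : ∀ y → bill y ≡ sumTo n total ℚ.- sumTo n (λ v → ι (y v) ℚ.* supply v)
      bill≡ y = begin
        bill y
          ≡⟨ sumTo-cong n (λ v _ → node v) ⟩
        sumTo n (λ v → total v ℚ.+ (ℚ.- 1ℚ) ℚ.* (ι (y v) ℚ.* supply v))
          ≡⟨ sumTo-+ n total _ ⟩
        sumTo n total ℚ.+ sumTo n (λ v → (ℚ.- 1ℚ) ℚ.* (ι (y v) ℚ.* supply v))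
          ≡⟨ cong (sumTo n total ℚ.+_) (sumTo-* n (ℚ.- 1ℚ) (λ v → ι (y v) ℚ.* supply v)) ⟩
        sumTo n total ℚ.+ (ℚ.- 1ℚ) ℚ.* sumTo n (λ v → ι (y v) ℚ.* supply v)
          ≡⟨ solve 2 (λ a b → a :+ (:- con 1ℚ) :* b := a :- b) refl (sumTo n total) (sumTo n (λ v → ι (y v) ℚ.* supply v)) ⟩
        sumTo n total ℚ.- sumTo n (λ v → ι (y v) ℚ.* supply v) ∎
        where
        open ≡-Reasoning
        pen : ∀ v → y v ≡ true → penalty 0ℚ (λ u k → β′ u k xor y u) v ℚ.+ penalty (ℚ.- size) β′ v ≡ penalty 0ℚ β′ v
        pen v yv = trans (sym (sumTo-+ n _ _)) (sumTo-cong n (λ k _ → entry′ k))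
          where
          entry′ : ∀ k → (if randomArc v k then (if β′ v k xor y v then size else 0ℚ) else 0ℚ)
                         ℚ.+ (if randomArc v k then (if β′ v k then size else ℚ.- size) else 0ℚ)
                       ≡ (if randomArc v k then (if β′ v k then size else 0ℚ) else 0ℚ)
          entry′ k with randomArc v k | β′ v k | y v
          entry′ k | false | _     | _     = refl
          entry′ k | true  | true  | true  = ℚₚ.+-identityˡ size
          entry′ k | true  | false | true  = ℚₚ.+-inverseʳ size
          entry′ k | true  | _     | false = contradiction yv λ ()
        pen′ : ∀ v → y v ≡ false → penalty 0ℚ (λ u k → β′ u k xor y u) v ≡ penalty 0ℚ β′ v
        pen′ v yv = sumTo-cong n (λ k _ → cong (λ b → if randomArc v k then (if b then size else 0ℚ) else 0ℚ)
          (trans (cong (β′ v k xor_) yv) (Boolₚ.xor-identityʳ (β′ v k))))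
        node : ∀ v → (if y v then ι (not (target v)) else cost-term v (q v)) ℚ.+ penalty 0ℚ (λ u k → β′ u k xor y u) v
             ≡ total v ℚ.+ (ℚ.- 1ℚ) ℚ.* (ι (y v) ℚ.* supply v)
        node v = go (y v) refl
          where
          go : ∀ c → y v ≡ c → (if c then ι (not (target v)) else cost-term v (q v)) ℚ.+ penalty 0ℚ (λ u k → β′ u k xor y u) v
             ≡ total v ℚ.+ (ℚ.- 1ℚ) ℚ.* (ι c ℚ.* supply v)
          go true  yv = trans (solve 4 (λ t c a b → t :+ a := (c :+ (a :+ b)) :+ (:- con 1ℚ) :* (con 1ℚ :* ((c :- t) :+ b))) refl
                          (ι (not (target v))) (cost-term v (q v)) (penalty 0ℚ (λ u k → β′ u k xor y u) v) (penalty (ℚ.- size) β′ v))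
                        (cong (λ z → (cost-term v (q v) ℚ.+ z) ℚ.+ (ℚ.- 1ℚ) ℚ.* (1ℚ ℚ.* supply v)) (pen v yv))
          go false yv = trans (cong (cost-term v (q v) ℚ.+_) (pen′ v yv))
                          (solve 2 (λ t s → t := t :+ (:- con 1ℚ) :* (con 0ℚ :* s)) refl (total v) (supply v))

      pay : (ℕ → Bool) → ℕ → ℚ
      pay y v = if y v then ι (not (target v)) else cost-term v (q v)

      violation : (ℕ → Bool) → ℕ → ℕ → ℚ
      violation y v k = if randomArc v k then (if β′ v k xor y v then size else 0ℚ) else 0ℚ

      violation≥0 : ∀ y v k → 0ℚ ℚ.≤ violation y v k
      violation≥0 y v k with randomArc v k | β′ v k xor y v
      ... | true  | true  = size≥0
      ... | true  | false = ℚₚ.≤-refl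
      ... | false | _     = ℚₚ.≤-refl

      pay≥0 : ∀ y v → v < n → 0ℚ ℚ.≤ pay y v
      pay≥0 y v v< with y v
      ... | true  = ι≥0 (not (target v))
      ... | false = proj₁ (cost-term-probability v (q v) (∀Fin⇒∀< (Probability ∘ q) (λ i → subst Probability (sym (q≡ i)) (mean-probability _)) v v<))

      size≤bill : ∀ y → ¬ Consistent y → size ℚ.≤ bill y
      size≤bill y inconsistent with Finₚ.any? {n = n} (λ u → Finₚ.any? {n = n} (λ v →
        (randomArc (toℕ u) (toℕ v) ∧ (β (index u v) xor y (toℕ u))) Boolₚ.≟ true))
      ... | no none = contradiction consistent inconsistent
        where
        consistent : Consistent y
        consistent u v r with β (index u v) in eβ | y (toℕ u) in ey
        ... | true  | true  = refl
        ... | false | false = refl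
        ... | true  | false = contradiction (u , v , trans (cong₂ (λ a b → a ∧ (b xor y (toℕ u))) r eβ) (cong (true xor_) ey)) none
        ... | false | true  = contradiction (u , v , trans (cong₂ (λ a b → a ∧ (b xor y (toℕ u))) r eβ) (cong (false xor_) ey)) none
      ... | yes (u , v , bad) = begin
        size
          ≡⟨ full (∧-trueˡ bad) (∧-trueʳ {randomArc (toℕ u) (toℕ v)} bad) ⟨
        violation y (toℕ u) (toℕ v)
          ≤⟨ term≤sumTo n (toℕ v) (Finₚ.toℕ<n v) (λ k _ → violation≥0 y (toℕ u) k) ⟩
        sumTo n (violation y (toℕ u))
          ≤⟨ x≤x+y _ (pay≥0 y (toℕ u) (Finₚ.toℕ<n u)) ⟩
        sumTo n (violation y (toℕ u)) ℚ.+ pay y (toℕ u)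
          ≡⟨ ℚₚ.+-comm (sumTo n (violation y (toℕ u))) (pay y (toℕ u)) ⟩
        pay y (toℕ u) ℚ.+ sumTo n (violation y (toℕ u))
          ≤⟨ term≤sumTo n {λ v → pay y v ℚ.+ sumTo n (violation y v)} (toℕ u) (Finₚ.toℕ<n u) (λ v v< → 0≤+ (pay≥0 y v v<) (sumTo-nonneg n (λ k _ → violation≥0 y v k))) ⟩
        bill y ∎
        where
        open ℚₚ.≤-Reasoning
        full : randomArc (toℕ u) (toℕ v) ≡ true → (β (index u v) xor y (toℕ u)) ≡ true → violation y (toℕ u) (toℕ v) ≡ size
        full r x rewrite r | x = refl

      open PushRelabel n arc supply using (ClosedUnder)

      module _ (y : ℕ → Bool) (y-closed : ClosedUnder y) (consistent : Consistent y)
               (R : Subset n) (R≡ : ∀ v → lookup R v ≡ y (toℕ v)) where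

        -- Once R is active, only the random arcs leave it, and β says which of them can fire.
        activated≡ : ∀ l v → lookup (activated l R) v ≡ lookup R v ∨ lookup (reached l) v
        activated≡ l = closure-restart R (heads l) (activated l R) (reached l) exits entries
            (activated-isClosure l R) (activated-isClosure l (heads l))
          where
          exits : ∀ u v → lookup R u ≡ true → live l u v ≡ true → lookup R v ≡ true ⊎ lookup (heads l) v ≡ true
          exits u v r e with randomArc (toℕ u) (toℕ v) in eʳ
          ... | false = inj₁ (trans (R≡ v) (y-closed (toℕ u) (toℕ v) (Finₚ.toℕ<n u) (Finₚ.toℕ<n v) (live⇒arc l u v e eʳ) (trans (sym (R≡ u)) r)))
          ... | true  = inj₂ (heads⇐ l v u (cong₂ _∧_ eʳ (cong₂ _∧_ (trans (consistent u v eʳ) (trans (sym (R≡ u)) r)) e)))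
          entries : ∀ v → lookup (heads l) v ≡ true → ∃ λ u → lookup R u ≡ true × live l u v ≡ true
          entries v h with heads⇒ l v h
          ... | u , i = u , trans (R≡ u) (trans (sym (consistent u v r)) (∧-trueˡ i′)) , ∧-trueʳ {β (index u v)} i′
            where
            r = ∧-trueˡ i
            i′ = ∧-trueʳ {randomArc (toℕ u) (toℕ v)} i

        p≡ : ∀ v → p G v R ≡ (if y (toℕ v) then 1ℚ else q (toℕ v))
        p≡ v with y (toℕ v) in yv
        ... | true  = trans (p≡mean v R) (trans (mean-cong (λ l _ → trans (activated≡ l v) (cong (_∨ lookup (reached l) v) (trans (R≡ v) yv)))) mean-true)
        ... | false = trans (p≡mean v R) (trans (mean-cong (λ l _ → trans (activated≡ l v) (cong (_∨ lookup (reached l) v) (trans (R≡ v) yv)))) (sym (q≡ v)))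

        cost≡bill : cost G A R ≡ bill y
        cost≡bill = trans (cost≡sumTo R (λ k → if y k then 1ℚ else q k) p≡) (sumTo-cong n (λ k k< → trans (node k) (sym (trans (cong (pay y k ℚ.+_) (clean k k<)) (ℚₚ.+-identityʳ _)))))
          where
          node : ∀ k → cost-term k (if y k then 1ℚ else q k) ≡ pay y k
          node k with y k | target k
          ... | true  | true  = ℚₚ.+-inverseʳ 1ℚ
          ... | true  | false = refl
          ... | false | _     = refl
          clean : ∀ k → k < n → sumTo n (violation y k) ≡ 0ℚ
          clean = ∀Fin⇒∀< (λ k → sumTo n (violation y k) ≡ 0ℚ) λ u →
            trans (sumTo-cong n (∀Fin⇒∀< (λ k → violation y (toℕ u) k ≡ 0ℚ) (none u))) (sumTo-zero n)
            where
            none : ∀ u v → violation y (toℕ u) (toℕ v) ≡ 0ℚ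
            none u v with randomArc (toℕ u) (toℕ v) in r
            ... | false = refl
            ... | true rewrite consistent u v r | Boolₚ.xor-same (y (toℕ u)) = refl

      bill-sound : ∀ y → ClosedUnder y → ∀ c → bill y ℚ.≤ c → Effectors G A ∞ c
      bill-sound y y-closed c le with Finₚ.all? {n = n} (λ u → Finₚ.all? {n = n} (λ v → (not (randomArc (toℕ u) (toℕ v)) ∨ not (β (index u v) xor y (toℕ u))) Boolₚ.≟ true))
      ... | yes ok = R , tt , ℚₚ.≤-trans (ℚₚ.≤-reflexive (cost≡bill y y-closed consistent R (Vecₚ.lookup∘tabulate (y ∘ toℕ)))) le
        where
        R = tabulate (y ∘ toℕ)
        agree : ∀ {r b c} → not r ∨ not (b xor c) ≡ true → r ≡ true → b ≡ c
        agree {true} {true}  {true}  _ _ = refl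
        agree {true} {false} {false} _ _ = refl
        consistent : Consistent y
        consistent u v r = agree (ok u v) r
      -- If a bill with a violation is at most c, then so is `size`, and even the empty set of
      -- effectors is cheap enough. Acceptance is therefore right for inconsistent guesses too.
      ... | no bad = tabulate (λ _ → false) , tt , ℚₚ.≤-trans (cost≤size _) (ℚₚ.≤-trans (size≤bill y (λ consistent → bad (λ u v → dis (consistent u v)))) le)
        where
        dis : ∀ {r b c} → (r ≡ true → b ≡ c) → not r ∨ not (b xor c) ≡ true
        dis {false} h = refl
        dis {true} {b} {c} h = cong not (trans (cong (_xor c) (h refl)) (Boolₚ.xor-same c))

  module _ (c : ℚ) where

    -- The mask is the guess that is true for the closure `R` of the given effectors. It has to be
    -- chosen before `q`, because `q` is determined by the guess.
    bill-complete : Effectors G A ∞ c → ∃ λ s → s < #masksℕ × (∀ q (q≡ : ∀ v → q (toℕ v) ≡ Guess.reachProb (contents false (decode ws s)) v) →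
      ∃ λ y → PushRelabel.ClosedUnder n arc (λ _ → 0ℚ) y × Guess.Bill.bill (contents false (decode ws s)) q q≡ y ℚ.≤ c)
    bill-complete (X , _ , le) = s , proj₁ (proj₂ mask) , λ q q≡ → y , y-closed ,
        ℚₚ.≤-trans (ℚₚ.≤-reflexive (trans (sym (Guess.Bill.cost≡bill β q q≡ y y-closed consistent R (λ v → sym (contents-toList false R v)))) (sym cost≡))) le
      where
      D : Vec (Subset n) n
      D = tabulate λ u → tabulate λ v → arc (toℕ u) (toℕ v)
      D≡ : ∀ u v → arcsᴸ D u v ≡ arc (toℕ u) (toℕ v)
      D≡ u v = trans (cong (λ r → lookup r v) (Vecₚ.lookup∘tabulate (λ u → tabulate λ v → arc (toℕ u) (toℕ v)) u)) (Vecₚ.lookup∘tabulate (λ v → arc (toℕ u) (toℕ v)) v)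
      R : Subset n
      -- A cascade in which exactly the certain arcs are live serves as the closure operator.
      R = activeᴸ D X
      r : IsClosure (arcsᴸ D) X R
      r = active-isClosure D X
      tails : Vec (Subset n) n
      -- The guess in the layout of an outcome: every cell of row u records whether u belongs to
      -- `R`.
      tails = tabulate λ u → Vec.replicate n (lookup R u)
      mask = decode-surjective ws (contents false (flat tails))
      s = proj₁ mask
      β = contents false (decode ws s)
      y : ℕ → Bool
      y = contents false (Vec.toList R)
      y≡ : ∀ u → y (toℕ u) ≡ lookup R u
      y≡ = contents-toList false R
      consistent : Guess.Consistent β y
      consistent u v e = trans (proj₂ (proj₂ mask) (index u v) e) (trans (contents-flat tails u v)
        (trans (cong (λ r → lookup r v) (Vecₚ.lookup∘tabulate (λ u → Vec.replicate n (lookup R u)) u)) (trans (Vecₚ.lookup-replicate v (lookup R u)) (sym (y≡ u)))))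
      y-closed : PushRelabel.ClosedUnder n arc (λ _ → 0ℚ) y
      y-closed u v u< v< = ∀Fin⇒∀< (λ u → arc u v ≡ true → y u ≡ true → y v ≡ true)
        (λ i → ∀Fin⇒∀< (λ v → arc (toℕ i) v ≡ true → y (toℕ i) ≡ true → y v ≡ true)
          (λ j a e → trans (y≡ j) (IsClosure.closed r i j (trans (sym (y≡ i)) e) (trans (D≡ i j) a))) v v<) u u<
      p≡ : ∀ v → p G v X ≡ p G v R
      p≡ v = trans (p≡mean v X) (trans (mean-cong (λ l _ →
          closure-absorb X R (activated l X) (activated l R) (λ u v a → arc⇒live l u v (trans (sym (D≡ u v)) a)) r (activated-isClosure l X) (activated-isClosure l R) v))
        (sym (p≡mean v R)))
      cost≡ : cost G A X ≡ cost G A R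
      cost≡ = trans (cost≡sumTo X x (λ v → trans (p≡ v) (x≡ v))) (sym (cost≡sumTo R x x≡))
        where
        x = contents 0ℚ (List.tabulate (λ v → p G v R))
        x≡ : ∀ v → p G v R ≡ x (toℕ v)
        x≡ v = sym (contents-tabulate 0ℚ (λ v → p G v R) v)

-- The program and its correctness

branch-nonzero : ∀ (P : Memory → Set) e S S′ m →
  (evalᴺ e m ≢ 0 → P (exec S m)) → (evalᴺ e m ≡ 0 → P (exec S′ m)) →
  P (exec (branch e S S′) m)
branch-nonzero P e S S′ m t f = branch-rule P e S S′ m (λ k eq → t (λ eq′ → contradiction (trans (sym eq) eq′) λ ())) f

toℕᵇ : Bool → ℕ
toℕᵇ b = if b then 1 else 0

branch-bool : ∀ (P : Memory → Set) e S S′ m b → evalᴺ e m ≡ toℕᵇ b →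
  (b ≡ true → P (exec S m)) → (b ≡ false → P (exec S′ m)) →
  P (exec (branch e S S′) m)
branch-bool P e S S′ m true  eq t f = branch-rule P e S S′ m (λ _ _ → t refl) (λ eq′ → contradiction (trans (sym eq) eq′) λ ())
branch-bool P e S S′ m false eq t f = branch-rule P e S S′ m (λ _ eq′ → contradiction (trans (sym eq) eq′) λ ()) (λ _ → f refl)

write-same : ∀ {A : Set} {i j} {x y : A} → i ≡ j → (if i ≡ᵇ j then x else y) ≡ x
write-same {i = i} refl rewrite ≡ᵇ-refl i = refl

write-other : ∀ {A : Set} {i j} {x y : A} → i ≢ j → (if i ≡ᵇ j then x else y) ≡ y
write-other {i = i} {j} i≢j rewrite ¬T⇒≡ {i ≡ᵇ j} (λ t → i≢j (≡ᵇ⇒≡ i j t)) = refl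

varᴺ : ℕ → NatExp
varᴺ a = a [ lit 0 ]

varᴿ : ℕ → RatExp
varᴿ a = a [ lit 0 ]

-- Natural scalars: 2 nodes, 3 cells, 4 rounds, 5 masks, 6 number of random arcs,
-- 8 to 13 loop counters, 16 and 17 remainder and remaining digits in decoding.
-- Natural arrays: 0 answer, 1 targets, 7 powers of two, 14 guess, 15 live arcs,
-- 18 reached nodes, 19 heights.
-- Rational scalars: 1 cost bound, 2 number of nodes, 3 probability of the outcome,
-- 7 value, 8 amount to be pushed.  Rational arrays: 0 weights, 4 probabilities of
-- being reached, 5 excesses, 6 flow.
cellᵘᵛ cellᵛᵘ : NatExp
cellᵘᵛ = varᴺ 11 ⊗ varᴺ 2 ⊕ varᴺ 12
cellᵛᵘ = varᴺ 12 ⊗ varᴺ 2 ⊕ varᴺ 11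

certainᴱ randomᴱ : NatExp → NatExp
certainᴱ i = lit 1ℚ ≼ 0 [ i ]
randomᴱ i = lit 1 ⊖ ((0 [ i ] ≼ lit 0ℚ) ⊕ (lit 1ℚ ≼ 0 [ i ]))

positiveᴱ : RatExp → NatExp
positiveᴱ r = lit 1 ⊖ (r ≼ lit 0ℚ)

eval-random : ∀ i m → evalᴺ (randomᴱ i) m ≡ toℕᵇ (isRandom (rat m 0 (evalᴺ i m)))
eval-random i m = go (rat m 0 (evalᴺ i m) ℚ.≤ᵇ 0ℚ) (1ℚ ℚ.≤ᵇ rat m 0 (evalᴺ i m))
  where
  go : ∀ a b → 1 ∸ (toℕᵇ a + toℕᵇ b) ≡ toℕᵇ (not a ∧ not b)
  go false false = refl
  go false true  = refl
  go true  false = refl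
  go true  true  = refl

eval-positive : ∀ r m → evalᴺ (positiveᴱ r) m ≡ toℕᵇ (not (evalᴿ r m ℚ.≤ᵇ 0ℚ))
eval-positive r m = go (evalᴿ r m ℚ.≤ᵇ 0ℚ)
  where
  go : ∀ a → 1 ∸ toℕᵇ a ≡ toℕᵇ (not a)
  go false = refl
  go true  = refl

-- Counting the random arcs and decoding masks

countRandom countStep countCode : Code
countRandom = 6 ⟦ lit 0 ⟧≔ᴺ varᴺ 6 ⊕ lit 1 ▹ 7 ⟦ varᴺ 6 ⟧≔ᴺ 7 [ varᴺ 6 ⊖ lit 1 ] ⊕ 7 [ varᴺ 6 ⊖ lit 1 ]
countStep = branch (randomᴱ (varᴺ 8)) countRandom done
countCode = for 8 #cells countStep

decodeHigh decodeLow decodeDigit decodeRandom decodeConstant decodeStep decodeCode : Code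
decodeHigh = 15 ⟦ varᴺ 8 ⟧≔ᴺ lit 1 ▹ 16 ⟦ lit 0 ⟧≔ᴺ varᴺ 16 ⊖ 7 [ varᴺ 17 ] ▹ 3 ⟦ lit 0 ⟧≔ᴿ varᴿ 3 ⊗ 0 [ varᴺ 8 ]
decodeLow = 15 ⟦ varᴺ 8 ⟧≔ᴺ lit 0 ▹ 3 ⟦ lit 0 ⟧≔ᴿ varᴿ 3 ⊗ (lit 1ℚ ⊖ 0 [ varᴺ 8 ])
decodeDigit = branch (lit 1 ⊖ (7 [ varᴺ 17 ] ⊖ varᴺ 16)) decodeHigh decodeLow
decodeRandom = 17 ⟦ lit 0 ⟧≔ᴺ varᴺ 17 ⊖ lit 1 ▹ decodeDigit
decodeConstant = 15 ⟦ varᴺ 8 ⟧≔ᴺ certainᴱ (varᴺ 8)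
decodeStep = branch (randomᴱ (varᴺ 8)) decodeRandom decodeConstant
decodeCode = 17 ⟦ lit 0 ⟧≔ᴺ varᴺ 6 ▹ 3 ⟦ lit 0 ⟧≔ᴿ lit 1ℚ ▹ for 8 #cells decodeStep

drop-∷ : ∀ (ws : List ℚ) k → k < List.length ws → List.drop k ws ≡ contents 0ℚ ws k ∷ List.drop (suc k) ws
drop-∷ (w ∷ ws) zero    k< = refl
drop-∷ (w ∷ ws) (suc k) k< = drop-∷ ws k (s≤s⁻¹ k<)

drop-length : ∀ (ws : List ℚ) → List.drop (List.length ws) ws ≡ []
drop-length []       = refl
drop-length (w ∷ ws) = drop-length ws

module Counting (ws : List ℚ) (m : Memory) (w≡ : ∀ j → rat m 0 j ≡ contents 0ℚ ws j)
                (cells≡ : nat m 3 0 ≡ List.length ws) where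

  record Counted (k : ℕ) (count : ℕ) (powers : ℕ → ℕ) : Set where
    field
      counted : count + #random (List.drop k ws) ≡ #random ws
      powers≡ : ∀ i → i ≤ count → powers i ≡ 2 ^ i
  open Counted

  count-correct : nat m 6 0 ≡ 0 → nat m 7 0 ≡ 1 →
    let m′ = exec countCode m in
    nat m′ 6 0 ≡ #random ws × (∀ i → i ≤ #random ws → nat m′ 7 i ≡ 2 ^ i)
  count-correct z o = trans (sym (+-identityʳ _)) (trans (cong (nat m′ 6 0 +_) (sym (cong #random (drop-length ws)))) (counted final))
      , λ i i≤ → powers≡ final i (≤-trans i≤ (≤-reflexive (sym count≡)))
    where
    m′ = exec countCode m
    Inv : ℕ → Memory → Set
    Inv k m = Counted k (nat m 6 0) (nat m 7)
    next : ∀ k → k < List.length ws → ∀ w → contents 0ℚ ws k ≡ w → List.drop k ws ≡ w ∷ List.drop (suc k) ws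
    next k k< w refl = drop-∷ ws k k<
    final : Inv (List.length ws) m′
    final = for-rule Inv 8 #cells countStep m refl cells≡
      (record { counted = cong (_+ #random ws) z ; powers≡ = λ { i i≤ → base i (≤-trans i≤ (≤-reflexive z)) } })
      λ k m₁ k< k≡ fr inv →
        let w₁≡ : rat m₁ 0 (nat m₁ 8 0) ≡ contents 0ℚ ws k
            w₁≡ = trans (ratᶠ fr 0 refl _) (trans (w≡ _) (cong (contents 0ℚ ws) k≡)) in
        branch-bool (λ m₂ → Inv (suc k) (setᴺ 8 0 (suc k) m₂)) (randomᴱ (varᴺ 8)) countRandom done m₁ (isRandom (contents 0ℚ ws k))
          (trans (eval-random (varᴺ 8) m₁) (cong (toℕᵇ ∘ isRandom) w₁≡))
          (λ r → record
            { counted = trans (trans (cong (_+ #random (List.drop (suc k) ws)) (+-comm (nat m₁ 6 0) 1))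
                (trans (sym (+-suc (nat m₁ 6 0) _)) (cong (nat m₁ 6 0 +_) (sym (head-true k k< r))))) (counted inv)
            ; powers≡ = λ i i≤ → double-power i (nat m₁ 6 0) (nat m₁ 7) i≤ (powers≡ inv) })
          (λ r → record { counted = trans (cong (nat m₁ 6 0 +_) (sym (head-false k k< r))) (counted inv) ; powers≡ = powers≡ inv })
      where
      base : ∀ i → i ≤ 0 → nat m 7 i ≡ 2 ^ i
      base zero z≤n = o
      head-true : ∀ k → k < List.length ws → isRandom (contents 0ℚ ws k) ≡ true → #random (List.drop k ws) ≡ suc (#random (List.drop (suc k) ws))
      head-true k k< r = trans (cong #random (drop-∷ ws k k<)) (cong (if_then suc (#random (List.drop (suc k) ws)) else #random (List.drop (suc k) ws)) r)
      head-false : ∀ k → k < List.length ws → isRandom (contents 0ℚ ws k) ≡ false → #random (List.drop k ws) ≡ #random (List.drop (suc k) ws)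
      head-false k k< r = trans (cong #random (drop-∷ ws k k<)) (cong (if_then suc (#random (List.drop (suc k) ws)) else #random (List.drop (suc k) ws)) r)
      double-power : ∀ i c (pw : ℕ → ℕ) → i ≤ c + 1 → (∀ j → j ≤ c → pw j ≡ 2 ^ j) →
        (if (c + 1) ≡ᵇ i then pw (c + 1 ∸ 1) + pw (c + 1 ∸ 1) else pw i) ≡ 2 ^ i
      double-power i c pw i≤ h with c + 1 ≟ i
      ... | yes refl = trans (write-same {i = c + 1} refl) (trans (cong (λ j → pw j + pw j) (m+n∸n≡m c 1))
              (trans (cong₂ _+_ (h c ≤-refl) (h c ≤-refl)) (trans (sym (double c)) (cong (2 ^_) (+-comm 1 c)))))
      ... | no c≢i = trans (write-other c≢i) (h i (s≤s⁻¹ (≤-trans (≤∧≢⇒< i≤ (≢-sym c≢i)) (≤-reflexive (+-comm c 1)))))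
    count≡ : nat m′ 6 0 ≡ #random ws
    count≡ = trans (sym (+-identityʳ _)) (trans (cong (nat m′ 6 0 +_) (sym (cong #random (drop-length ws)))) (counted final))

module Decoding (ws : List ℚ) (m : Memory) (w≡ : ∀ j → rat m 0 j ≡ contents 0ℚ ws j)
                (cells≡ : nat m 3 0 ≡ List.length ws) (count≡ : nat m 6 0 ≡ #random ws)
                (powers≡ : ∀ i → i ≤ #random ws → nat m 7 i ≡ 2 ^ i) (l : ℕ) (x≡ : nat m 16 0 ≡ l) where

  -- After k cells, `x` is the number of the outcome on the remaining coins and `π` the probability
  -- of the coins already decoded. The field `within` keeps the index into the table of powers in
  -- its range.
  record Decoded (k : ℕ) (coins : ℕ → ℕ) (x digits : ℕ) (π : ℚ) : Set where
    field
      digits≡ : digits ≡ #random (List.drop k ws)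
      within  : digits ≤ #random ws
      prob≡   : π ℚ.* prob (List.drop k ws) x ≡ prob ws l
      before  : ∀ j → j < k → coins j ≡ toℕᵇ (contents false (decode ws l) j)
      after   : ∀ j → contents false (decode ws l) (k + j) ≡ contents false (decode (List.drop k ws) x) j
  open Decoded

  decoded-step : ∀ {k coins x digits π} coins′ b x′ digits′ π′ → Decoded k coins x digits π →
    decode (List.drop k ws) x ≡ b ∷ decode (List.drop (suc k) ws) x′ →
    π′ ℚ.* prob (List.drop (suc k) ws) x′ ≡ π ℚ.* prob (List.drop k ws) x →
    digits′ ≡ #random (List.drop (suc k) ws) → digits′ ≤ digits →
    coins′ k ≡ toℕᵇ b → (∀ j → j ≢ k → coins′ j ≡ coins j) →
    Decoded (suc k) coins′ x′ digits′ π′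
  decoded-step {k} {coins} {x} coins′ b x′ digits′ π′ D d pr dg dg≤ atk off = record
    { digits≡ = dg
    ; within  = ≤-trans dg≤ (within D)
    ; prob≡   = trans pr (prob≡ D)
    ; before  = before′
    ; after   = λ j → trans (cong (contents false (decode ws l)) (sym (+-suc k j)))
                  (trans (after D (suc j)) (cong (λ bs → contents false bs (suc j)) d)) }
    where
    before′ : ∀ j → j < suc k → coins′ j ≡ toℕᵇ (contents false (decode ws l) j)
    before′ j j< with j ≟ k
    ... | no j≢k   = trans (off j j≢k) (before D j (≤∧≢⇒< (s≤s⁻¹ j<) j≢k))
    ... | yes refl = trans atk (cong toℕᵇ (trans (sym (cong (λ bs → contents false bs 0) d))
                       (trans (sym (after D 0)) (cong (contents false (decode ws l)) (+-identityʳ k)))))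

  decode-∷-constant : ∀ w vs x → isRandom w ≡ false → decode (w ∷ vs) x ≡ isCertain w ∷ decode vs x × prob (w ∷ vs) x ≡ prob vs x
    × #random (w ∷ vs) ≡ #random vs
  decode-∷-constant w vs x e rewrite e = refl , refl , refl

  decode-∷-true : ∀ w vs x → isRandom w ≡ true → 2 ^ #random vs ≤ x → decode (w ∷ vs) x ≡ true ∷ decode vs (x ∸ 2 ^ #random vs)
    × prob (w ∷ vs) x ≡ w ℚ.* prob vs (x ∸ 2 ^ #random vs)
  decode-∷-true w vs x e le rewrite e | T⇒≡ (≤⇒≤ᵇ le) = refl , refl

  decode-∷-false : ∀ w vs x → isRandom w ≡ true → x < 2 ^ #random vs → decode (w ∷ vs) x ≡ false ∷ decode vs x
    × prob (w ∷ vs) x ≡ (1ℚ ℚ.- w) ℚ.* prob vs x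
  decode-∷-false w vs x e lt rewrite e | <⇒≤ᵇ≡false lt = refl , refl

  #random-∷ : ∀ w vs → isRandom w ≡ true → #random (w ∷ vs) ≡ suc (#random vs)
  #random-∷ w vs e rewrite e = refl

  decode-correct : let m′ = exec decodeCode m in
    (∀ j → j < List.length ws → nat m′ 15 j ≡ toℕᵇ (contents false (decode ws l) j)) × rat m′ 3 0 ≡ prob ws l
  decode-correct = before final , trans (sym (trans (cong (rat m′ 3 0 ℚ.*_) (cong (λ vs → prob vs (nat m′ 16 0)) (drop-length ws))) (ℚₚ.*-identityʳ _))) (prob≡ final)
    where
    m′ = exec decodeCode m
    m₀ = exec (17 ⟦ lit 0 ⟧≔ᴺ varᴺ 6 ▹ 3 ⟦ lit 0 ⟧≔ᴿ lit 1ℚ) m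
    Inv : ℕ → Memory → Set
    Inv k m = Decoded k (nat m 15) (nat m 16 0) (nat m 17 0) (rat m 3 0)
    final : Inv (List.length ws) m′
    final = for-rule Inv 8 #cells decodeStep m₀ refl cells≡
      (record { digits≡ = count≡ ; within = ≤-reflexive count≡ ; prob≡ = trans (ℚₚ.*-identityˡ _) (cong (prob ws) x≡)
              ; before = λ j () ; after = λ j → cong (λ x → contents false (decode ws x) j) (sym x≡) })
      step′
      where
      step′ : ∀ k m₁ → k < List.length ws → nat m₁ 8 0 ≡ k → Unchanged (8 ∷ writesᴺ decodeStep) (writesᴿ decodeStep) m₀ m₁ →
        Inv k m₁ → Inv (suc k) (setᴺ 8 0 (suc k) (exec decodeStep m₁))
      step′ k m₁ k< k≡ fr inv =
        branch-bool P (randomᴱ (varᴺ 8)) decodeRandom decodeConstant m₁ (isRandom w) (trans (eval-random (varᴺ 8) m₁) (cong (toℕᵇ ∘ isRandom) w₁≡))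
          (λ r → branch-nonzero P (lit 1 ⊖ (7 [ varᴺ 17 ] ⊖ varᴺ 16)) decodeHigh decodeLow m₂
            (λ nz → decoded-step _ true _ _ _ inv
               (trans (cong (λ vs′ → decode vs′ x) d∷) (trans (proj₁ (high r nz)) (cong (λ q → true ∷ decode vs (x ∸ q)) (sym (power r)))))
               (trans (trans (cong (λ a → π ℚ.* a ℚ.* prob vs (x ∸ pw)) w₁≡) (ℚₚ.*-assoc π w _))
                 (cong (π ℚ.*_) (trans (cong (λ q → w ℚ.* prob vs (x ∸ q)) (power r)) (sym (trans (cong (λ vs′ → prob vs′ x) d∷) (proj₂ (high r nz)))))))
               (digits′≡ r) (m∸n≤m digits 1)
               (write-same {i = nat m₁ 8 0} k≡) (λ j j≢k → write-other (λ e → j≢k (trans (sym e) k≡))))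
            (λ z → decoded-step _ false _ _ _ inv
               (trans (cong (λ vs′ → decode vs′ x) d∷) (proj₁ (low r z)))
               (trans (trans (cong (λ a → π ℚ.* (1ℚ ℚ.- a) ℚ.* prob vs x) w₁≡) (ℚₚ.*-assoc π (1ℚ ℚ.- w) _))
                 (cong (π ℚ.*_) (sym (trans (cong (λ vs′ → prob vs′ x) d∷) (proj₂ (low r z))))))
               (digits′≡ r) (m∸n≤m digits 1)
               (write-same {i = nat m₁ 8 0} k≡) (λ j j≢k → write-other (λ e → j≢k (trans (sym e) k≡)))))
          (λ r → let (dc , pc , cc) = decode-∷-constant w vs x r in decoded-step _ (isCertain w) _ _ _ inv
               (trans (cong (λ vs′ → decode vs′ x) d∷) dc)
               (cong (π ℚ.*_) (sym (trans (cong (λ vs′ → prob vs′ x) d∷) pc)))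
               (trans (digits≡ inv) (trans (cong #random d∷) cc)) ≤-refl
               (trans (write-same {i = nat m₁ 8 0} k≡) (cong (toℕᵇ ∘ isCertain) w₁≡))
               (λ j j≢k → write-other (λ e → j≢k (trans (sym e) k≡))))
        where
        P : Memory → Set
        P m₂ = Inv (suc k) (setᴺ 8 0 (suc k) m₂)
        w = contents 0ℚ ws k
        vs = List.drop (suc k) ws
        x = nat m₁ 16 0
        π = rat m₁ 3 0
        digits = nat m₁ 17 0
        m₂ = setᴺ 17 0 (nat m₁ 17 0 ∸ 1) m₁
        pw = nat m₁ 7 (nat m₁ 17 0 ∸ 1)
        d∷ : List.drop k ws ≡ w ∷ vs
        d∷ = drop-∷ ws k k<
        w₁≡ : rat m₁ 0 (nat m₁ 8 0) ≡ w
        w₁≡ = trans (ratᶠ fr 0 refl _) (trans (w≡ _) (cong (contents 0ℚ ws) k≡))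
        digits′≡ : isRandom w ≡ true → digits ∸ 1 ≡ #random vs
        digits′≡ r = cong (_∸ 1) (trans (digits≡ inv) (trans (cong #random d∷) (#random-∷ w vs r)))
        power : isRandom w ≡ true → pw ≡ 2 ^ #random vs
        power r = trans (natᶠ fr 7 refl _) (trans (powers≡ _ (≤-trans (m∸n≤m digits 1) (within inv))) (cong (2 ^_) (digits′≡ r)))
        high : isRandom w ≡ true → 1 ∸ (pw ∸ x) ≢ 0 → decode (w ∷ vs) x ≡ true ∷ decode vs (x ∸ 2 ^ #random vs)
          × prob (w ∷ vs) x ≡ w ℚ.* prob vs (x ∸ 2 ^ #random vs)
        high r nz = decode-∷-true w vs x r (subst (_≤ x) (power r) (m∸n≡0⇒m≤n (lemma (pw ∸ x) nz)))
          where
          lemma : ∀ a → 1 ∸ a ≢ 0 → a ≡ 0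
          lemma zero    _ = refl
          lemma (suc a) h = contradiction (0∸n≡0 a) h
        low : isRandom w ≡ true → 1 ∸ (pw ∸ x) ≡ 0 → decode (w ∷ vs) x ≡ false ∷ decode vs x
          × prob (w ∷ vs) x ≡ (1ℚ ℚ.- w) ℚ.* prob vs x
        low r z = decode-∷-false w vs x r (subst (x <_) (power r) (m∸n≢0⇒n<m (λ e → contradiction (trans (sym (cong (1 ∸_) e)) z) λ ())))

toℕᵇ≢0 : ∀ {b} → toℕᵇ b ≢ 0 → b ≡ true
toℕᵇ≢0 {true}  h = refl
toℕᵇ≢0 {false} h = contradiction refl h

true⇒≢0 : ∀ {b} → b ≡ true → toℕᵇ b ≢ 0
true⇒≢0 refl ()

toℕᵇ-∧ : ∀ a b → toℕᵇ a * toℕᵇ b ≡ toℕᵇ (a ∧ b)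
toℕᵇ-∧ true  b = +-identityʳ (toℕᵇ b)
toℕᵇ-∧ false b = refl

*≢0 : ∀ {a b} → a ≢ 0 → b ≢ 0 → a * b ≢ 0
*≢0 {zero}          h h′ _ = h refl
*≢0 {suc a} {zero}  h h′ _ = h′ refl
*≢0 {suc a} {suc b} h h′ ()

*≢0⇒ : ∀ a b → a * b ≢ 0 → a ≢ 0 × b ≢ 0
*≢0⇒ a b h = (λ { refl → h refl }) , λ { refl → h (*-zeroʳ a) }

cell< : ∀ {n} u v → u < n → v < n → u * n + v < n * n
cell< {n} u v u< v< = ≤-trans (+-monoʳ-< (u * n) v<) (≤-trans (≤-reflexive (+-comm (u * n) n)) (*-monoˡ-≤ n u<))

-- Computing the reached nodes by sweeps over all pairs

markNode : Code
markNode = 18 ⟦ varᴺ 12 ⟧≔ᴺ lit 1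

sweepStep sweepRow sweepCode : NatExp → Code
sweepStep e = branch e markNode done
sweepRow e = for 12 #nodes (sweepStep e)
sweepCode e = for 11 #nodes (sweepRow e)

-- Marks set during a sweep may take effect within the same sweep, so its result depends on the
-- order of the pairs. It is therefore only bounded from both sides: `P` holds of whatever gets
-- marked, and the pairs in `Req`, which may refer to the marks at the start, are certain to mark
-- their second node.
module Sweep (n : ℕ) (e : NatExp) (m : Memory) (nodes≡ : nat m 2 0 ≡ n) (P : ℕ → Set) (Req : ℕ → ℕ → Set)
  (start : ∀ k → k < n → nat m 18 k ≢ 0 → P k)
  (sound : ∀ m′ u v → u < n → v < n → Unchanged (11 ∷ 12 ∷ 18 ∷ []) [] m m′ → nat m′ 11 0 ≡ u → nat m′ 12 0 ≡ v →
     (∀ k → k < n → nat m′ 18 k ≢ 0 → P k) → evalᴺ e m′ ≢ 0 → P v)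
  (complete : ∀ m′ u v → u < n → v < n → Unchanged (11 ∷ 12 ∷ 18 ∷ []) [] m m′ → nat m′ 11 0 ≡ u → nat m′ 12 0 ≡ v →
     (∀ k → nat m 18 k ≢ 0 → nat m′ 18 k ≢ 0) → Req u v → evalᴺ e m′ ≢ 0) where

  record Swept (u v : ℕ) (z : ℕ → ℕ) : Set where
    field
      only    : ∀ k → k < n → z k ≢ 0 → P k
      keeps   : ∀ k → nat m 18 k ≢ 0 → z k ≢ 0
      reaches : ∀ i j → i < n → j < n → i < u ⊎ (i ≡ u × j < v) → Req i j → z j ≢ 0
  open Swept

  swept : Swept n 0 (nat (exec (sweepCode e) m) 18)
  swept = for-rule Outer 11 #nodes (sweepRow e) m refl nodes≡
    (record { only = start ; keeps = λ _ h → h ; reaches = λ { _ _ _ _ (inj₁ ()) ; _ _ _ _ (inj₂ (_ , ())) } })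
    outer
    where
    Outer : ℕ → Memory → Set
    Outer u m₁ = Swept u 0 (nat m₁ 18)
    outer : ∀ u m₁ → u < n → nat m₁ 11 0 ≡ u → Unchanged (11 ∷ 12 ∷ 18 ∷ []) [] m m₁ → Outer u m₁ →
      Outer (suc u) (setᴺ 11 0 (suc u) (exec (sweepRow e) m₁))
    outer u m₁ u< u≡ fr inv = record { only = only scanned ; keeps = keeps scanned ; reaches = λ i j i< j< c → reaches scanned i j i< j< (shift i j j< c) }
      where
      shift : ∀ i j → j < n → i < suc u ⊎ (i ≡ suc u × j < 0) → i < u ⊎ (i ≡ u × j < n)
      shift i j j< (inj₁ i<) with i ≟ u
      ... | yes i≡u = inj₂ (i≡u , j<)
      ... | no i≢u  = inj₁ (≤∧≢⇒< (s≤s⁻¹ i<) i≢u)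
      Inner : ℕ → Memory → Set
      Inner v m₂ = Swept u v (nat m₂ 18)
      inner : ∀ v m₂ → v < n → nat m₂ 12 0 ≡ v → Unchanged (12 ∷ 18 ∷ []) [] m₁ m₂ → Inner v m₂ →
        Inner (suc v) (setᴺ 12 0 (suc v) (exec (sweepStep e) m₂))
      inner v m₂ v< v≡ fr′ inv′ = branch-nonzero (λ m₃ → Inner (suc v) (setᴺ 12 0 (suc v) m₃)) e markNode done m₂
        (λ nz → record
          { only = λ k k< → mark-only k (sound m₂ u v u< v< fr₂ u₂ v≡ (only inv′) nz) (only inv′ k k<)
          ; keeps = λ k h → mark-keeps k (keeps inv′ k h)
          ; reaches = λ i j i< j< c q → mark-reaches j (λ j≢v → reaches inv′ i j i< j< (earlier i j j≢v c) q) })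
        (λ z → record
          { only = only inv′ ; keeps = keeps inv′
          ; reaches = λ i j i< j< c q → skip-reaches i j i< j< z c q })
        where
        fr₂ : Unchanged (11 ∷ 12 ∷ 18 ∷ []) [] m m₂
        fr₂ = unchanged-trans fr (unchanged-∷ 11 fr′)
        u₂ : nat m₂ 11 0 ≡ u
        u₂ = trans (natᶠ fr′ 11 refl 0) u≡
        earlier : ∀ i j → j ≢ v → i < u ⊎ (i ≡ u × j < suc v) → i < u ⊎ (i ≡ u × j < v)
        earlier i j j≢v (inj₁ i<) = inj₁ i<
        earlier i j j≢v (inj₂ (i≡u , j<)) = inj₂ (i≡u , ≤∧≢⇒< (s≤s⁻¹ j<) j≢v)
        mark-only : ∀ k → P v → (nat m₂ 18 k ≢ 0 → P k) → (if nat m₂ 12 0 ≡ᵇ k then 1 else nat m₂ 18 k) ≢ 0 → P k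
        mark-only k pv h nz with nat m₂ 12 0 ≟ k
        ... | yes q = subst P (trans (sym v≡) q) pv
        ... | no q  = h (λ z → nz (trans (write-other q) z))
        mark-keeps : ∀ k → nat m₂ 18 k ≢ 0 → (if nat m₂ 12 0 ≡ᵇ k then 1 else nat m₂ 18 k) ≢ 0
        mark-keeps k h z with nat m₂ 12 0 ≡ᵇ k
        ... | false = h z
        mark-reaches : ∀ j → (j ≢ v → nat m₂ 18 j ≢ 0) → (if nat m₂ 12 0 ≡ᵇ j then 1 else nat m₂ 18 j) ≢ 0
        mark-reaches j h z with nat m₂ 12 0 ≟ j
        ... | yes q = contradiction (trans (sym (write-same q)) z) λ ()
        ... | no q  = h (λ j≡v → q (trans v≡ (sym j≡v))) (trans (sym (write-other q)) z)
        skip-reaches : ∀ i j → i < n → j < n → evalᴺ e m₂ ≡ 0 → i < u ⊎ (i ≡ u × j < suc v) → Req i j → nat m₂ 18 j ≢ 0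
        skip-reaches i j i< j< z c q with j ≟ v
        ... | no j≢v = reaches inv′ i j i< j< (earlier i j j≢v c) q
        skip-reaches i j i< j< z (inj₁ i<u) q | yes _ = reaches inv′ i j i< j< (inj₁ i<u) q
        skip-reaches i j i< j< z (inj₂ (refl , _)) q | yes refl =
          contradiction z (complete m₂ u v u< v< fr₂ u₂ v≡ (keeps inv′) q)
      scanned : Inner n (exec (sweepRow e) m₁)
      scanned = for-rule Inner 12 #nodes (sweepStep e) m₁ refl (trans (natᶠ fr 2 refl 0) nodes≡)
        (record { only = only inv ; keeps = keeps inv ; reaches = reaches inv }) inner

headᴱ spreadᴱ : NatExp
headᴱ = randomᴱ cellᵘᵛ ⊗ (14 [ cellᵘᵛ ] ⊗ 15 [ cellᵘᵛ ])
spreadᴱ = 18 [ varᴺ 11 ] ⊗ 15 [ cellᵘᵛ ]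

clearStep clearCode reachCode : Code
clearStep = 18 ⟦ varᴺ 12 ⟧≔ᴺ lit 0
clearCode = for 12 #nodes clearStep
reachCode = clearCode ▹ sweepCode headᴱ ▹ for 13 #nodes (sweepCode spreadᴱ)

addMember addStep addCode : Code
addMember = 4 ⟦ varᴺ 12 ⟧≔ᴿ 4 [ varᴺ 12 ] ⊕ varᴿ 3
addStep = branch (18 [ varᴺ 12 ]) addMember done
addCode = for 12 #nodes addStep

zeroStep zeroCode outcomeStep reachProbCode : Code
zeroStep = 4 ⟦ varᴺ 12 ⟧≔ᴿ lit 0ℚ
zeroCode = for 12 #nodes zeroStep
outcomeStep = 16 ⟦ lit 0 ⟧≔ᴺ varᴺ 10 ▹ decodeCode ▹ reachCode ▹ addCode
reachProbCode = zeroCode ▹ for 10 #masks outcomeStep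

avoids : List ℕ → List ℕ → Bool
avoids as ns = List.foldr (λ a r → not (elem a ns) ∧ r) true as

nonzero : ℕ → Bool
nonzero x = not (x ≡ᵇ 0)

nonzero⇒ : ∀ {x} → nonzero x ≡ true → x ≢ 0
nonzero⇒ () refl

nonzero⇐ : ∀ {x} → x ≢ 0 → nonzero x ≡ true
nonzero⇐ {zero}  h = contradiction refl h
nonzero⇐ {suc x} h = refl

module Machine {n : ℕ} (G : InfluenceGraph n) (A : Subset n) (c : ℚ) where

  open Cost G A

  record Context (m : Memory) : Set where
    field
      nodes≡   : nat m 2 0 ≡ n
      cells≡   : nat m 3 0 ≡ n * n
      rounds≡  : nat m 4 0 ≡ 2 * (suc n * suc n)
      masks≡   : nat m 5 0 ≡ #masksℕ
      count≡   : nat m 6 0 ≡ #random ws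
      powers≡  : ∀ i → i ≤ #random ws → nat m 7 i ≡ 2 ^ i
      targets≡ : ∀ j → nat m 1 j ≡ toℕᵇ (target j)
      weights≡ : ∀ j → rat m 0 j ≡ wt j
      bound≡   : rat m 1 0 ≡ c
      size≡    : rat m 2 0 ≡ size
  open Context public

  -- The arrays listed here are those that stay constant during the loop over the guesses. For each
  -- routine both premises are checked by evaluation.
  context-unchanged : ∀ {ns rs m m′} → avoids (1 ∷ 2 ∷ 3 ∷ 4 ∷ 5 ∷ 6 ∷ 7 ∷ []) ns ≡ true → avoids (0 ∷ 1 ∷ 2 ∷ []) rs ≡ true →
    Unchanged ns rs m m′ → Context m → Context m′
  context-unchanged {ns} {rs} a b u ctx = record
    { nodes≡ = trans (natᶠ u 2 (not-true (∧-trueˡ a₂)) 0) (nodes≡ ctx)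
    ; cells≡ = trans (natᶠ u 3 (not-true (∧-trueˡ a₃)) 0) (cells≡ ctx)
    ; rounds≡ = trans (natᶠ u 4 (not-true (∧-trueˡ a₄)) 0) (rounds≡ ctx)
    ; masks≡ = trans (natᶠ u 5 (not-true (∧-trueˡ a₅)) 0) (masks≡ ctx)
    ; count≡ = trans (natᶠ u 6 (not-true (∧-trueˡ a₆)) 0) (count≡ ctx)
    ; powers≡ = λ i i≤ → trans (natᶠ u 7 (not-true (∧-trueˡ a₇)) i) (powers≡ ctx i i≤)
    ; targets≡ = λ j → trans (natᶠ u 1 (not-true (∧-trueˡ a)) j) (targets≡ ctx j)
    ; weights≡ = λ j → trans (ratᶠ u 0 (not-true (∧-trueˡ b)) j) (weights≡ ctx j)
    ; bound≡ = trans (ratᶠ u 1 (not-true (∧-trueˡ b₁)) 0) (bound≡ ctx)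
    ; size≡ = trans (ratᶠ u 2 (not-true (∧-trueˡ b₂)) 0) (size≡ ctx) }
    where
    a₂ = ∧-trueʳ {not (elem 1 ns)} a
    a₃ = ∧-trueʳ {not (elem 2 ns)} a₂
    a₄ = ∧-trueʳ {not (elem 3 ns)} a₃
    a₅ = ∧-trueʳ {not (elem 4 ns)} a₄
    a₆ = ∧-trueʳ {not (elem 5 ns)} a₅
    a₇ = ∧-trueʳ {not (elem 6 ns)} a₆
    b₁ = ∧-trueʳ {not (elem 0 rs)} b
    b₂ = ∧-trueʳ {not (elem 1 rs)} b₁

  random-eval : ∀ i m → Context m → ∀ j → evalᴺ i m ≡ j → evalᴺ (randomᴱ i) m ≡ toℕᵇ (isRandom (wt j))
  random-eval i m ctx j e = trans (eval-random i m) (cong (toℕᵇ ∘ isRandom) (trans (weights≡ ctx _) (cong wt e)))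

  cell-eval : ∀ m u v → Context m → nat m 11 0 ≡ u → nat m 12 0 ≡ v → evalᴺ cellᵘᵛ m ≡ u * n + v
  cell-eval m u v ctx u≡ v≡ = cong₂ _+_ (cong₂ _*_ u≡ (nodes≡ ctx)) v≡

  marked : (ℕ → ℕ) → Subset n
  marked z = tabulate λ v → nonzero (z (toℕ v))

  marked≡ : ∀ z v → lookup (marked z) v ≡ nonzero (z (toℕ v))
  marked≡ z v = Vecₚ.lookup∘tabulate (λ v → nonzero (z (toℕ v))) v

  marked⇒ : ∀ z v → lookup (marked z) v ≡ true → z (toℕ v) ≢ 0
  marked⇒ z v e = nonzero⇒ (trans (sym (marked≡ z v)) e)

  marked⇐ : ∀ z v → z (toℕ v) ≢ 0 → lookup (marked z) v ≡ true
  marked⇐ z v h = trans (marked≡ z v) (nonzero⇐ h)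

  module Reach (β : ℕ → Bool) (l : ℕ) (m : Memory) (ctx : Context m)
    (guess≡ : ∀ j → j < n * n → nat m 14 j ≡ toℕᵇ (β j))
    (live≡ⱼ : ∀ j → j < n * n → nat m 15 j ≡ toℕᵇ (contents false (decode ws l) j)) where

    open Guess β

    private
      m₁ = exec clearCode m
      m₂ = exec (sweepCode headᴱ) m₁
      m₃ = exec (for 13 #nodes (sweepCode spreadᴱ)) m₂

    liveℕ headℕ : ℕ → ℕ → Bool
    liveℕ u v = contents false (decode ws l) (u * n + v)
    headℕ u v = randomArc u v ∧ (β (u * n + v) ∧ liveℕ u v)

    cleared : ∀ k → k < n → nat m₁ 18 k ≡ 0
    cleared = for-rule (λ k m → ∀ j → j < k → nat m 18 j ≡ 0) 12 #nodes clearStep m refl (nodes≡ ctx) (λ _ ())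
      λ k m′ _ k≡ _ inv j j< → step′ k m′ k≡ inv j j<
      where
      step′ : ∀ k m′ → nat m′ 12 0 ≡ k → (∀ j → j < k → nat m′ 18 j ≡ 0) → ∀ j → j < suc k → (if nat m′ 12 0 ≡ᵇ j then 0 else nat m′ 18 j) ≡ 0
      step′ k m′ k≡ inv j j< with nat m′ 12 0 ≟ j
      ... | yes q = write-same q
      ... | no q  = trans (write-other q) (inv j (≤∧≢⇒< (s≤s⁻¹ j<) (λ j≡k → q (trans k≡ (sym j≡k)))))

    ctx₁ : Context m₁
    ctx₁ = context-unchanged refl refl (frame clearCode m) ctx

    module _ (m′ : Memory) (u v : ℕ) (u< : u < n) (v< : v < n) (fr : Unchanged (11 ∷ 12 ∷ 18 ∷ []) [] m₁ m′)
             (u≡ : nat m′ 11 0 ≡ u) (v≡ : nat m′ 12 0 ≡ v) where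
      private
        ctx′ : Context m′
        ctx′ = context-unchanged refl refl fr ctx₁
        cell≡ : evalᴺ cellᵘᵛ m′ ≡ u * n + v
        cell≡ = cell-eval m′ u v ctx′ u≡ v≡

      live-eval : nat m′ 15 (evalᴺ cellᵘᵛ m′) ≡ toℕᵇ (liveℕ u v)
      live-eval = trans (natᶠ fr 15 refl _) (trans (natᶠ (frame clearCode m) 15 refl _) (trans (cong (nat m 15) cell≡) (live≡ⱼ _ (cell< u v u< v<))))

      head-eval : evalᴺ headᴱ m′ ≡ toℕᵇ (headℕ u v)
      head-eval = trans (cong₂ _*_ (random-eval cellᵘᵛ m′ ctx′ _ cell≡) (trans (cong₂ _*_
          (trans (natᶠ fr 14 refl _) (trans (natᶠ (frame clearCode m) 14 refl _) (trans (cong (nat m 14) cell≡) (guess≡ _ (cell< u v u< v<)))))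
          live-eval) (toℕᵇ-∧ (β (u * n + v)) (liveℕ u v)))) (toℕᵇ-∧ (randomArc u v) _)

    HasHead : ℕ → Set
    HasHead v = ∃ λ u → u < n × headℕ u v ≡ true

    head-start : ∀ k → k < n → nat m₁ 18 k ≢ 0 → HasHead k
    head-start k k< nz = contradiction (cleared k k<) nz

    head-sound : ∀ m′ u v → u < n → v < n → Unchanged (11 ∷ 12 ∷ 18 ∷ []) [] m₁ m′ → nat m′ 11 0 ≡ u → nat m′ 12 0 ≡ v →
      (∀ k → k < n → nat m′ 18 k ≢ 0 → HasHead k) → evalᴺ headᴱ m′ ≢ 0 → HasHead v
    head-sound m′ u v u< v< fr u≡ v≡ _ nz = u , u< , toℕᵇ≢0 (λ z → nz (trans (head-eval m′ u v u< v< fr u≡ v≡) z))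

    head-complete : ∀ m′ u v → u < n → v < n → Unchanged (11 ∷ 12 ∷ 18 ∷ []) [] m₁ m′ → nat m′ 11 0 ≡ u → nat m′ 12 0 ≡ v →
      (∀ k → nat m₁ 18 k ≢ 0 → nat m′ 18 k ≢ 0) → headℕ u v ≡ true → evalᴺ headᴱ m′ ≢ 0
    head-complete m′ u v u< v< fr u≡ v≡ _ h z = true⇒≢0 h (trans (sym (head-eval m′ u v u< v< fr u≡ v≡)) z)

    IsHeadℕ : ℕ → ℕ → Set
    IsHeadℕ u v = headℕ u v ≡ true

    open Sweep n headᴱ m₁ (nodes≡ ctx₁) HasHead IsHeadℕ head-start head-sound head-complete
      using () renaming (swept to headsSwept; module Swept to HeadsSwept)

    marked-heads : ∀ v → lookup (marked (nat m₂ 18)) v ≡ lookup (heads l) v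
    marked-heads = ⊑-antisym (marked (nat m₂ 18)) (heads l) ⇒ ⇐
      where
      ⇒ : marked (nat m₂ 18) ⊑ heads l
      ⇒ v e with HeadsSwept.only headsSwept (toℕ v) (Finₚ.toℕ<n v) (marked⇒ (nat m₂ 18) v e)
      ... | u , u< , h = heads⇐ l v (fromℕ< u<)
            (trans (cong₂ (λ k b → randomArc k (toℕ v) ∧ (β (k * n + toℕ v) ∧ b)) (Finₚ.toℕ-fromℕ< u<)
               (trans (live≡ l (fromℕ< u<) v) (cong (λ k → liveℕ k (toℕ v)) (Finₚ.toℕ-fromℕ< u<)))) h)
      ⇐ : heads l ⊑ marked (nat m₂ 18)
      ⇐ v e with heads⇒ l v e
      ... | u , h = marked⇐ (nat m₂ 18) v (HeadsSwept.reaches headsSwept (toℕ u) (toℕ v) (Finₚ.toℕ<n u) (Finₚ.toℕ<n v) (inj₁ (Finₚ.toℕ<n u))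
            (trans (cong (λ b → randomArc (toℕ u) (toℕ v) ∧ (β (index u v) ∧ b)) (sym (live≡ l u v))) h))

    fr₂ : Unchanged (11 ∷ 12 ∷ 18 ∷ []) [] m₁ m₂
    fr₂ = frame (sweepCode headᴱ) m₁

    -- The marks stay inside every closed set that contains the heads, and they grow until they are
    -- closed. After n sweeps this determines them by `isClosure-unique`, whatever a single sweep
    -- marks beyond one round of spreading.
    record Growing (t : ℕ) (z : ℕ → ℕ) : Set where
      field
        seeds  : heads l ⊑ marked z
        least  : ∀ Z → heads l ⊑ Z → Closed (live l) Z → marked z ⊑ Z
        growth : Growth (live l) t (marked z)
    open Growing

    growing : Growing n (nat m₃ 18)
    growing = for-rule (λ t m → Growing t (nat m 18)) 13 #nodes (sweepCode spreadᴱ) m₂ refl (nodes≡ (context-unchanged refl refl fr₂ ctx₁))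
      (record { seeds = λ v e → trans (marked-heads v) e
              ; least = λ Z h _ v e → h v (trans (sym (marked-heads v)) e)
              ; growth = inj₂ z≤n })
      λ t m′ _ _ fr inv → round t m′ fr inv
      where
      round : ∀ t m′ → Unchanged (13 ∷ 11 ∷ 12 ∷ 18 ∷ []) [] m₂ m′ → Growing t (nat m′ 18) → Growing (suc t) (nat (exec (sweepCode spreadᴱ) m′) 18)
      round t m′ fr inv = record
        { seeds = λ v e → up v (seeds inv v e)
        ; least = λ Z h cl v e → Swept.only swept (toℕ v) (Finₚ.toℕ<n v) (marked⇒ (nat m″ 18) v e) Z h cl v refl
        ; growth = growth-step (live l) (marked (nat m′ 18)) (marked (nat m″ 18)) (growth inv) up onward
            (λ cl v e → Swept.only swept (toℕ v) (Finₚ.toℕ<n v) (marked⇒ (nat m″ 18) v e) (marked (nat m′ 18)) (seeds inv) cl v refl) }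
        where
        m″ = exec (sweepCode spreadᴱ) m′
        spread-eval : ∀ m₄ u v → u < n → v < n → Unchanged (11 ∷ 12 ∷ 18 ∷ []) [] m′ m₄ → nat m₄ 11 0 ≡ u → nat m₄ 12 0 ≡ v →
          evalᴺ spreadᴱ m₄ ≡ nat m₄ 18 u * toℕᵇ (liveℕ u v)
        spread-eval m₄ u v u< v< fr′ u≡ v≡ = cong₂ _*_ (cong (nat m₄ 18) u≡)
          (trans (natᶠ all 15 refl _) (trans (cong (nat m 15) (cell-eval m₄ u v (context-unchanged refl refl all ctx) u≡ v≡)) (live≡ⱼ _ (cell< u v u< v<))))
          where
          all : Unchanged (13 ∷ 11 ∷ 12 ∷ 18 ∷ []) [] m m₄
          all = unchanged-trans (unchanged-∷ 13 (unchanged-∷ 11 (frame clearCode m)))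
                  (unchanged-trans (unchanged-∷ 13 fr₂) (unchanged-trans fr (unchanged-∷ 13 fr′)))
        InEvery : ℕ → Set
        InEvery k = ∀ Z → heads l ⊑ Z → Closed (live l) Z → ∀ v → toℕ v ≡ k → lookup Z v ≡ true
        SpreadsTo : ℕ → ℕ → Set
        SpreadsTo u v = nat m′ 18 u ≢ 0 × liveℕ u v ≡ true
        start : ∀ k → k < n → nat m′ 18 k ≢ 0 → InEvery k
        start k k< nz Z h cl v e = least inv Z h cl v (marked⇐ (nat m′ 18) v (λ z → nz (trans (cong (nat m′ 18) (sym e)) z)))
        sound : ∀ m₄ u v → u < n → v < n → Unchanged (11 ∷ 12 ∷ 18 ∷ []) [] m′ m₄ → nat m₄ 11 0 ≡ u → nat m₄ 12 0 ≡ v →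
          (∀ k → k < n → nat m₄ 18 k ≢ 0 → InEvery k) → evalᴺ spreadᴱ m₄ ≢ 0 → InEvery v
        sound m₄ u v u< v< fr′ u≡ v≡ only nz Z h cl w w≡ =
          cl (fromℕ< u<) w (only u u< (proj₁ both) Z h cl (fromℕ< u<) (Finₚ.toℕ-fromℕ< u<))
            (trans (live≡ l (fromℕ< u<) w) (trans (cong₂ liveℕ (Finₚ.toℕ-fromℕ< u<) w≡) (toℕᵇ≢0 (proj₂ both))))
          where
          both : nat m₄ 18 u ≢ 0 × toℕᵇ (liveℕ u v) ≢ 0
          both = *≢0⇒ _ _ (λ z → nz (trans (spread-eval m₄ u v u< v< fr′ u≡ v≡) z))
        complete : ∀ m₄ u v → u < n → v < n → Unchanged (11 ∷ 12 ∷ 18 ∷ []) [] m′ m₄ → nat m₄ 11 0 ≡ u → nat m₄ 12 0 ≡ v →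
          (∀ k → nat m′ 18 k ≢ 0 → nat m₄ 18 k ≢ 0) → SpreadsTo u v → evalᴺ spreadᴱ m₄ ≢ 0
        complete m₄ u v u< v< fr′ u≡ v≡ keeps (zu , lu) z =
          *≢0 (keeps u zu) (true⇒≢0 lu) (trans (sym (spread-eval m₄ u v u< v< fr′ u≡ v≡)) z)
        nodes′ : nat m′ 2 0 ≡ n
        nodes′ = trans (natᶠ fr 2 refl 0) (nodes≡ (context-unchanged refl refl fr₂ ctx₁))
        open Sweep n spreadᴱ m′ nodes′ InEvery SpreadsTo start sound complete using (swept; module Swept)
        up : marked (nat m′ 18) ⊑ marked (nat m″ 18)
        up v e = marked⇐ (nat m″ 18) v (Swept.keeps swept (toℕ v) (marked⇒ (nat m′ 18) v e))
        onward : ∀ u v → lookup (marked (nat m′ 18)) u ≡ true → live l u v ≡ true → lookup (marked (nat m″ 18)) v ≡ true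
        onward u v e le = marked⇐ (nat m″ 18) v (Swept.reaches swept (toℕ u) (toℕ v) (Finₚ.toℕ<n u) (Finₚ.toℕ<n v) (inj₁ (Finₚ.toℕ<n u))
          (marked⇒ (nat m′ 18) u e , trans (sym (live≡ l u v)) le))

    reach-correct : ∀ v → nonzero (nat (exec reachCode m) 18 (toℕ v)) ≡ lookup (reached l) v
    reach-correct v = trans (sym (marked≡ (nat m₃ 18) v)) (isClosure-unique (live l) {Z = marked (nat m₃ 18)} {Z′ = reached l}
      (record { contains = seeds growing ; closed = growth-full (live l) (marked (nat m₃ 18)) (growth growing) ; least = least growing })
      (activated-isClosure l (heads l)) v)

  module Add (m₄ : Memory) (ctx₄ : Context m₄) where

    summand : ℕ → ℚ
    summand k = if nonzero (nat m₄ 18 k) then rat m₄ 3 0 else 0ℚ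
    Added : ℕ → Memory → Set
    Added k m₅ = ∀ j → rat m₅ 4 j ≡ rat m₄ 4 j ℚ.+ (if j <ᵇ k then summand j else 0ℚ)
    addStep-correct : ∀ k m₅ → nat m₅ 12 0 ≡ k → Unchanged (12 ∷ []) (4 ∷ []) m₄ m₅ → Added k m₅ → Added (suc k) (setᴺ 12 0 (suc k) (exec addStep m₅))
    addStep-correct k m₅ k≡ fr₅ inv₅ = branch-nonzero (λ m₆ → Added (suc k) (setᴺ 12 0 (suc k) m₆)) (18 [ varᴺ 12 ]) addMember done m₅
      (λ nz j → hit′ j (λ z → nz (trans (natᶠ fr₅ 18 refl _) (trans (cong (nat m₄ 18) k≡) z))))
      (λ z j → miss j (trans (sym (cong (nat m₄ 18) k≡)) (trans (sym (natᶠ fr₅ 18 refl _)) z)))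
      where
      later : ∀ j → j ≢ k → (j <ᵇ k) ≡ (j <ᵇ suc k)
      later j j≢k with j <? k
      ... | yes j<k = trans (T⇒≡ (<⇒<ᵇ j<k)) (sym (T⇒≡ (<⇒<ᵇ (m<n⇒m<1+n j<k))))
      ... | no j≮k  = trans (¬T⇒≡ (λ t → j≮k (<ᵇ⇒< j k t))) (sym (¬T⇒≡ (λ t → j≮k (≤∧≢⇒< (s≤s⁻¹ (<ᵇ⇒< j (suc k) t)) j≢k))))
      now : ∀ (x : ℚ) → (if k <ᵇ suc k then x else 0ℚ) ≡ x
      now x = cong (if_then x else 0ℚ) (T⇒≡ (<⇒<ᵇ (n<1+n k)))
      notyet : ∀ (x : ℚ) → (if k <ᵇ k then x else 0ℚ) ≡ 0ℚ
      notyet x = cong (if_then x else 0ℚ) (¬T⇒≡ (λ t → <-irrefl refl (<ᵇ⇒< k k t)))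
      hit′ : ∀ j → nat m₄ 18 k ≢ 0 → (if nat m₅ 12 0 ≡ᵇ j then rat m₅ 4 (nat m₅ 12 0) ℚ.+ rat m₅ 3 0 else rat m₅ 4 j)
        ≡ rat m₄ 4 j ℚ.+ (if j <ᵇ suc k then summand j else 0ℚ)
      hit′ j nz with nat m₅ 12 0 ≟ j
      ... | yes q with trans (sym q) k≡
      ...   | refl = trans (write-same q) (cong₂ ℚ._+_
               (trans (cong (rat m₅ 4) q) (trans (inv₅ j) (trans (cong (rat m₄ 4 j ℚ.+_) (notyet (summand j))) (ℚₚ.+-identityʳ (rat m₄ 4 j)))))
               (trans (ratᶠ fr₅ 3 refl 0) (sym (trans (now (summand j)) (cong (if_then rat m₄ 3 0 else 0ℚ) (nonzero⇐ nz))))))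
      hit′ j nz | no q = trans (write-other q) (trans (inv₅ j) (cong (λ b → rat m₄ 4 j ℚ.+ (if b then summand j else 0ℚ)) (later j (λ j≡k → q (trans k≡ (sym j≡k))))))
      miss : ∀ j → nat m₄ 18 k ≡ 0 → rat m₅ 4 j ≡ rat m₄ 4 j ℚ.+ (if j <ᵇ suc k then summand j else 0ℚ)
      miss j z with j ≟ k
      ... | yes refl = trans (inv₅ j) (cong (rat m₄ 4 j ℚ.+_) (trans (notyet (summand j)) (sym (trans (now (summand j)) (cong (λ x → if nonzero x then rat m₄ 3 0 else 0ℚ) z)))))
      ... | no j≢k = trans (inv₅ j) (cong (λ b → rat m₄ 4 j ℚ.+ (if b then summand j else 0ℚ)) (later j j≢k))
    added : ∀ (v : Fin n) → rat (exec addCode m₄) 4 (toℕ v) ≡ rat m₄ 4 (toℕ v) ℚ.+ summand (toℕ v)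
    added v = trans (for-rule Added 12 #nodes addStep m₄ refl (nodes≡ ctx₄) (λ j → sym (ℚₚ.+-identityʳ (rat m₄ 4 j)))
        (λ k m₅ _ k≡ fr₅ inv₅ → addStep-correct k m₅ k≡ fr₅ inv₅) (toℕ v))
      (cong (λ b → rat m₄ 4 (toℕ v) ℚ.+ (if b then summand (toℕ v) else 0ℚ)) (T⇒≡ (<⇒<ᵇ (Finₚ.toℕ<n v))))

  module ReachProb (β : ℕ → Bool) (m : Memory) (ctx : Context m) (guess≡ : ∀ j → j < n * n → nat m 14 j ≡ toℕᵇ (β j)) where

    open Guess β

    partialMean : ℕ → Fin n → ℚ
    partialMean l v = sumTo l (λ l → prob ws l ℚ.* ι (lookup (reached l) v))

    reachProb-correct : ∀ v → rat (exec reachProbCode m) 4 (toℕ v) ≡ reachProb v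
    reachProb-correct = for-rule (λ l m → ∀ v → rat m 4 (toℕ v) ≡ partialMean l v) 10 #masks outcomeStep m₁ refl
      (masks≡ (context-unchanged refl refl (frame zeroCode m) ctx))
      (λ v → zeroed (toℕ v) (Finₚ.toℕ<n v))
      λ l m′ _ l≡ fr inv → outcome l m′ l≡ fr inv
      where
      m₁ = exec zeroCode m
      zeroed : ∀ k → k < n → rat m₁ 4 k ≡ 0ℚ
      zeroed = for-rule (λ k m → ∀ j → j < k → rat m 4 j ≡ 0ℚ) 12 #nodes zeroStep m refl (nodes≡ ctx) (λ _ ())
        λ k m′ _ k≡ _ inv j j< → step′ k m′ k≡ inv j j<
        where
        step′ : ∀ k m′ → nat m′ 12 0 ≡ k → (∀ j → j < k → rat m′ 4 j ≡ 0ℚ) → ∀ j → j < suc k → (if nat m′ 12 0 ≡ᵇ j then 0ℚ else rat m′ 4 j) ≡ 0ℚ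
        step′ k m′ k≡ inv j j< with nat m′ 12 0 ≟ j
        ... | yes q = write-same q
        ... | no q  = trans (write-other q) (inv j (≤∧≢⇒< (s≤s⁻¹ j<) (λ j≡k → q (trans k≡ (sym j≡k)))))
      outcome : ∀ l m′ → nat m′ 10 0 ≡ l → Unchanged (10 ∷ writesᴺ outcomeStep) (writesᴿ outcomeStep) m₁ m′ →
        (∀ v → rat m′ 4 (toℕ v) ≡ partialMean l v) → ∀ v → rat (exec outcomeStep m′) 4 (toℕ v) ≡ partialMean (suc l) v
      outcome l m′ l≡ fr inv v = trans (Add.added m₄ ctx₄ v) (cong₂ ℚ._+_ (trans q₄ (inv v))
          (trans (cong₂ (λ π b → if b then π else 0ℚ) π₄ (Reach.reach-correct β l m₃ ctx₃ guess₃ (λ j j< → proj₁ decoded j (subst (j <_) (sym (length-weights G)) j<)) v)) (scale (lookup (reached l) v))))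
        where
        m₂ = setᴺ 16 0 (nat m′ 10 0) m′
        m₃ = exec decodeCode m₂
        m₄ = exec reachCode m₃
        ctx′ : Context m′
        ctx′ = context-unchanged refl refl fr (context-unchanged refl refl (frame zeroCode m) ctx)
        ctx₂ : Context m₂
        ctx₂ = context-unchanged refl refl (unchanged-setᴺ 16 [] [] 0 (nat m′ 10 0) m′) ctx′
        ctx₃ : Context m₃
        ctx₃ = context-unchanged refl refl (frame decodeCode m₂) ctx₂
        ctx₄ : Context m₄
        ctx₄ = context-unchanged refl refl (frame reachCode m₃) ctx₃
        guess₃ : ∀ j → j < n * n → nat m₃ 14 j ≡ toℕᵇ (β j)
        guess₃ j j< = trans (natᶠ (frame decodeCode m₂) 14 refl j) (trans (natᶠ fr 14 refl j) (trans (natᶠ (frame zeroCode m) 14 refl j) (guess≡ j j<)))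
        decoded = Decoding.decode-correct ws m₂ (weights≡ ctx₂) (trans (cells≡ ctx₂) (sym (length-weights G))) (count≡ ctx₂) (powers≡ ctx₂) l l≡
        π₄ : rat m₄ 3 0 ≡ prob ws l
        π₄ = trans (ratᶠ (frame reachCode m₃) 3 refl 0) (proj₂ decoded)
        q₄ : rat m₄ 4 (toℕ v) ≡ rat m′ 4 (toℕ v)
        q₄ = trans (ratᶠ (frame reachCode m₃) 4 refl _) (ratᶠ (frame decodeCode m₂) 4 refl _)
        scale : ∀ b → (if b then prob ws l else 0ℚ) ≡ prob ws l ℚ.* ι b
        scale true  = sym (ℚₚ.*-identityʳ _)
        scale false = sym (ℚₚ.*-zeroʳ (prob ws l))

-- Push-relabel and its set-up on the machine

insideTarget outsideTarget chosen unchosen setupRandom setupCell setupNode setupCode : Code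
insideTarget = 5 ⟦ varᴺ 11 ⟧≔ᴿ lit 1ℚ ⊖ 4 [ varᴺ 11 ] ▹ 7 ⟦ lit 0 ⟧≔ᴿ varᴿ 7 ⊕ (lit 1ℚ ⊖ 4 [ varᴺ 11 ])
outsideTarget = 5 ⟦ varᴺ 11 ⟧≔ᴿ 4 [ varᴺ 11 ] ⊖ lit 1ℚ ▹ 7 ⟦ lit 0 ⟧≔ᴿ varᴿ 7 ⊕ 4 [ varᴺ 11 ]
chosen = 5 ⟦ varᴺ 11 ⟧≔ᴿ 5 [ varᴺ 11 ] ⊕ varᴿ 2 ▹ 7 ⟦ lit 0 ⟧≔ᴿ varᴿ 7 ⊕ varᴿ 2
unchosen = 5 ⟦ varᴺ 11 ⟧≔ᴿ 5 [ varᴺ 11 ] ⊖ varᴿ 2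
setupRandom = branch (14 [ cellᵘᵛ ]) chosen unchosen
setupCell = 6 ⟦ cellᵘᵛ ⟧≔ᴿ lit 0ℚ ▹ branch (randomᴱ cellᵘᵛ) setupRandom done
setupNode = 19 ⟦ varᴺ 11 ⟧≔ᴺ lit 0 ▹ branch (1 [ varᴺ 11 ]) insideTarget outsideTarget ▹ for 12 #nodes setupCell
setupCode = 7 ⟦ lit 0 ⟧≔ᴿ lit 0ℚ ▹ for 11 #nodes setupNode

-- Equality of a with b + 1 is tested by truncated subtraction: a ∸ (b + 1) and (b + 1) ∸ a are both
-- 0 only then.
admissibleᴱ : NatExp
admissibleᴱ = positiveᴱ (5 [ varᴺ 11 ]) ⊗
  (lit 1 ⊖ ((19 [ varᴺ 11 ] ⊖ (19 [ varᴺ 12 ] ⊕ lit 1)) ⊕ ((19 [ varᴺ 12 ] ⊕ lit 1) ⊖ 19 [ varᴺ 11 ])))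

-- A certain arc has unlimited capacity and takes the whole excess of u. Otherwise flow from v to u
-- is taken back, as far as there is any. A node is raised only if it still has excess after its
-- whole row has been inspected.
forward amountExcess amountFlow backward pushAmount move push pushStep raise relabelStep pushRow treatNode nodeStep roundCode flowCode : Code
forward = 8 ⟦ lit 0 ⟧≔ᴿ 5 [ varᴺ 11 ] ▹ 6 ⟦ cellᵘᵛ ⟧≔ᴿ 6 [ cellᵘᵛ ] ⊕ varᴿ 8
amountExcess = 8 ⟦ lit 0 ⟧≔ᴿ 5 [ varᴺ 11 ] ▹ 6 ⟦ cellᵛᵘ ⟧≔ᴿ 6 [ cellᵛᵘ ] ⊖ varᴿ 8
amountFlow = 8 ⟦ lit 0 ⟧≔ᴿ 6 [ cellᵛᵘ ] ▹ 6 ⟦ cellᵛᵘ ⟧≔ᴿ 6 [ cellᵛᵘ ] ⊖ varᴿ 8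
backward = branch (5 [ varᴺ 11 ] ≼ 6 [ cellᵛᵘ ]) amountExcess amountFlow
pushAmount = branch (certainᴱ cellᵘᵛ) forward backward
move = 5 ⟦ varᴺ 11 ⟧≔ᴿ 5 [ varᴺ 11 ] ⊖ varᴿ 8 ▹ 5 ⟦ varᴺ 12 ⟧≔ᴿ 5 [ varᴺ 12 ] ⊕ varᴿ 8
push = pushAmount ▹ move
pushStep = branch admissibleᴱ push done
pushRow = for 12 #nodes pushStep
raise = 19 ⟦ varᴺ 11 ⟧≔ᴺ 19 [ varᴺ 11 ] ⊕ lit 1
relabelStep = branch (positiveᴱ (5 [ varᴺ 11 ])) raise done
treatNode = pushRow ▹ relabelStep
-- The condition holds up to height n. Nodes that have reached n + 1 are given up: they push nothing
-- more, and nothing can be pushed to them.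
nodeStep = branch ((varᴺ 2 ⊕ lit 1) ⊖ 19 [ varᴺ 11 ]) treatNode done
roundCode = for 11 #nodes nodeStep
flowCode = for 13 #rounds roundCode

subtractExcess valueStep valueCode : Code
subtractExcess = 7 ⟦ lit 0 ⟧≔ᴿ varᴿ 7 ⊖ 5 [ varᴺ 12 ]
valueStep = branch (positiveᴱ (5 [ varᴺ 12 ])) subtractExcess done
valueCode = for 12 #nodes valueStep

eval-admissible : ∀ x a b → ((1 ∸ toℕᵇ (x ℚ.≤ᵇ 0ℚ)) * (1 ∸ ((a ∸ (b + 1)) + ((b + 1) ∸ a))) ≢ 0 → 0ℚ ℚ.< x × a ≡ suc b)
  × (0ℚ ℚ.< x → a ≡ suc b → (1 ∸ toℕᵇ (x ℚ.≤ᵇ 0ℚ)) * (1 ∸ ((a ∸ (b + 1)) + ((b + 1) ∸ a))) ≢ 0)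
eval-admissible x a b = to , from
  where
  gapᵃᵇ = (a ∸ (b + 1)) + ((b + 1) ∸ a)
  positive-bit : ∀ {t} → 1 ∸ toℕᵇ t ≢ 0 → t ≡ false
  positive-bit {true}  h = contradiction refl h
  positive-bit {false} h = refl
  eq : 1 ∸ gapᵃᵇ ≢ 0 → gapᵃᵇ ≡ 0
  eq h with gapᵃᵇ
  ... | zero  = refl
  ... | suc k = contradiction (0∸n≡0 k) h
  to : (1 ∸ toℕᵇ (x ℚ.≤ᵇ 0ℚ)) * (1 ∸ gapᵃᵇ) ≢ 0 → 0ℚ ℚ.< x × a ≡ suc b
  to h = ≤ᵇ≡false x 0ℚ (positive-bit (proj₁ both)) ,
         trans (≤-antisym (m∸n≡0⇒m≤n (m+n≡0⇒m≡0 _ (eq (proj₂ both)))) (m∸n≡0⇒m≤n (m+n≡0⇒n≡0 (a ∸ (b + 1)) (eq (proj₂ both))))) (+-comm b 1)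
    where both = *≢0⇒ ((1 ∸ toℕᵇ (x ℚ.≤ᵇ 0ℚ))) (1 ∸ gapᵃᵇ) h
  from : 0ℚ ℚ.< x → a ≡ suc b → (1 ∸ toℕᵇ (x ℚ.≤ᵇ 0ℚ)) * (1 ∸ gapᵃᵇ) ≢ 0
  from pos refl = *≢0 (λ z → contradiction (trans (sym (cong (λ t → 1 ∸ toℕᵇ t) (¬T⇒≡ (λ t → ℚₚ.<-irrefl refl (ℚₚ.<-≤-trans pos (ℚₚ.≤ᵇ⇒≤ t)))))) z) λ ())
    (λ z → contradiction (trans (sym (cong (1 ∸_) (cong₂ _+_ (trans (cong (suc b ∸_) (+-comm b 1)) (n∸n≡0 b)) (trans (cong (_∸ suc b) (+-comm b 1)) (n∸n≡0 b))))) z) λ ())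

not≤ᵇ0 : ∀ x → not (x ℚ.≤ᵇ 0ℚ) ≡ true → 0ℚ ℚ.< x
not≤ᵇ0 x e = ≤ᵇ≡false x 0ℚ (not-true e)

not≤ᵇ0-false : ∀ x → not (x ℚ.≤ᵇ 0ℚ) ≡ false → x ℚ.≤ 0ℚ
not≤ᵇ0-false x e = ≤ᵇ≡true x 0ℚ (trans (sym (Boolₚ.not-involutive _)) (cong not e))

module Flow {n : ℕ} (G : InfluenceGraph n) (A : Subset n) (c : ℚ) (b : ℕ → ℚ) where

  open Cost G A
  open Machine G A c
  open PushRelabel n arc b

  State : ℕ → ℕ → Memory → Set
  State r u m = Preflow (rat m 5) (nat m 19) (rat m 6) × Progress r u (rat m 5) (nat m 19)

  Scanning : ℕ → ℕ → ℕ → Memory → Set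
  Scanning r u j m = State r u m × Scanned (rat m 5) (nat m 19) (rat m 6) u j

  module PushStep (m : Memory) (ctx : Context m) (r : ℕ) where

    private
      u v : ℕ
      u = nat m 11 0
      v = nat m 12 0
      e = rat m 5
      d = nat m 19
      f = rat m 6
      uv vu : ℕ
      uv = u * nat m 2 0 + v
      vu = v * nat m 2 0 + u
      uv≡ : uv ≡ u * n + v
      uv≡ = cong (λ k → u * k + v) (nodes≡ ctx)
      vu≡ : vu ≡ v * n + u
      vu≡ = cong (λ k → v * k + u) (nodes≡ ctx)

    moved : ℚ → ℕ → ℚ
    moved δ j = if v ≡ᵇ j then (if u ≡ᵇ v then e u ℚ.- δ else e v) ℚ.+ δ else (if u ≡ᵇ j then e u ℚ.- δ else e j)

    moved-push : ∀ δ → u < n → v < n → d u ≡ suc (d v) → 0ℚ ℚ.≤ δ → δ ℚ.≤ e u → Push e (moved δ) d u v δ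
    moved-push δ u< v< down δ≥0 δ≤ = record
      { u< = u< ; v< = v< ; down = down ; δ≥0 = δ≥0 ; δ≤ = δ≤
      ; eᵘ = trans (write-other (≢-sym u≢v)) (write-same {i = u} refl)
      ; eᵛ = trans (write-same {i = v} refl) (cong (ℚ._+ δ) (write-other u≢v))
      ; others = λ k _ k≢u k≢v → trans (write-other (≢-sym k≢v)) (write-other (≢-sym k≢u)) }
      where
      u≢v : u ≢ v
      u≢v q = 1+n≢n (sym (trans (cong d (sym q)) down))

    -- What has been scanned stays scanned, because a push from u alters no height and opens no
    -- residual arc out of u. The pair of u and v is settled in one of three ways: u has lost all
    -- its excess; or there is no certain arc to v and the flow from v is used up; or the heights do
    -- not differ by one in the right direction.
    pushStep-correct : u < n → v < n → d u ≤ n → Scanning r u v m → Scanning r u (suc v) (exec pushStep m)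
    pushStep-correct u< v< d≤n ((F , pr) , scanned) = branch-nonzero (Scanning r u (suc v)) admissibleᴱ push done m
      (λ nz → let (pos , down) = proj₁ (eval-admissible (e u) (d u) (d v)) nz in
        branch-bool (λ m′ → Scanning r u (suc v) (exec move m′)) (certainᴱ cellᵘᵛ) forward backward m
          (isCertain (rat m 0 uv)) refl
          (λ a → let P = moved-push (e u) u< v< down (ℚₚ.<⇒≤ pos) ℚₚ.≤-refl in
             (push-forward P F (arc≡ a) (write-same-at (e u) uv≡) (λ k k≢ → write-other (λ q → k≢ (trans (sym q) uv≡)))
             , progress-push P pos d≤n ≤-refl pr)
             , λ pos′ → emptied P pos′)
          (λ a → branch-bool (λ m′ → Scanning r u (suc v) (exec move m′)) (5 [ varᴺ 11 ] ≼ 6 [ cellᵛᵘ ]) amountExcess amountFlow m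
             (e u ℚ.≤ᵇ f vu) refl
             (λ le → let P = moved-push (e u) u< v< down (ℚₚ.<⇒≤ pos) ℚₚ.≤-refl in
                (push-back P F (ℚₚ.≤-trans (≤ᵇ≡true (e u) (f vu) le) (ℚₚ.≤-reflexive (cong f vu≡))) (write-same-at (ℚ.- e u) vu≡)
                  (λ k k≢ → write-other (λ q → k≢ (trans (sym q) vu≡)))
                , progress-push P pos d≤n ≤-refl pr)
                , λ pos′ → emptied P pos′)
             (λ gt → let f≥ = subst (λ k → 0ℚ ℚ.≤ f k) (sym vu≡) (f≥0 F v u v< u<)
                         P = moved-push (f vu) u< v< down f≥ (ℚₚ.<⇒≤ (≤ᵇ≡false (e u) (f vu) gt)) in
                (push-back P F (ℚₚ.≤-reflexive (cong f vu≡)) (trans (write-same {i = vu} vu≡) (cong (λ k → f k ℚ.- f vu) vu≡))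
                  (λ k k≢ → write-other (λ q → k≢ (trans (sym q) vu≡)))
                , progress-push P pos d≤n ≤-refl pr)
                , λ _ → saturated a down (scanned pos))))
      (λ z → (F , pr) , λ pos → rejected (λ down → proj₂ (eval-admissible (e u) (d u) (d v)) pos down z) (scanned pos))
      where
      open Preflow
      arc≡ : isCertain (rat m 0 uv) ≡ true → arc u v ≡ true
      arc≡ a = trans (cong isCertain (trans (sym (cong wt uv≡)) (sym (weights≡ ctx uv)))) a
      write-same-at : ∀ {i j} x → i ≡ j → (if i ≡ᵇ j then f i ℚ.+ x else f j) ≡ f j ℚ.+ x
      write-same-at {i} x refl = write-same {i = i} refl
      emptied : ∀ {e′} {X : Set} → Push e e′ d u v (e u) → 0ℚ ℚ.< e′ u → X
      emptied P pos = contradiction (subst (0ℚ ℚ.<_) (trans (Push.eᵘ P) (ℚₚ.+-inverseʳ (e u))) pos) (ℚₚ.<-irrefl refl)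
      saturated : isCertain (rat m 0 uv) ≡ false → d u ≡ suc (d v) →
        (∀ k → k < v → arc u k ≡ true ⊎ 0ℚ ℚ.< f (k * n + u) → d u ≢ suc (d k)) →
        ∀ k → k < suc v → arc u k ≡ true ⊎ 0ℚ ℚ.< (if vu ≡ᵇ (k * n + u) then f vu ℚ.- f vu else f (k * n + u)) → d u ≢ suc (d k)
      saturated a down h k k< res with k ≟ v
      saturated a down h k k< (inj₁ a′) | yes refl = contradiction (trans (sym (trans (cong isCertain (trans (weights≡ ctx uv) (cong wt uv≡))) a′)) a) λ ()
      saturated a down h k k< (inj₂ pos) | yes refl = contradiction (subst (0ℚ ℚ.<_) (trans (write-same {i = vu} vu≡) (ℚₚ.+-inverseʳ (f vu))) pos) (ℚₚ.<-irrefl refl)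
      saturated a down h k k< (inj₁ a′) | no k≢v = h k (≤∧≢⇒< (s≤s⁻¹ k<) k≢v) (inj₁ a′)
      saturated a down h k k< (inj₂ pos) | no k≢v = h k (≤∧≢⇒< (s≤s⁻¹ k<) k≢v) (inj₂ (subst (0ℚ ℚ.<_)
        (write-other (λ q → k≢v (sym (proj₁ (index-injective v k u< u< (trans (sym vu≡) q)))))) pos))
      rejected : d u ≢ suc (d v) → (∀ k → k < v → arc u k ≡ true ⊎ 0ℚ ℚ.< f (k * n + u) → d u ≢ suc (d k)) →
        ∀ k → k < suc v → arc u k ≡ true ⊎ 0ℚ ℚ.< f (k * n + u) → d u ≢ suc (d k)
      rejected ne h k k< res with k ≟ v
      ... | yes refl = ne
      ... | no k≢v   = h k (≤∧≢⇒< (s≤s⁻¹ k<) k≢v) res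

  module NodeStep (m : Memory) (ctx : Context m) (r : ℕ) where

    private
      u : ℕ
      u = nat m 11 0

    pushRow-correct : u < n → nat m 19 u ≤ n → State r u m → Scanning r u n (exec pushRow m)
    pushRow-correct u< d≤n st = for-rule (Scanning r u) 12 #nodes pushStep m refl (nodes≡ ctx) (st , λ _ k ())
      λ { _ m′ k< refl fr inv → row-step m′ k< fr inv }
      where
      row-step : ∀ m′ → nat m′ 12 0 < n → Unchanged (12 ∷ []) (writesᴿ pushStep) m m′ → Scanning r u (nat m′ 12 0) m′ →
        Scanning r u (suc (nat m′ 12 0)) (exec pushStep m′)
      row-step m′ k< fr inv = subst (λ i → Scanning r i (suc (nat m′ 12 0)) (exec pushStep m′)) u≡
          (PushStep.pushStep-correct m′ (context-unchanged refl refl fr ctx) r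
            (subst (_< n) (sym u≡) u<) k< (subst (_≤ n) (sym (trans (natᶠ fr 19 refl _) (cong (nat m 19) u≡))) d≤n)
            (subst (λ i → Scanning r i (nat m′ 12 0) m′) (sym u≡) inv))
        where
        u≡ : nat m′ 11 0 ≡ u
        u≡ = natᶠ fr 11 refl 0

    relabel-correct : u < n → nat m 19 u ≤ n → Scanning r u n m → State r (suc u) (exec relabelStep m)
    relabel-correct u< d≤n ((F , pr) , scanned) = branch-bool (State r (suc u)) (positiveᴱ (5 [ varᴺ 11 ])) raise done m
      (not (rat m 5 u ℚ.≤ᵇ 0ℚ)) (eval-positive (5 [ varᴺ 11 ]) m)
      (λ t → let pos = not≤ᵇ0 (rat m 5 u) t in
        relabel F u< pos d≤n scanned at off , progress-relabel u< pos d≤n at off pr)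
      (λ t → F , progress-inactive (λ (pos , _) → ℚₚ.<-irrefl refl (ℚₚ.<-≤-trans pos (not≤ᵇ0-false (rat m 5 u) t))) pr)
      where
      at : (if u ≡ᵇ u then nat m 19 u + 1 else nat m 19 u) ≡ suc (nat m 19 u)
      at = trans (write-same {i = u} refl) (+-comm (nat m 19 u) 1)
      off : ∀ k → k < n → k ≢ u → (if u ≡ᵇ k then nat m 19 u + 1 else nat m 19 k) ≡ nat m 19 k
      off k _ k≢u = write-other (≢-sym k≢u)

  nodeStep-correct : ∀ m → Context m → ∀ r → nat m 11 0 < n → State r (nat m 11 0) m → State r (suc (nat m 11 0)) (exec nodeStep m)
  nodeStep-correct m ctx r u< st = branch-nonzero (State r (suc u)) ((varᴺ 2 ⊕ lit 1) ⊖ 19 [ varᴺ 11 ]) treatNode done m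
    (λ nz → treat (s≤s⁻¹ (≤-trans (m∸n≢0⇒n<m nz) (≤-reflexive (trans (cong (_+ 1) (nodes≡ ctx)) (+-comm n 1))))))
    (λ z → proj₁ st , progress-inactive (λ (_ , d≤n) → <-irrefl refl
       (≤-trans (s≤s d≤n) (≤-trans (≤-reflexive (sym (trans (cong (_+ 1) (nodes≡ ctx)) (+-comm n 1)))) (m∸n≡0⇒m≤n z)))) (proj₂ st))
    where
    u = nat m 11 0
    m₁ = exec pushRow m
    fr : Unchanged (writesᴺ pushRow) (writesᴿ pushRow) m m₁
    fr = frame pushRow m
    u≡ : nat m₁ 11 0 ≡ u
    u≡ = natᶠ fr 11 refl 0
    treat : nat m 19 u ≤ n → State r (suc u) (exec relabelStep m₁)
    treat d≤n = subst (λ i → State r (suc i) (exec relabelStep m₁)) u≡ (NodeStep.relabel-correct m₁ (context-unchanged refl refl fr ctx) r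
      (subst (_< n) (sym u≡) u<) (subst (_≤ n) (sym (trans (natᶠ fr 19 refl _) (cong (nat m 19) u≡))) d≤n)
      (subst (λ i → Scanning r i n m₁) (sym u≡) (NodeStep.pushRow-correct m ctx r u< d≤n st)))

  round-correct : ∀ m → Context m → ∀ r → State r 0 m → State (suc r) 0 (exec roundCode m)
  round-correct m ctx r st = proj₁ end , progress-round (proj₂ end)
    where
    end : State r n (exec roundCode m)
    end = for-rule (State r) 11 #nodes nodeStep m refl (nodes≡ ctx) st
      λ { _ m′ u< refl fr inv → nodeStep-correct m′ (context-unchanged refl refl fr ctx) r u< inv }

  flow-correct : ∀ m → Context m → (∀ v → v < n → rat m 5 v ≡ b v) → (∀ v → v < n → nat m 19 v ≡ 0) →
    (∀ u v → u < n → v < n → rat m 6 (u * n + v) ≡ 0ℚ) →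
    let m′ = exec flowCode m in Preflow (rat m′ 5) (nat m′ 19) (rat m′ 6) × (∀ v → v < n → ¬ Active (rat m′ 5) (nat m′ 19) v)
  flow-correct m ctx e≡ d≡ f≡ = proj₁ end , progress-end (proj₁ end) (proj₂ end)
    where
    end : State (2 * (suc n * suc n)) 0 (exec flowCode m)
    end = for-rule (λ r m → State r 0 m) 13 #rounds roundCode m refl (rounds≡ ctx)
      (initial-preflow e≡ d≡ f≡ , initial-progress d≡)
      λ r m′ _ _ fr inv → round-correct m′ (context-unchanged refl refl fr ctx) r inv

  value-correct : ∀ m → Context m → rat (exec valueCode m) 7 0 ≡ rat m 7 0 ℚ.- excess (rat m 5)
  value-correct m ctx = for-rule (λ k m′ → rat m′ 7 0 ≡ rat m 7 0 ℚ.- sumTo k (λ v → positivePart (rat m 5 v))) 12 #nodes valueStep m refl (nodes≡ ctx)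
    (sym (ℚₚ.+-identityʳ (rat m 7 0))) λ { _ m′ _ refl fr inv → value-step m′ fr inv }
    where
    value-step : ∀ m′ → Unchanged (12 ∷ []) (7 ∷ []) m m′ → let k = nat m′ 12 0 in
      rat m′ 7 0 ≡ rat m 7 0 ℚ.- sumTo k (λ v → positivePart (rat m 5 v)) →
      rat (exec valueStep m′) 7 0 ≡ rat m 7 0 ℚ.- sumTo (suc k) (λ v → positivePart (rat m 5 v))
    value-step m′ fr inv = branch-bool (λ m″ → rat m″ 7 0 ≡ rat m 7 0 ℚ.- (S ℚ.+ positivePart (rat m 5 k))) (positiveᴱ (5 [ varᴺ 12 ])) subtractExcess done m′
      (not (rat m′ 5 k ℚ.≤ᵇ 0ℚ)) (eval-positive (5 [ varᴺ 12 ]) m′)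
      (λ t → trans (cong₂ ℚ._-_ inv (sym (part t)))
        (solve 3 (λ a s x → (a :- s) :- x := a :- (s :+ x)) refl (rat m 7 0) S (positivePart (rat m 5 k))))
      (λ t → trans inv (cong (λ x → rat m 7 0 ℚ.- x) (trans (sym (ℚₚ.+-identityʳ S)) (cong (S ℚ.+_) (sym (none t))))))
      where
      k = nat m′ 12 0
      S = sumTo k (λ v → positivePart (rat m 5 v))
      e≡ : rat m′ 5 k ≡ rat m 5 k
      e≡ = ratᶠ fr 5 refl k
      part : not (rat m′ 5 k ℚ.≤ᵇ 0ℚ) ≡ true → positivePart (rat m 5 k) ≡ rat m′ 5 k
      part t = trans (cong positivePart (sym e≡)) (cong (if_then 0ℚ else rat m′ 5 k) (not-true t))
      none : not (rat m′ 5 k ℚ.≤ᵇ 0ℚ) ≡ false → positivePart (rat m 5 k) ≡ 0ℚ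
      none t = trans (cong positivePart (sym e≡)) (cong (if_then 0ℚ else rat m′ 5 k) (trans (sym (Boolₚ.not-involutive _)) (cong not t)))

-- The loop over the guesses

copyStep copyCode accept answerCode maskStep sizeStep sizeCode mainCode : Code
copyStep = 14 ⟦ varᴺ 8 ⟧≔ᴺ 15 [ varᴺ 8 ]
copyCode = for 8 #cells copyStep
accept = 0 ⟦ lit 0 ⟧≔ᴺ lit 1
answerCode = branch (varᴿ 7 ≼ varᴿ 1) accept done
maskStep = 16 ⟦ lit 0 ⟧≔ᴺ varᴺ 9 ▹ decodeCode ▹ copyCode ▹ reachProbCode ▹ setupCode ▹ flowCode ▹ valueCode ▹ answerCode
sizeStep = 2 ⟦ lit 0 ⟧≔ᴿ varᴿ 2 ⊕ lit 1ℚ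
sizeCode = for 11 #nodes sizeStep
-- The answer cell held n in the input; `preCode` has copied that value to scalar 2.
mainCode = 0 ⟦ lit 0 ⟧≔ᴺ lit 0 ▹ sizeCode ▹ for 9 #masks maskStep

+-extend : ∀ {x y t} b s → x ≡ b ℚ.+ s → y ≡ t → x ℚ.+ y ≡ b ℚ.+ (s ℚ.+ t)
+-extend b s refl refl = ℚₚ.+-assoc b s _

module Evaluation {n : ℕ} (G : InfluenceGraph n) (A : Subset n) (c : ℚ) where

  open Cost G A
  open Machine G A c

  module Setup (β : ℕ → Bool) (m₀ : Memory) (ctx₀ : Context m₀) (guess≡ : ∀ j → j < n * n → nat m₀ 14 j ≡ toℕᵇ (β j))
    (q≡ : ∀ v → rat m₀ 4 (toℕ v) ≡ Guess.reachProb β v) where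

    open Guess β
    open Bill (rat m₀ 4) q≡

    charge : ℚ → ℕ → ℕ → ℚ
    charge x u k = if randomArc u k then (if β′ u k then size else x) else 0ℚ

    -- The flow is cleared in the double loop that sets up the supplies, hence the lexicographic
    -- order on pairs.
    ZeroBefore : ℕ → ℕ → (ℕ → ℚ) → Set
    ZeroBefore u k f = ∀ v j → j < n → v < u ⊎ (v ≡ u × j < k) → f (v * n + j) ≡ 0ℚ

    record RowDone (e₁ : ℕ → ℚ) (t₁ : ℚ) (u k : ℕ) (e : ℕ → ℚ) (t : ℚ) (f : ℕ → ℚ) : Set where
      field
        elsewhere : ∀ v → v ≢ u → e v ≡ e₁ v
        here      : e u ≡ e₁ u ℚ.+ sumTo k (charge (ℚ.- size) u)
        sum       : t ≡ t₁ ℚ.+ sumTo k (charge 0ℚ u)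
        zeros     : ZeroBefore u k f
    open RowDone

    RowInv : Memory → ℕ → ℕ → Memory → Set
    RowInv m₁ u k m = RowDone (rat m₁ 5) (rat m₁ 7 0) u k (rat m 5) (rat m 7 0) (rat m 6)

    cell-correct : ∀ m₁ m → Context m → (∀ j → j < n * n → nat m 14 j ≡ toℕᵇ (β j)) → nat m 11 0 < n → nat m 12 0 < n →
      RowInv m₁ (nat m 11 0) (nat m 12 0) m → RowInv m₁ (nat m 11 0) (suc (nat m 12 0)) (exec setupCell m)
    cell-correct m₁ m ctx guess u< k< inv = branch-bool (RowInv m₁ u (suc k)) (randomᴱ cellᵘᵛ) setupRandom done m₂ (randomArc u k)
      (random-eval cellᵘᵛ m₂ ctx₂ _ (cell-eval m₂ u k ctx₂ refl refl))
      (λ r → branch-bool (RowInv m₁ u (suc k)) (14 [ cellᵘᵛ ]) chosen unchosen m₂ (β′ u k)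
        (trans (guess uk (subst (_< n * n) (sym uk≡) (cell< u k u< k<))) (cong (toℕᵇ ∘ β) uk≡))
        (λ b → record
          { elsewhere = λ v v≢u → trans (write-other (≢-sym v≢u)) (elsewhere inv v v≢u)
          ; here = trans (write-same {i = u} refl) (+-extend (rat m₁ 5 u) _ (here inv) (trans (size≡ ctx) (sym (charge≡ _ r b))))
          ; sum = +-extend (rat m₁ 7 0) _ (sum inv) (trans (size≡ ctx) (sym (charge≡ _ r b)))
          ; zeros = zeros′ })
        (λ b → record
          { elsewhere = λ v v≢u → trans (write-other (≢-sym v≢u)) (elsewhere inv v v≢u)
          ; here = trans (write-same {i = u} refl) (+-extend (rat m₁ 5 u) _ (here inv) (trans (cong (ℚ.-_) (size≡ ctx)) (sym (charge≡′ _ r b))))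
          ; sum = unchangedSum (rat m₁ 7 0) _ (charge≡′ _ r b) (sum inv)
          ; zeros = zeros′ }))
      (λ r → record
        { elsewhere = elsewhere inv
        ; here = unchangedSum (rat m₁ 5 u) _ (charge≡″ _ r) (here inv)
        ; sum = unchangedSum (rat m₁ 7 0) _ (charge≡″ _ r) (sum inv)
        ; zeros = zeros′ })
      where
      u = nat m 11 0
      k = nat m 12 0
      uk = u * nat m 2 0 + k
      m₂ = setᴿ 6 uk 0ℚ m
      uk≡ : uk ≡ u * n + k
      uk≡ = cong (λ i → u * i + k) (nodes≡ ctx)
      ctx₂ : Context m₂
      ctx₂ = context-unchanged refl refl (unchanged-setᴿ 6 [] uk 0ℚ m) ctx
      charge≡ : ∀ x → randomArc u k ≡ true → β′ u k ≡ true → charge x u k ≡ size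
      charge≡ x r b = cong₂ (λ a b → if a then (if b then size else x) else 0ℚ) r b
      charge≡′ : ∀ x → randomArc u k ≡ true → β′ u k ≡ false → charge x u k ≡ x
      charge≡′ x r b = cong₂ (λ a b → if a then (if b then size else x) else 0ℚ) r b
      charge≡″ : ∀ x → randomArc u k ≡ false → charge x u k ≡ 0ℚ
      charge≡″ x r = cong (if_then (if β′ u k then size else x) else 0ℚ) r
      unchangedSum : ∀ {x t} b s → t ≡ 0ℚ → x ≡ b ℚ.+ s → x ≡ b ℚ.+ (s ℚ.+ t)
      unchangedSum b s z e = trans e (cong (b ℚ.+_) (sym (trans (cong (s ℚ.+_) z) (ℚₚ.+-identityʳ s))))
      zeros′ : ZeroBefore u (suc k) (rat m₂ 6)
      zeros′ v j j< before with uk ≟ v * n + j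
      ... | yes q = write-same q
      ... | no q  = trans (write-other q) (zeros inv v j j< (earlier before))
        where
        earlier : v < u ⊎ (v ≡ u × j < suc k) → v < u ⊎ (v ≡ u × j < k)
        earlier (inj₁ v<) = inj₁ v<
        earlier (inj₂ (refl , j<′)) = inj₂ (refl , ≤∧≢⇒< (s≤s⁻¹ j<′) (λ { refl → q uk≡ }))

    record NodesDone (u : ℕ) (e : ℕ → ℚ) (d : ℕ → ℕ) (t : ℚ) (f : ℕ → ℚ) : Set where
      field
        e≡      : ∀ v → v < u → e v ≡ supply v
        d≡      : ∀ v → v < u → d v ≡ 0
        zeros₀  : ZeroBefore u 0 f
        t≡      : t ≡ sumTo u total
    open NodesDone

    NodesInv : ℕ → Memory → Set
    NodesInv u m = NodesDone u (rat m 5) (nat m 19) (rat m 7 0) (rat m 6)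

    node-correct : ∀ m → Context m → (∀ j → j < n * n → nat m 14 j ≡ toℕᵇ (β j)) → (∀ j → rat m 4 j ≡ rat m₀ 4 j) → nat m 11 0 < n →
      NodesInv (nat m 11 0) m → NodesInv (suc (nat m 11 0)) (exec setupNode m)
    node-correct m ctx guess q₀ u< inv = record
      { e≡ = excesses
      ; d≡ = heights
      ; zeros₀ = λ v j j< → λ where
          (inj₁ v<) → zeros row-done v j j< (shift v j j< v<)
          (inj₂ (_ , ()))
      ; t≡ = trans (sum row-done) (trans (cong (ℚ._+ sumTo n (charge 0ℚ u)) (proj₂ (proj₂ after)))
               (trans (ℚₚ.+-assoc (rat m 7 0) _ _) (cong (ℚ._+ total u) (t≡ inv)))) }
      where
      u = nat m 11 0
      m₁ = setᴺ 19 u 0 m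
      m₂ = exec (branch (1 [ varᴺ 11 ]) insideTarget outsideTarget) m₁
      m₃ = exec (for 12 #nodes setupCell) m₂
      fr₁ : Unchanged (19 ∷ []) (5 ∷ 7 ∷ 5 ∷ 7 ∷ []) m m₁
      fr₁ = unchanged-setᴺ 19 [] _ u 0 m
      fr₂ : Unchanged (19 ∷ []) (5 ∷ 7 ∷ 5 ∷ 7 ∷ []) m m₂
      fr₂ = unchanged-trans fr₁ (unchanged-∷ 19 (frame (branch (1 [ varᴺ 11 ]) insideTarget outsideTarget) m₁))
      ctx₂ : Context m₂
      ctx₂ = context-unchanged refl refl fr₂ ctx
      u₂ : nat m₂ 11 0 ≡ u
      u₂ = natᶠ fr₂ 11 refl 0
      base : ℚ
      base = cost-term u (rat m₀ 4 u) ℚ.- ι (not (target u))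
      After : Memory → Set
      After m′ = (∀ v → v ≢ u → rat m′ 5 v ≡ rat m 5 v) × rat m′ 5 u ≡ base × rat m′ 7 0 ≡ rat m 7 0 ℚ.+ cost-term u (rat m₀ 4 u)
      after : After m₂
      after = branch-bool After (1 [ varᴺ 11 ]) insideTarget outsideTarget m₁ (target u) (targets≡ ctx u)
        (λ t → (λ v v≢u → write-other (≢-sym v≢u))
             , trans (write-same {i = u} refl) (trans (cong (λ x → 1ℚ ℚ.- x) (q₀ u)) (trans (sym (ℚₚ.+-identityʳ _))
                 (cong (λ b → (if b then 1ℚ ℚ.- rat m₀ 4 u else rat m₀ 4 u) ℚ.- ι (not b)) (sym t))))
             , cong (rat m 7 0 ℚ.+_) (trans (cong (λ x → 1ℚ ℚ.- x) (q₀ u)) (cong (if_then 1ℚ ℚ.- rat m₀ 4 u else rat m₀ 4 u) (sym t))))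
        (λ t → (λ v v≢u → write-other (≢-sym v≢u))
             , trans (write-same {i = u} refl) (trans (cong (λ x → x ℚ.- 1ℚ) (q₀ u))
                 (cong (λ b → (if b then 1ℚ ℚ.- rat m₀ 4 u else rat m₀ 4 u) ℚ.- ι (not b)) (sym t)))
             , cong (rat m 7 0 ℚ.+_) (trans (q₀ u) (cong (if_then 1ℚ ℚ.- rat m₀ 4 u else rat m₀ 4 u) (sym t))))
      shift : ∀ v j → j < n → v < suc u → v < u ⊎ (v ≡ u × j < n)
      shift v j j< v< with v ≟ u
      ... | yes v≡u = inj₂ (v≡u , j<)
      ... | no v≢u  = inj₁ (≤∧≢⇒< (s≤s⁻¹ v<) v≢u)
      row-done : RowInv m₂ u n m₃
      row-done = for-rule (RowInv m₂ u) 12 #nodes setupCell m₂ refl (nodes≡ ctx₂)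
        (record
          { elsewhere = λ _ _ → refl
          ; here = sym (ℚₚ.+-identityʳ _)
          ; sum = sym (ℚₚ.+-identityʳ _)
          ; zeros = λ v j j< → λ where
              (inj₁ v<) → trans (ratᶠ fr₂ 6 refl _) (zeros₀ inv v j j< (inj₁ v<))
              (inj₂ (_ , ())) })
        λ { _ m′ k< refl fr inv′ → row-step m′ k< fr inv′ }
        where
        row-step : ∀ m′ → nat m′ 12 0 < n → Unchanged (12 ∷ []) (writesᴿ setupCell) m₂ m′ → RowInv m₂ u (nat m′ 12 0) m′ →
          RowInv m₂ u (suc (nat m′ 12 0)) (exec setupCell m′)
        row-step m′ k< fr inv′ = subst (λ i → RowInv m₂ i (suc (nat m′ 12 0)) (exec setupCell m′)) u′
          (cell-correct m₂ m′ (context-unchanged refl refl fr ctx₂)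
            (λ j j< → trans (natᶠ fr 14 refl j) (trans (natᶠ fr₂ 14 refl j) (guess j j<)))
            (subst (_< n) (sym u′) u<) k< (subst (λ i → RowInv m₂ i (nat m′ 12 0) m′) (sym u′) inv′))
          where
          u′ : nat m′ 11 0 ≡ u
          u′ = trans (natᶠ fr 11 refl 0) u₂
      excesses : ∀ v → v < suc u → rat m₃ 5 v ≡ supply v
      excesses v v< with v ≟ u
      ... | yes refl = trans (here row-done) (cong (ℚ._+ sumTo n (charge (ℚ.- size) u)) (proj₁ (proj₂ after)))
      ... | no v≢u   = trans (elsewhere row-done v v≢u) (trans (proj₁ after v v≢u) (e≡ inv v (≤∧≢⇒< (s≤s⁻¹ v<) v≢u)))
      heights : ∀ v → v < suc u → nat m₃ 19 v ≡ 0
      heights v v< = trans (natᶠ (frame (for 12 #nodes setupCell) m₂) 19 refl v)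
        (trans (natᶠ (frame (branch (1 [ varᴺ 11 ]) insideTarget outsideTarget) m₁) 19 refl v) (written v v<))
        where
        written : ∀ v → v < suc u → nat m₁ 19 v ≡ 0
        written v v< with u ≟ v
        ... | yes q = write-same q
        ... | no q  = trans (write-other q) (d≡ inv v (≤∧≢⇒< (s≤s⁻¹ v<) (≢-sym q)))

    setup-correct : NodesInv n (exec setupCode m₀)
    setup-correct = for-rule NodesInv 11 #nodes setupNode m₁ refl (nodes≡ ctx₀)
      (record { e≡ = λ _ () ; d≡ = λ _ () ; zeros₀ = λ { _ _ _ (inj₁ ()) ; _ _ _ (inj₂ (_ , ())) } ; t≡ = refl })
      λ { _ m′ u< refl fr inv → node-correct m′ (context-unchanged refl refl fr ctx₁) (λ j j< → trans (natᶠ fr 14 refl j) (guess≡ j j<))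
            (λ j → ratᶠ fr 4 refl j) u< inv }
      where
      m₁ = setᴿ 7 0 0ℚ m₀
      ctx₁ : Context m₁
      ctx₁ = context-unchanged refl refl (unchanged-setᴿ 7 [] 0 0ℚ m₀) ctx₀

    open PushRelabel n arc supply

    Optimal : ℚ → Set
    Optimal x = (∃ λ y → ClosedUnder y × bill y ≡ x) × (∀ y → ClosedUnder y → x ℚ.≤ bill y)

    -- Both halves of duality are used: by `cut` some closed set attains the value, by
    -- `closure≤excess` none has a smaller bill. The value is what scalar 7 holds in the end, since
    -- set-up accumulates `total` there and `valueCode` subtracts the positive excess.
    preflow-optimal : ∀ {e d f x} → Preflow e d f → (∀ v → v < n → ¬ Active e d v) → x ≡ sumTo n total ℚ.- excess e → Optimal x
    preflow-optimal {e} {x = x} F idle x≡ = attained (cut F idle) , λ y y-closed → ℚₚ.≤-trans (ℚₚ.≤-reflexive x≡)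
        (ℚₚ.≤-trans (ℚₚ.+-monoʳ-≤ (sumTo n total) (ℚₚ.neg-antimono-≤ (closure≤excess F y y-closed))) (ℚₚ.≤-reflexive (sym (bill≡ y))))
      where
      attained : (∃ λ y → ClosedUnder y × closure-weight y ≡ excess e) → ∃ λ y → ClosedUnder y × bill y ≡ x
      attained (y , y-closed , weight≡) = y , y-closed , trans (bill≡ y) (trans (cong (λ w → sumTo n total ℚ.- w) weight≡) (sym x≡))

    flow-optimal : ∀ m → Context m → NodesInv n m → Optimal (rat (exec valueCode (exec flowCode m)) 7 0)
    flow-optimal m ctx inv = preflow-optimal (proj₁ flow) (proj₂ flow)
        (trans (Flow.value-correct G A c supply (exec flowCode m) (context-unchanged refl refl (frame flowCode m) ctx))
          (cong (ℚ._- excess (rat (exec flowCode m) 5)) (trans (ratᶠ (frame flowCode m) 7 refl 0) (t≡ inv))))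
      where
      flow : Preflow (rat (exec flowCode m) 5) (nat (exec flowCode m) 19) (rat (exec flowCode m) 6)
        × (∀ v → v < n → ¬ Active (rat (exec flowCode m) 5) (nat (exec flowCode m) 19) v)
      flow = Flow.flow-correct G A c supply m ctx (e≡ inv) (d≡ inv) (λ u v u< v< → zeros₀ inv u v v< (inj₁ u<))

-- This holds by definition; it splits a composite program at a named place, so that the verdict can
-- be carried through one piece at a time.
sequence-rule : ∀ (P : Memory → Set) S S′ m → P (exec S′ (exec S m)) → P (exec (S ▹ S′) m)
sequence-rule P S S′ m h = h

module Judgement {n : ℕ} (G : InfluenceGraph n) (A : Subset n) (c : ℚ) where

  open Cost G A
  open Machine G A c
  open Evaluation G A c

  guess : ℕ → ℕ → Bool
  guess s = contents false (decode ws s)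

  Refuted : ℕ → Set
  Refuted s = ∃ λ q → Σ[ q≡ ∈ (∀ v → q (toℕ v) ≡ Guess.reachProb (guess s) v) ]
    (∀ y → PushRelabel.ClosedUnder n arc (λ _ → 0ℚ) y → ¬ Guess.Bill.bill (guess s) q q≡ y ℚ.≤ c)

  -- Within the loop the answer is never reset to 0, so an acceptance persists. Each refutation
  -- carries the probabilities it is based on, because the array that held them is overwritten for
  -- the next guess.
  Verdict : ℕ → Memory → Set
  Verdict s m = (nat m 0 0 ≡ 1 × Effectors G A ∞ c) ⊎ (nat m 0 0 ≡ 0 × (∀ s′ → s′ < s → Refuted s′))

  verdict-unchanged : ∀ {s m m′} → nat m′ 0 0 ≡ nat m 0 0 → Verdict s m → Verdict s m′
  verdict-unchanged e (inj₁ (a , E)) = inj₁ (trans e a , E)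
  verdict-unchanged e (inj₂ (a , r)) = inj₂ (trans e a , r)

  refute : ∀ s m → Refuted s → Verdict s m → Verdict (suc s) m
  refute s m refuted (inj₁ accepted) = inj₁ accepted
  refute s m refuted (inj₂ (a , all)) = inj₂ (a , each)
    where
    each : ∀ s′ → s′ < suc s → Refuted s′
    each s′ s′< with s′ ≟ s
    ... | yes refl = refuted
    ... | no s′≢s  = all s′ (≤∧≢⇒< (s≤s⁻¹ s′<) s′≢s)

  module _ (s : ℕ) (q : ℕ → ℚ) (q≡ : ∀ v → q (toℕ v) ≡ Guess.reachProb (guess s) v) where

    open Guess.Bill (guess s) q q≡

    answer-correct : ∀ m → rat m 1 0 ≡ c →
      (∃ λ y → PushRelabel.ClosedUnder n arc supply y × bill y ≡ rat m 7 0) →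
      (∀ y → PushRelabel.ClosedUnder n arc supply y → rat m 7 0 ℚ.≤ bill y) →
      Verdict s m → Verdict (suc s) (exec answerCode m)
    answer-correct m bound (y , y-closed , bill≡value) minimal verdict =
      branch-bool (Verdict (suc s)) (varᴿ 7 ≼ varᴿ 1) accept done m (rat m 7 0 ℚ.≤ᵇ rat m 1 0) refl
        (λ le → inj₁ (refl , bill-sound y y-closed c
           (ℚₚ.≤-trans (ℚₚ.≤-reflexive bill≡value) (ℚₚ.≤-trans (≤ᵇ≡true (rat m 7 0) (rat m 1 0) le) (ℚₚ.≤-reflexive bound)))))
        (λ gt → refute s m (q , q≡ , λ y y-closed bill≤c → ℚₚ.<-irrefl refl
           (ℚₚ.≤-<-trans bill≤c (ℚₚ.<-≤-trans (subst (ℚ._< rat m 7 0) bound (≤ᵇ≡false (rat m 7 0) (rat m 1 0) gt)) (minimal y y-closed)))) verdict)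

    Attained Minimal : ℚ → Set
    Attained x = ∃ λ y → PushRelabel.ClosedUnder n arc supply y × bill y ≡ x
    Minimal x = ∀ y → PushRelabel.ClosedUnder n arc supply y → x ℚ.≤ bill y

    judge-value : ∀ m → Context m → Attained (rat (exec valueCode m) 7 0) → Minimal (rat (exec valueCode m) 7 0) →
      Verdict s m → Verdict (suc s) (exec (valueCode ▹ answerCode) m)
    judge-value m ctx attained minimal verdict = sequence-rule (Verdict (suc s)) valueCode answerCode m
      (answer-correct (exec valueCode m) (bound≡ (context-unchanged refl refl (frame valueCode m) ctx)) attained minimal
        (verdict-unchanged {s} {m} {exec valueCode m} (natᶠ (frame valueCode m) 0 refl 0) verdict))

    judge-flow : ∀ m → Context m → Attained (rat (exec valueCode (exec flowCode m)) 7 0) → Minimal (rat (exec valueCode (exec flowCode m)) 7 0) →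
      Verdict s m → Verdict (suc s) (exec (flowCode ▹ valueCode ▹ answerCode) m)
    judge-flow m ctx attained minimal verdict = sequence-rule (Verdict (suc s)) flowCode (valueCode ▹ answerCode) m
      (judge-value (exec flowCode m) (context-unchanged refl refl (frame flowCode m) ctx) attained minimal
        (verdict-unchanged {s} {m} {exec flowCode m} (natᶠ (frame flowCode m) 0 refl 0) verdict))

  judge : ∀ s m → Context m → (∀ j → j < n * n → nat m 14 j ≡ toℕᵇ (guess s j)) → (∀ v → rat m 4 (toℕ v) ≡ Guess.reachProb (guess s) v) →
    Verdict s m → Verdict (suc s) (exec (setupCode ▹ flowCode ▹ valueCode ▹ answerCode) m)
  judge s m ctx guess≡ q≡ verdict = sequence-rule (Verdict (suc s)) setupCode (flowCode ▹ valueCode ▹ answerCode) m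
      (judge-flow s (rat m 4) q≡ (exec setupCode m) ctx₁ (proj₁ optimal) (proj₂ optimal)
        (verdict-unchanged {s} {m} {exec setupCode m} (natᶠ (frame setupCode m) 0 refl 0) verdict))
    where
    module S = Setup (guess s) m ctx guess≡ q≡
    ctx₁ : Context (exec setupCode m)
    ctx₁ = context-unchanged refl refl (frame setupCode m) ctx
    optimal = S.flow-optimal (exec setupCode m) ctx₁ S.setup-correct

  -- The guess needs an array of its own, since the outcomes decoded later overwrite array 15.
  copied : ∀ m → Context m → ∀ j → j < n * n → nat (exec copyCode m) 14 j ≡ nat m 15 j
  copied m ctx = for-rule (λ k m′ → ∀ j → j < k → nat m′ 14 j ≡ nat m 15 j) 8 #cells copyStep m refl (cells≡ ctx) (λ _ ())
    λ { _ m′ _ refl fr inv j j< → copy m′ fr inv j j< }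
    where
    copy : ∀ m′ → Unchanged (8 ∷ 14 ∷ []) [] m m′ → (∀ j → j < nat m′ 8 0 → nat m′ 14 j ≡ nat m 15 j) →
      ∀ j → j < suc (nat m′ 8 0) → (if nat m′ 8 0 ≡ᵇ j then nat m′ 15 (nat m′ 8 0) else nat m′ 14 j) ≡ nat m 15 j
    copy m′ fr inv j j< with nat m′ 8 0 ≟ j
    ... | yes q = trans (write-same q) (trans (natᶠ fr 15 refl _) (cong (nat m 15) q))
    ... | no q  = trans (write-other q) (inv j (≤∧≢⇒< (s≤s⁻¹ j<) (≢-sym q)))

  judge-guess : ∀ s m → Context m → (∀ j → j < n * n → nat m 14 j ≡ toℕᵇ (guess s j)) →
    Verdict s m → Verdict (suc s) (exec (reachProbCode ▹ setupCode ▹ flowCode ▹ valueCode ▹ answerCode) m)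
  judge-guess s m ctx guess≡ verdict = sequence-rule (Verdict (suc s)) reachProbCode (setupCode ▹ flowCode ▹ valueCode ▹ answerCode) m
    (judge s (exec reachProbCode m) (context-unchanged refl refl (frame reachProbCode m) ctx)
      (λ j j< → trans (natᶠ (frame reachProbCode m) 14 refl j) (guess≡ j j<))
      (ReachProb.reachProb-correct (guess s) m ctx guess≡)
      (verdict-unchanged {s} {m} {exec reachProbCode m} (natᶠ (frame reachProbCode m) 0 refl 0) verdict))

  judge-coins : ∀ s m → Context m → (∀ j → j < n * n → nat m 15 j ≡ toℕᵇ (guess s j)) →
    Verdict s m → Verdict (suc s) (exec (copyCode ▹ reachProbCode ▹ setupCode ▹ flowCode ▹ valueCode ▹ answerCode) m)
  judge-coins s m ctx coins≡ verdict = sequence-rule (Verdict (suc s)) copyCode (reachProbCode ▹ setupCode ▹ flowCode ▹ valueCode ▹ answerCode) m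
    (judge-guess s (exec copyCode m) (context-unchanged refl refl (frame copyCode m) ctx)
      (λ j j< → trans (copied m ctx j j<) (coins≡ j j<))
      (verdict-unchanged {s} {m} {exec copyCode m} (natᶠ (frame copyCode m) 0 refl 0) verdict))

  judge-mask : ∀ s m → nat m 16 0 ≡ s → Context m → Verdict s m →
    Verdict (suc s) (exec (decodeCode ▹ copyCode ▹ reachProbCode ▹ setupCode ▹ flowCode ▹ valueCode ▹ answerCode) m)
  judge-mask s m s≡ ctx verdict = sequence-rule (Verdict (suc s)) decodeCode (copyCode ▹ reachProbCode ▹ setupCode ▹ flowCode ▹ valueCode ▹ answerCode) m
    (judge-coins s (exec decodeCode m) (context-unchanged refl refl (frame decodeCode m) ctx)
      (λ j j< → proj₁ (Decoding.decode-correct ws m (weights≡ ctx) (trans (cells≡ ctx) (sym (length-weights G))) (count≡ ctx) (powers≡ ctx) s s≡)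
        j (subst (j <_) (sym (length-weights G)) j<))
      (verdict-unchanged {s} {m} {exec decodeCode m} (natᶠ (frame decodeCode m) 0 refl 0) verdict))

  mask-correct : ∀ m → Context m → Verdict (nat m 9 0) m → Verdict (suc (nat m 9 0)) (exec maskStep m)
  mask-correct m ctx verdict = sequence-rule (Verdict (suc s)) (16 ⟦ lit 0 ⟧≔ᴺ varᴺ 9)
      (decodeCode ▹ copyCode ▹ reachProbCode ▹ setupCode ▹ flowCode ▹ valueCode ▹ answerCode) m
      (judge-mask s (exec (16 ⟦ lit 0 ⟧≔ᴺ varᴺ 9) m) refl
        (context-unchanged refl refl (frame (16 ⟦ lit 0 ⟧≔ᴺ varᴺ 9) m) ctx)
        (verdict-unchanged {s} {m} {exec (16 ⟦ lit 0 ⟧≔ᴺ varᴺ 9) m} refl verdict))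
    where
    s = nat m 9 0

  verdict-answers : ∀ m → Verdict #masksℕ m → Answers (output m) (Effectors G A ∞ c)
  verdict-answers m (inj₁ accepted) = inj₁ accepted
  verdict-answers m (inj₂ (e , refuted)) = inj₂ (e , λ E →
    let (s , s< , found) = bill-complete c E
        (q , q≡ , none) = refuted s s<
        (y , y-closed , le) = found q q≡ in none y y-closed le)

  record Prepared (m : Memory) : Set where
    field
      nodesᵖ   : nat m 2 0 ≡ n
      cellsᵖ   : nat m 3 0 ≡ n * n
      roundsᵖ  : nat m 4 0 ≡ 2 * (suc n * suc n)
      masksᵖ   : nat m 5 0 ≡ #masksℕ
      countᵖ   : nat m 6 0 ≡ #random ws
      powersᵖ  : ∀ i → i ≤ #random ws → nat m 7 i ≡ 2 ^ i
      targetsᵖ : ∀ j → nat m 1 j ≡ toℕᵇ (target j)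
      weightsᵖ : ∀ j → rat m 0 j ≡ wt j
      boundᵖ   : rat m 1 0 ≡ c
      sizeᵖ    : rat m 2 0 ≡ 0ℚ
  open Prepared

  main-correct : ∀ m → Prepared m → Answers (output (exec mainCode m)) (Effectors G A ∞ c)
  main-correct m pm = verdict-answers (exec mainCode m) (for-rule Verdict 9 #masks maskStep m₂ refl (masks≡ ctx₂)
      (inj₂ (natᶠ fr₂ 0 refl 0 , λ _ ()))
      λ { _ m′ _ refl fr inv → mask-correct m′ (context-unchanged refl refl fr ctx₂) inv })
    where
    m₁ = setᴺ 0 0 0 m
    m₂ = exec sizeCode m₁
    fr₂ : Unchanged (writesᴺ sizeCode) (writesᴿ sizeCode) m₁ m₂
    fr₂ = frame sizeCode m₁
    ctx₂ : Context m₂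
    ctx₂ = record
      { nodes≡ = trans (natᶠ fr₂ 2 refl 0) (nodesᵖ pm)
      ; cells≡ = trans (natᶠ fr₂ 3 refl 0) (cellsᵖ pm)
      ; rounds≡ = trans (natᶠ fr₂ 4 refl 0) (roundsᵖ pm)
      ; masks≡ = trans (natᶠ fr₂ 5 refl 0) (masksᵖ pm)
      ; count≡ = trans (natᶠ fr₂ 6 refl 0) (countᵖ pm)
      ; powers≡ = λ i i≤ → trans (natᶠ fr₂ 7 refl i) (powersᵖ pm i i≤)
      ; targets≡ = λ j → trans (natᶠ fr₂ 1 refl j) (targetsᵖ pm j)
      ; weights≡ = λ j → trans (ratᶠ fr₂ 0 refl j) (weightsᵖ pm j)
      ; bound≡ = trans (ratᶠ fr₂ 1 refl 0) (boundᵖ pm)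
      ; size≡ = for-rule (λ k m → rat m 2 0 ≡ sumTo k (λ _ → 1ℚ)) 11 #nodes sizeStep m₁ refl (nodesᵖ pm) (sizeᵖ pm)
          (λ _ _ _ _ _ inv → cong (ℚ._+ 1ℚ) inv) }

-- The whole program and its running time

preCode powerCode wholeCode : Code
preCode = 2 ⟦ lit 0 ⟧≔ᴺ varᴺ 0 ▹ 3 ⟦ lit 0 ⟧≔ᴺ varᴺ 2 ⊗ varᴺ 2 ▹
          -- The number of rounds is the one required by `progress-end`; the 1 is 2 ^ 0, from which
          -- the doubling starts.
          4 ⟦ lit 0 ⟧≔ᴺ lit 2 ⊗ ((lit 1 ⊕ varᴺ 2) ⊗ (lit 1 ⊕ varᴺ 2)) ▹ 7 ⟦ lit 0 ⟧≔ᴺ lit 1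
powerCode = 5 ⟦ lit 0 ⟧≔ᴺ 7 [ varᴺ 6 ]
wholeCode = preCode ▹ countCode ▹ powerCode ▹ mainCode

preTime powerTime factor : ℕ
preTime = time preCode (λ _ → 0)
powerTime = time powerCode (λ _ → 0)
factor = preTime + (coeff countCode + (powerTime + coeff mainCode))

contents-toℕᵇ : ∀ bs j → contents 0 (List.map (λ b → if b then 1 else 0) bs) j ≡ toℕᵇ (contents false bs j)
contents-toℕᵇ []       j       = refl
contents-toℕᵇ (b ∷ bs) zero    = refl
contents-toℕᵇ (b ∷ bs) (suc j) = contents-toℕᵇ bs j

sum≤ : ∀ {t₁ t₂ t₃ t₄} a b c d X → t₁ ≤ a * X → t₂ ≤ b * X → t₃ ≤ c * X → t₄ ≤ d * X →
  t₁ + (t₂ + (t₃ + t₄)) ≤ (a + (b + (c + d))) * X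
sum≤ a b c d X p q r s = ≤-trans (+-mono-≤ p (+-mono-≤ q (+-mono-≤ r s))) (≤-reflexive (sym (distrib a b c d X)))
  where
  distrib : ∀ a b c d X → (a + (b + (c + d))) * X ≡ a * X + (b * X + (c * X + d * X))
  distrib = solve-∀

-- The factor 16 is 2 ^ 4 and pays for n + 1 ≤ 2 * n, which holds as soon as there is a node.
monomial≤ : ∀ n r → 1 ≤ n → suc n ^ 4 * (2 ^ r) ^ 2 ≤ 16 * (4 ^ r * n ^ 4)
monomial≤ n r 1≤n = begin
  suc n ^ 4 * (2 ^ r) ^ 2       ≤⟨ *-monoˡ-≤ ((2 ^ r) ^ 2) (^-monoˡ-≤ 4 (+-monoˡ-≤ n 1≤n)) ⟩
  (n + n) ^ 4 * (2 ^ r) ^ 2     ≡⟨ cong ((n + n) ^ 4 *_) (trans (^-*-assoc 2 r 2) (trans (cong (2 ^_) (*-comm r 2)) (sym (^-*-assoc 2 2 r)))) ⟩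
  (n + n) ^ 4 * 4 ^ r           ≡⟨ cong (_* 4 ^ r) (fourth n) ⟩
  16 * n ^ 4 * 4 ^ r            ≡⟨ trans (*-assoc 16 (n ^ 4) (4 ^ r)) (cong (16 *_) (*-comm (n ^ 4) (4 ^ r))) ⟩
  16 * (4 ^ r * n ^ 4)          ∎
  where
  open ≤-Reasoning
  fourth : ∀ n → (n + n) ^ 4 ≡ 16 * n ^ 4
  fourth n = lemma n
    where
    lemma : ∀ n → (n + n) * ((n + n) * ((n + n) * ((n + n) * 1))) ≡ 16 * (n * (n * (n * (n * 1))))
    lemma = solve-∀

*-≤-assoc : ∀ {t X} Y k j → t ≤ k * X → X ≤ j * Y → t ≤ k * j * Y
*-≤-assoc Y k j p q = ≤-trans p (≤-trans (*-monoʳ-≤ k q) (≤-reflexive (sym (*-assoc k j Y))))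

module Run {n : ℕ} (G : InfluenceGraph n) (A : Subset n) (c : ℚ) where

  open Cost G A
  open Evaluation G A c
  open Judgement G A c

  M : ℕ
  M = #masksℕ

  instance
    M≢0 : NonZero M
    M≢0 = m^n≢0 2 (#random ws)

  record Started (m : Memory) : Set where
    field
      nodesˢ   : nat m 2 0 ≡ n
      cellsˢ   : nat m 3 0 ≡ n * n
      roundsˢ  : nat m 4 0 ≡ 2 * (suc n * suc n)
      masksˢ   : nat m 5 0 ≡ 0
      countˢ   : nat m 6 0 ≡ 0
      powerˢ   : nat m 7 0 ≡ 1
      targetsˢ : ∀ j → nat m 1 j ≡ toℕᵇ (target j)
      weightsˢ : ∀ j → rat m 0 j ≡ wt j
      boundˢ   : rat m 1 0 ≡ c
      sizeˢ    : rat m 2 0 ≡ 0ℚ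
  open Started

  started : Started (exec preCode (input G A c))
  started = record
    { nodesˢ = refl ; cellsˢ = refl ; roundsˢ = refl ; masksˢ = refl ; countˢ = refl ; powerˢ = refl
    ; targetsˢ = contents-toℕᵇ (Vec.toList A) ; weightsˢ = λ j → refl ; boundˢ = refl ; sizeˢ = refl }

  prepared : ∀ m → Started m → Prepared (exec powerCode (exec countCode m))
  prepared m st = record
    { nodesᵖ   = trans (natᶠ fr 2 refl 0) (nodesˢ st)
    ; cellsᵖ   = trans (natᶠ fr 3 refl 0) (cellsˢ st)
    ; roundsᵖ  = trans (natᶠ fr 4 refl 0) (roundsˢ st)
    ; masksᵖ   = trans (proj₂ counted _ (≤-reflexive (proj₁ counted))) (cong (2 ^_) (proj₁ counted))
    ; countᵖ   = proj₁ counted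
    ; powersᵖ  = proj₂ counted
    ; targetsᵖ = λ j → trans (natᶠ fr 1 refl j) (targetsˢ st j)
    ; weightsᵖ = λ j → trans (ratᶠ fr 0 refl j) (weightsˢ st j)
    ; boundᵖ   = trans (ratᶠ fr 1 refl 0) (boundˢ st)
    ; sizeᵖ    = trans (ratᶠ fr 2 refl 0) (sizeˢ st) }
    where
    fr : Unchanged (writesᴺ countCode) (writesᴿ countCode) m (exec countCode m)
    fr = frame countCode m
    counted = Counting.count-correct ws m (weightsˢ st) (trans (cellsˢ st) (sym (length-weights G))) (countˢ st) (powerˢ st)

  -- For the masks an inequality is assumed because `countCode` runs before their number is stored,
  -- while the cell still holds 0.
  bounds≤ : ∀ m → nat m 2 0 ≡ n → nat m 3 0 ≡ n * n → nat m 4 0 ≡ 2 * (suc n * suc n) → nat m 5 0 ≤ M →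
    ∀ b → bounds m b ≤ boundCoeff b * (suc n ^ boundDegᴺ b * M ^ boundDegᴹ b)
  bounds≤ m e₂ e₃ e₄ e₅ #nodes = ≤-trans (≤-reflexive e₂) (≤-trans (n≤1+n n) (≤-reflexive (lemma (suc n))))
    where
    lemma : ∀ x → x ≡ 1 * (x * 1 * 1)
    lemma = solve-∀
  bounds≤ m e₂ e₃ e₄ e₅ #cells = ≤-trans (≤-reflexive e₃) (≤-trans (*-mono-≤ (n≤1+n n) (n≤1+n n)) (≤-reflexive (lemma (suc n))))
    where
    lemma : ∀ x → x * x ≡ 1 * (x * (x * 1) * 1)
    lemma = solve-∀
  bounds≤ m e₂ e₃ e₄ e₅ #rounds = ≤-trans (≤-reflexive e₄) (≤-reflexive (lemma (suc n)))
    where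
    lemma : ∀ x → 2 * (x * x) ≡ 2 * (x * (x * 1) * 1)
    lemma = solve-∀
  bounds≤ m e₂ e₃ e₄ e₅ #masks = ≤-trans e₅ (≤-reflexive (lemma M))
    where
    lemma : ∀ x → x ≡ 1 * (1 * (x * 1))
    lemma = solve-∀

  X : ℕ
  X = suc n ^ 4 * M ^ 2

  RunsWithin : Code → ℕ → Memory → Set
  RunsWithin S k m = Σ[ t ∈ ℕ ] (compile S , m ⇓ exec S m , t) × t ≤ k * X

  runs : ∀ S → wellFormed S ≡ true → constantBounds S ≡ true → degᴺ S ≤ 4 → degᴹ S ≤ 2 →
    ∀ m → (∀ b → bounds m b ≤ boundCoeff b * (suc n ^ boundDegᴺ b * M ^ boundDegᴹ b)) → RunsWithin S (coeff S) m
  runs S wf cb dᴺ dᴹ m bs = bounded (halts S (bounds m) m wf (bound-unwritten S cb) (λ _ → refl))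
    where
    bounded : Halts S (bounds m) m → RunsWithin S (coeff S) m
    bounded (t , r , t≤) = t , r , ≤-trans t≤ (time≤-deg (suc n) M (bounds m) bs S 4 2 dᴺ dᴹ)

  runs-whole : ∀ {k₁ k₂ k₃ k₄} S₁ S₂ S₃ S₄ m → RunsWithin S₁ k₁ m → RunsWithin S₂ k₂ (exec S₁ m) →
    RunsWithin S₃ k₃ (exec S₂ (exec S₁ m)) → RunsWithin S₄ k₄ (exec S₃ (exec S₂ (exec S₁ m))) →
    RunsWithin (S₁ ▹ S₂ ▹ S₃ ▹ S₄) (k₁ + (k₂ + (k₃ + k₄))) m
  runs-whole {k₁} {k₂} {k₃} {k₄} S₁ S₂ S₃ S₄ m (_ , r₁ , b₁) (_ , r₂ , b₂) (_ , r₃ , b₃) (_ , r₄ , b₄) =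
    _ , seq r₁ (seq r₂ (seq r₃ r₄)) , sum≤ k₁ k₂ k₃ k₄ X b₁ b₂ b₃ b₄

  -- Both degrees are attained: the loop over outcomes inside the loop over guesses gives the
  -- exponent 2 of `M`, and the rounds of push-relabel, quadratically many with quadratically many
  -- pairs each, give the exponent 4 of n + 1.
  runs-main : ∀ m → Prepared m → RunsWithin mainCode (coeff mainCode) m
  runs-main m pm = runs mainCode refl refl ≤-refl ≤-refl m
    (bounds≤ m (Prepared.nodesᵖ pm) (Prepared.cellsᵖ pm) (Prepared.roundsᵖ pm) (≤-reflexive (Prepared.masksᵖ pm)))

  runs-count : ∀ m → Started m → RunsWithin countCode (coeff countCode) m
  runs-count m st = runs countCode refl refl (s≤s (s≤s z≤n)) z≤n m
    (bounds≤ m (nodesˢ st) (cellsˢ st) (roundsˢ st) (≤-trans (≤-reflexive (masksˢ st)) z≤n))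

  runs-pre : ∀ m → RunsWithin preCode preTime m
  runs-pre m = _ , seq assignᴺ (seq assignᴺ (seq assignᴺ assignᴺ)) , const≤ (suc n) M preTime 4 2

  runs-power : ∀ m → RunsWithin powerCode powerTime m
  runs-power m = _ , assignᴺ , const≤ (suc n) M powerTime 4 2

  runs-input : RunsWithin wholeCode factor (input G A c)
  runs-input = runs-whole {preTime} {coeff countCode} {powerTime} {coeff mainCode} preCode countCode powerCode mainCode (input G A c) (runs-pre (input G A c))
    (runs-count (exec preCode (input G A c)) started) (runs-power (exec countCode (exec preCode (input G A c))))
    (runs-main (exec powerCode (exec countCode (exec preCode (input G A c)))) (prepared (exec preCode (input G A c)) started))

  sequence-rule₄ : ∀ (Q : Memory → Set) S₁ S₂ S₃ S₄ m → Q (exec S₄ (exec S₃ (exec S₂ (exec S₁ m)))) → Q (exec (S₁ ▹ S₂ ▹ S₃ ▹ S₄) m)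
  sequence-rule₄ Q S₁ S₂ S₃ S₄ m h = h

  answers : Answers (output (exec wholeCode (input G A c))) (Effectors G A ∞ c)
  answers = sequence-rule₄ (λ m → Answers (output m) (Effectors G A ∞ c)) preCode countCode powerCode mainCode (input G A c)
    (main-correct (exec powerCode (exec countCode (exec preCode (input G A c)))) (prepared (exec preCode (input G A c)) started))

  X≤ : 1 ≤ n → X ≤ 16 * (4 ^ #probabilistic G * n ^ 4)
  X≤ 1≤n = subst (λ r → X ≤ 16 * (4 ^ r * n ^ 4)) (#random≡#probabilistic G) (monomial≤ n (#random ws) 1≤n)

  Solution : Set
  Solution = Σ[ m ∈ Memory ] Σ[ t ∈ ℕ ]
    (compile wholeCode , input G A c ⇓ m , t)
    × Answers (output m) (Effectors G A ∞ c)
    × (1 ≤ n → t ≤ factor * 16 * (4 ^ #probabilistic G * n ^ 4))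

  solution : Solution
  solution = fromRun runs-input
    where
    fromRun : RunsWithin wholeCode factor (input G A c) → Solution
    fromRun (t , r , t≤) = exec wholeCode (input G A c) , t , r , answers ,
      λ 1≤n → *-≤-assoc (4 ^ #probabilistic G * n ^ 4) factor 16 t≤ (X≤ 1≤n)

theorem5 : (poly : List ℕ) →
    Σ[ P ∈ Program ] Σ[ K ∈ ℕ ]
    (∀ {n} (G : InfluenceGraph n) (A : Subset n) (c : ℚ) → PrecisionBoundedBy poly G →
    Σ[ m ∈ Memory ] Σ[ t ∈ ℕ ]
    (P , input G A c ⇓ m , t)
    × Answers (output m) (Effectors G A ∞ c)
    × (1 ≤ n → t ≤ K * (4 ^ #probabilistic G * n ^ 4)))
theorem5 poly = compile wholeCode , factor * 16 , λ G A c _ → Run.solution G A c
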